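{- Let $k\ge 3$ be an integer and let $\varepsilon\in(0,1)$. There is a constant $p_0=p_0(k,\varepsilon)$ (any sufficiently large constant in terms of $k$ and $\varepsilon$ will do) such that the following holds. Let $X_1,\dots,X_k,D\in[1,\infty)$ with $D\le \min(X_1,\dots,X_k)$, let $\delta\in(0,1]$, and let $A_i\subset[X_i,2X_i]$ ($1\le i\le k$) be sets of integers such that $\gcd(a_1,\dots,a_k)\ge D$ for at least $\delta\prod_{i=1}^k|A_i|$ tuples $(a_1,\dots,a_k)\in\prod_{i=1}^kA_i$. Then $$\prod_{i=1}^k|A_i|\le C_k^{\,1+\#\mathscr{P}_{\mathrm{small}}\left(\bigcup_{i=1}^kA_i\right)}\;\delta^{ -\frac{k+\varepsilon/(k-1)}{k-1}}\;\frac{\prod_{i=1}^kX_i}{D^k},\qquad C_k=2^{4k}.$$ In particular, $$\prod_{i=1}^k|A_i|\ll_{\varepsilon,k}\delta^{ -\frac{k}{k-1}-\varepsilon}\,\frac{\prod_{i=1}^kX_i}{D^k},$$ where the implied constant depends only on $k$ and $\varepsilon$.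
   Context: For a set $S$ of positive integers, $\mathscr{P}(S)$ denotes the set of primes dividing at least one element of $S$, and $\mathscr{P}_{\mathrm{small}}(S):=\{p\in\mathscr{P}(S):p\le p_0\}$. -}

module Defs where

open import Algebra.Bundles using (CommutativeRing)
open import Data.Bool.Base using (Bool; true; false; if_then_else_)
open import Data.Empty using (⊥-elim)
open import Data.Fin.Base using (Fin)
open import Data.Integer.Base as ℤ using (ℤ; +_; -[1+_])
import Data.Integer.Properties as ℤ
import Data.Integer.Tactic.RingSolver as ℤSolver
open import Data.List.Base as List using (List; length; filter; upTo; concat; tabulate)
open import Data.List.Membership.Propositional using (_∈_)
open import Data.List.Relation.Unary.All using (All)
open import Data.List.Relation.Unary.Any using (Any; any?)
open import Data.List.Relation.Unary.Unique.Propositional using (Unique)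
open import Data.Nat.Base as ℕ using (ℕ; zero; suc)
import Data.Nat.Coprimality as ℕ using (sym; 1-coprimeTo)
open import Data.Nat.Divisibility using (_∣_; _∣?_)
open import Data.Nat.GCD using (gcd)
open import Data.Nat.Primality using (Prime; prime?)
import Data.Nat.Properties as ℕ
open import Data.Product.Base using (∃-syntax; _×_; _,_; proj₁; proj₂)
open import Data.Rational.Base
open import Data.Rational.Properties
open import Data.Rational.Solver using (module +-*-Solver)
import Data.Rational.Unnormalised.Base as ℚᵘ
import Data.Rational.Unnormalised.Properties as ℚᵘ
open import Data.Sum.Base using (inj₁; inj₂)
open import Data.Vec.Base as Vec using (Vec; lookup)
import Data.Vec.Functional as Vector
open import Function.Base using (_∘_)
open import Relation.Binary.PropositionalEquality
  using (_≡_; refl; sym; trans; cong; cong₂; subst; subst₂)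
open import Relation.Nullary using (Dec; yes; no; ¬_; does)
open import Relation.Nullary.Decidable using (_×-dec_)
open import Algebra.Properties.CommutativeSemiring.Exp
  (CommutativeRing.commutativeSemiring +-*-commutativeRing)
  using (_^_; ^-homo-*; ^-assocʳ; ^-distrib-*)

open +-*-Solver using (solve; con; _:=_; _:+_; _:*_; _:-_; :-_)

ι : ℕ → ℚ
ι n = mkℚ (+ n) 0 (ℕ.sym (ℕ.1-coprimeTo n))

1/suc : ℕ → ℚ
1/suc n = mkℚ (+ 1) n (ℕ.1-coprimeTo (suc n))

ι-mono : ∀ {m n} → m ℕ.≤ n → ι m ≤ ι n
ι-mono {m} {n} m≤n = *≤* (ℤ.*-monoʳ-≤-nonNeg (+ 1) (ℤ.+≤+ m≤n))

ι-suc : ∀ n → ι (suc n) ≡ 1ℚ + ι n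
ι-suc n = toℚᵘ-injective (ℚᵘ.≃-sym (ℚᵘ.≃-trans (toℚᵘ-homo-+ 1ℚ (ι n)) (ℚᵘ.*≡* (lem (+ n)))))
  where
  lem : ∀ (i : ℤ) → (+ 1 ℤ.* + 1 ℤ.+ i ℤ.* + 1) ℤ.* + 1 ≡ (+ 1 ℤ.+ i) ℤ.* (+ 1 ℤ.* + 1)
  lem = ℤSolver.solve-∀

ι-* : ∀ m n → ι (m ℕ.* n) ≡ ι m * ι n
ι-* m n = toℚᵘ-injective (ℚᵘ.≃-sym (ℚᵘ.≃-trans (toℚᵘ-homo-* (ι m) (ι n))
  (ℚᵘ.*≡* (cong (ℤ._* + 1) (sym (ℤ.pos-* m n))))))

1/suc-inverse : ∀ n → ι (suc n) * 1/suc n ≡ 1ℚ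
1/suc-inverse n = toℚᵘ-injective (ℚᵘ.≃-trans (toℚᵘ-homo-* (ι (suc n)) (1/suc n)) (ℚᵘ.*≡* (lem (+ suc n))))
  where
  lem : ∀ (i : ℤ) → i ℤ.* + 1 ℤ.* + 1 ≡ + 1 ℤ.* (+ 1 ℤ.* i)
  lem = ℤSolver.solve-∀

0≤ι : ∀ n → 0ℚ ≤ ι n
0≤ι n = ι-mono ℕ.z≤n

0<1/suc : ∀ n → 0ℚ < 1/suc n
0<1/suc n = positive⁻¹ (1/suc n)

0<1 : 0ℚ < 1ℚ
0<1 = positive⁻¹ 1ℚ

0≤1 : 0ℚ ≤ 1ℚ
0≤1 = <⇒≤ 0<1

archimedean : ∀ p → ∃[ n ] p ≤ ι n
archimedean (mkℚ (+ n) d c) = n , *≤* (ℤ.*-monoˡ-≤-nonNeg (+ n) (ℤ.+≤+ (ℕ.s≤s ℕ.z≤n)))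
archimedean p@(mkℚ -[1+ n ] d c) = 0 , <⇒≤ (negative⁻¹ p)

p≤∣p∣ : ∀ p → p ≤ ∣ p ∣
p≤∣p∣ p with ≤-total 0ℚ p
... | inj₁ 0≤p = ≤-reflexive (sym (0≤p⇒∣p∣≡p 0≤p))
... | inj₂ p≤0 = ≤-trans p≤0 (0≤∣p∣ p)

∣∣-lub : ∀ {p e} → p ≤ e → - p ≤ e → ∣ p ∣ ≤ e
∣∣-lub {p} p≤e -p≤e with ∣p∣≡p∨∣p∣≡-p p
... | inj₁ eq rewrite eq = p≤e
... | inj₂ eq rewrite eq = -p≤e

∣-∣-sym : ∀ p q → ∣ p - q ∣ ≡ ∣ q - p ∣
∣-∣-sym p q = trans (sym (∣-p∣≡∣p∣ (p - q)))
  (cong ∣_∣ (solve 2 (λ p q → :- (p :- q) := q :- p) refl p q))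

∣∣⇒≤+ : ∀ {p q e} → ∣ p - q ∣ ≤ e → p ≤ q + e
∣∣⇒≤+ {p} {q} {e} h = subst (_≤ q + e) (solve 2 (λ p q → q :+ (p :- q) := p) refl p q)
  (+-monoʳ-≤ q (≤-trans (p≤∣p∣ (p - q)) h))

≤+⇒-≤ : ∀ {p q e} → p ≤ q + e → p - q ≤ e
≤+⇒-≤ {p} {q} {e} h = subst (p - q ≤_) (solve 2 (λ q e → q :+ e :- q := e) refl q e)
  (+-monoˡ-≤ (- q) h)

*-monoˡ-≤ : ∀ {r p q} → 0ℚ ≤ r → p ≤ q → r * p ≤ r * q
*-monoˡ-≤ {r} 0≤r = *-monoˡ-≤-nonNeg r {{nonNegative 0≤r}}

*-monoʳ-≤ : ∀ {r p q} → 0ℚ ≤ r → p ≤ q → p * r ≤ q * r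
*-monoʳ-≤ {r} 0≤r = *-monoʳ-≤-nonNeg r {{nonNegative 0≤r}}

*-mono-≤ : ∀ {a b c d} → 0ℚ ≤ a → 0ℚ ≤ d → a ≤ b → c ≤ d → a * c ≤ b * d
*-mono-≤ 0≤a 0≤d a≤b c≤d = ≤-trans (*-monoˡ-≤ 0≤a c≤d) (*-monoʳ-≤ 0≤d a≤b)

*-monoˡ-< : ∀ {r p q} → 0ℚ < r → p < q → r * p < r * q
*-monoˡ-< {r} 0<r = *-monoʳ-<-pos r {{positive 0<r}}

*-cancelˡ-≤ : ∀ {r p q} → 0ℚ < r → r * p ≤ r * q → p ≤ q
*-cancelˡ-≤ {r} 0<r = *-cancelˡ-≤-pos r {{positive 0<r}}

0≤* : ∀ {p q} → 0ℚ ≤ p → 0ℚ ≤ q → 0ℚ ≤ p * q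
0≤* {p} {q} 0≤p 0≤q = subst (_≤ p * q) (*-zeroʳ p) (*-monoˡ-≤ 0≤p 0≤q)

0<* : ∀ {p q} → 0ℚ < p → 0ℚ < q → 0ℚ < p * q
0<* {p} {q} 0<p 0<q = subst (_< p * q) (*-zeroʳ p) (*-monoˡ-< 0<p 0<q)

0≤+ : ∀ {p q} → 0ℚ ≤ p → 0ℚ ≤ q → 0ℚ ≤ p + q
0≤+ = +-mono-≤

-- Only the values at p ≠ 0 matter.
inv : ℚ → ℚ
inv (mkℚ (+ zero) _ _)      = 0ℚ
inv p@(mkℚ (+ suc _) _ _)   = 1/ p
inv p@(mkℚ -[1+ _ ] _ _)    = 1/ p

inv-inverse : ∀ {p} → 0ℚ < p → p * inv p ≡ 1ℚ
inv-inverse {p} 0<p = lem p (positive 0<p)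
  where
  lem : ∀ p → Positive p → p * inv p ≡ 1ℚ
  lem p@(mkℚ (+ suc _) _ _) _ = *-inverseʳ p

0<inv : ∀ {p} → 0ℚ < p → 0ℚ < inv p
0<inv {p} 0<p = lem p (positive 0<p)
  where
  lem : ∀ p → Positive p → 0ℚ < inv p
  lem p@(mkℚ (+ suc _) _ _) _ = positive⁻¹ (1/ p)

inv-anti : ∀ {p q} → 0ℚ < p → p ≤ q → inv q ≤ inv p
inv-anti {p} {q} 0<p p≤q = *-cancelˡ-≤ 0<p (*-cancelˡ-≤ 0<q
  (subst₂ _≤_ (sym l) (sym r) p≤q))
  where
  0<q = <-≤-trans 0<p p≤q
  l : q * (p * inv q) ≡ p
  l = trans (solve 3 (λ q p i → q :* (p :* i) := p :* (q :* i)) refl q p (inv q))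
        (trans (cong (p *_) (inv-inverse 0<q)) (*-identityʳ p))
  r : q * (p * inv p) ≡ q
  r = trans (cong (q *_) (inv-inverse 0<p)) (*-identityʳ q)

^-nonNeg : ∀ {x} n → 0ℚ ≤ x → 0ℚ ≤ x ^ n
^-nonNeg zero    0≤x = 0≤1
^-nonNeg (suc n) 0≤x = 0≤* 0≤x (^-nonNeg n 0≤x)

^-pos : ∀ {x} n → 0ℚ < x → 0ℚ < x ^ n
^-pos zero    0<x = 0<1
^-pos (suc n) 0<x = 0<* 0<x (^-pos n 0<x)

^-mono-≤ : ∀ {x y} n → 0ℚ ≤ x → x ≤ y → x ^ n ≤ y ^ n
^-mono-≤ zero    0≤x x≤y = ≤-refl
^-mono-≤ (suc n) 0≤x x≤y =
  *-mono-≤ 0≤x (^-nonNeg n (≤-trans 0≤x x≤y)) x≤y (^-mono-≤ n 0≤x x≤y)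

^-mono-< : ∀ {x y} n → 1 ℕ.≤ n → 0ℚ ≤ x → x < y → x ^ n < y ^ n
^-mono-< {x} {y} (suc n) _ 0≤x x<y = ≤-<-trans
  (*-monoˡ-≤ 0≤x (^-mono-≤ n 0≤x (<⇒≤ x<y)))
  (subst₂ _<_ (*-comm _ x) (*-comm _ y) (*-monoˡ-< (^-pos n (≤-<-trans 0≤x x<y)) x<y))

1^n≡1 : ∀ n → 1ℚ ^ n ≡ 1ℚ
1^n≡1 zero    = refl
1^n≡1 (suc n) = trans (*-identityˡ _) (1^n≡1 n)

1≤^ : ∀ {x} n → 1ℚ ≤ x → 1ℚ ≤ x ^ n
1≤^ {x} n 1≤x = subst (_≤ x ^ n) (1^n≡1 n) (^-mono-≤ n 0≤1 1≤x)

^-monoʳ-≤ : ∀ {x m n} → 1ℚ ≤ x → m ℕ.≤ n → x ^ m ≤ x ^ n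
^-monoʳ-≤ {x} {n = n} 1≤x ℕ.z≤n = 1≤^ n 1≤x
^-monoʳ-≤ 1≤x (ℕ.s≤s m≤n) = *-monoˡ-≤ (≤-trans 0≤1 1≤x) (^-monoʳ-≤ 1≤x m≤n)

bernoulli : ∀ {t} n → 0ℚ ≤ t → 1ℚ + ι n * t ≤ (1ℚ + t) ^ n
bernoulli {t} zero 0≤t = ≤-reflexive (trans (cong (λ z → 1ℚ + z) (*-zeroˡ t)) (+-identityʳ 1ℚ))
bernoulli {t} (suc n) 0≤t = ≤-trans
  (subst₂ _≤_ l r (+-monoʳ-≤ (1ℚ + ι (suc n) * t) (0≤* (0≤* (0≤ι n) 0≤t) 0≤t)))
  (*-monoˡ-≤ (0≤+ 0≤1 0≤t) (bernoulli n 0≤t))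
  where
  l = +-identityʳ (1ℚ + ι (suc n) * t)
  r : 1ℚ + ι (suc n) * t + ι n * t * t ≡ (1ℚ + t) * (1ℚ + ι n * t)
  r rewrite ι-suc n = solve 2 (λ i t → con 1ℚ :+ (con 1ℚ :+ i) :* t :+ i :* t :* t
    := (con 1ℚ :+ t) :* (con 1ℚ :+ i :* t)) refl (ι n) t

3ℚ : ℚ
3ℚ = 1ℚ + 1ℚ + 1ℚ

1≤3 : 1ℚ ≤ 3ℚ
1≤3 = *≤* (ℤ.+≤+ (ℕ.s≤s ℕ.z≤n))

bernoulli-upper : ∀ {v} n → 0ℚ ≤ v → v ≤ 1ℚ → (1ℚ + v) ^ n ≤ 1ℚ + 3ℚ ^ n * v
bernoulli-upper {v} zero 0≤v v≤1 =
  subst (_≤ 1ℚ + 1ℚ * v) (+-identityʳ 1ℚ) (+-monoʳ-≤ 1ℚ (0≤* 0≤1 0≤v))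
bernoulli-upper {v} (suc n) 0≤v v≤1 = ≤-trans
  (*-monoˡ-≤ (0≤+ 0≤1 0≤v) (bernoulli-upper n 0≤v v≤1))
  (subst₂ _≤_ l r (+-mono-≤ (+-mono-≤ (≤-refl {1ℚ + P * v}) a) b))
  where
  P = 3ℚ ^ n
  0≤P = ^-nonNeg n (≤-trans 0≤1 1≤3)
  a : v ≤ P * v
  a = subst (_≤ P * v) (*-identityˡ v) (*-monoʳ-≤ 0≤v (1≤^ n 1≤3))
  b : P * v * v ≤ P * v
  b = subst (P * v * v ≤_) (*-identityʳ _) (*-monoˡ-≤ (0≤* 0≤P 0≤v) v≤1)
  l : 1ℚ + P * v + v + P * v * v ≡ (1ℚ + v) * (1ℚ + P * v)
  l = solve 2 (λ P v → con 1ℚ :+ P :* v :+ v :+ P :* v :* v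
    := (con 1ℚ :+ v) :* (con 1ℚ :+ P :* v)) refl P v
  r : 1ℚ + P * v + P * v + P * v ≡ 1ℚ + 3ℚ * P * v
  r = solve 2 (λ P v → con 1ℚ :+ P :* v :+ P :* v :+ P :* v
    := con 1ℚ :+ (con 1ℚ :+ con 1ℚ :+ con 1ℚ) :* P :* v) refl P v

-- Comparing rational powers:  x^(p/q)  for  x > 0  is handled through the
-- inequalities  γ^q · x^(p⁻) ≤ x^(p⁺),  i.e.  γ ≤ x^(p/q)

infix 30 _⁺ _⁻

_⁺ _⁻ : ℤ → ℕ
(+ n)    ⁺ = n
-[1+ n ] ⁺ = 0
(+ n)    ⁻ = 0
-[1+ n ] ⁻ = suc n

⁺-⁻ : ∀ p → p ≡ + (p ⁺) ℤ.- + (p ⁻)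
⁺-⁻ (+ n)    = sym (ℤ.+-identityʳ (+ n))
⁺-⁻ -[1+ n ] = refl

⁺+⁻ : ∀ p → p ⁺ ℕ.+ p ⁻ ≡ ℤ.∣ p ∣
⁺+⁻ (+ n)    = ℕ.+-identityʳ n
⁺+⁻ -[1+ n ] = refl

^-near : ∀ {B V y} K Q m n → 0ℚ ≤ B → 0ℚ < y → y ≤ B → 1ℚ ≤ B * y → 1ℚ ≤ V → B ≤ V ^ K →
         K ℕ.* m ℕ.≤ K ℕ.* n ℕ.+ Q → K ℕ.* n ℕ.≤ K ℕ.* m ℕ.+ Q →
         y ^ m ≤ V ^ Q * y ^ n
^-near {B} {V} {y} K Q m n 0≤B 0<y y≤B 1≤By 1≤V B≤V^K m≲n n≲m = go (ℕ.≤-total m n)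
  where
  0≤V^Q = ≤-trans 0≤1 (1≤^ Q 1≤V)
  0≤y^ : ∀ n → 0ℚ ≤ y ^ n
  0≤y^ n = <⇒≤ (^-pos n 0<y)
  gap : ∀ j → K ℕ.* j ℕ.≤ Q → B ^ j ≤ V ^ Q
  gap j h = ≤-trans (^-mono-≤ j 0≤B B≤V^K)
    (≤-trans (≤-reflexive (^-assocʳ V K j)) (^-monoʳ-≤ 1≤V h))
  small : ∀ {m n j} → n ≡ m ℕ.+ j → K ℕ.* n ℕ.≤ K ℕ.* m ℕ.+ Q → K ℕ.* j ℕ.≤ Q
  small {m} {n} {j} refl h =
    ℕ.+-cancelˡ-≤ (K ℕ.* m) _ _ (subst (ℕ._≤ K ℕ.* m ℕ.+ Q) (ℕ.*-distribˡ-+ K m j) h)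
  go : _ → y ^ m ≤ V ^ Q * y ^ n
  go (inj₁ m≤n) = subst (_≤ V ^ Q * y ^ n) (*-identityˡ (y ^ m))
    (≤-trans (*-monoʳ-≤ (0≤y^ m) (≤-trans (1≤^ j 1≤By) (≤-reflexive (^-distrib-* B y j))))
      (≤-trans (*-monoʳ-≤ (0≤y^ m) (*-monoʳ-≤ (0≤y^ j) (gap j (small eq n≲m))))
        (≤-reflexive (trans (solve 3 (λ w a b → w :* a :* b := w :* (b :* a)) refl (V ^ Q) (y ^ j) (y ^ m))
           (cong (λ z → V ^ Q * z) (trans (sym (^-homo-* y m j)) (cong (y ^_) (sym eq))))))))
    where
    j = n ℕ.∸ m
    eq : n ≡ m ℕ.+ j
    eq = sym (ℕ.m+[n∸m]≡n m≤n)
  go (inj₂ n≤m) = ≤-trans (≤-reflexive (trans (cong (y ^_) eq) (trans (^-homo-* y n j) (*-comm (y ^ n) (y ^ j)))))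
    (*-monoʳ-≤ (0≤y^ n) (≤-trans (^-mono-≤ j (<⇒≤ 0<y) y≤B) (gap j (small eq m≲n))))
    where
    j = m ℕ.∸ n
    eq : m ≡ n ℕ.+ j
    eq = sym (ℕ.m+[n∸m]≡n n≤m)

-- x^((a-c)/q) ≤ V² · y^((d-b)/r)  for nearby x, y and nearby exponents
^-compare : ∀ {B V u x y γ δ} K M a c q d b r →
  0ℚ ≤ B → 0ℚ < x → 0ℚ < y → y ≤ B → 1ℚ ≤ B * y →
  1ℚ ≤ u → x ≤ u * y → y ≤ u * x → u ^ M ≤ V → 1ℚ ≤ V → B ≤ V ^ K →
  1 ℕ.≤ q → a ℕ.+ c ℕ.≤ M ℕ.* q →
  K ℕ.* (a ℕ.* r ℕ.+ b ℕ.* q) ℕ.≤ K ℕ.* (c ℕ.* r ℕ.+ d ℕ.* q) ℕ.+ q ℕ.* r →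
  K ℕ.* (c ℕ.* r ℕ.+ d ℕ.* q) ℕ.≤ K ℕ.* (a ℕ.* r ℕ.+ b ℕ.* q) ℕ.+ q ℕ.* r →
  0ℚ ≤ γ → 0ℚ ≤ δ → γ ^ q * x ^ c ≤ x ^ a → y ^ d < δ ^ r * y ^ b →
  γ ≤ V * V * δ
^-compare {B} {V} {u} {x} {y} {γ} {δ} K M a c q d b r
  0≤B 0<x 0<y y≤B 1≤By 1≤u x≤uy y≤ux u^M≤V 1≤V B≤V^K 1≤q a+c≤Mq near₁ near₂ 0≤γ 0≤δ γ-low δ-high =
  ≮⇒≥ λ VVδ<γ → <-irrefl refl (<-≤-trans (lower VVδ<γ) upper)
  where
  Q  = q ℕ.* r
  Xa = x ^ (a ℕ.* r)
  Xc = x ^ (c ℕ.* r)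
  Yd = y ^ (d ℕ.* q)
  Yb = y ^ (b ℕ.* q)
  W  = V ^ Q * V ^ Q
  Δ  = δ ^ Q
  0≤V = ≤-trans 0≤1 1≤V
  0≤u = ≤-trans 0≤1 1≤u
  0<V^Q = <-≤-trans 0<1 (1≤^ Q 1≤V)
  0<W : 0ℚ < W
  0<W = 0<* 0<V^Q 0<V^Q
  0<Xc : 0ℚ < Xc
  0<Xc = ^-pos (c ℕ.* r) 0<x

  s₁ : V * V * δ < γ → W * Δ * Xc ≤ Xa
  s₁ lt = ≤-trans
    (*-monoʳ-≤ (<⇒≤ 0<Xc) (≤-trans
      (≤-reflexive (trans (cong (_* Δ) (sym (^-distrib-* V V Q))) (sym (^-distrib-* (V * V) δ Q))))
      (^-mono-≤ Q (0≤* (0≤* 0≤V 0≤V) 0≤δ) (<⇒≤ lt))))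
    (≤-trans (≤-reflexive (trans (cong₂ _*_ (sym (^-assocʳ γ q r)) (sym (^-assocʳ x c r)))
                                 (sym (^-distrib-* (γ ^ q) (x ^ c) r))))
      (≤-trans (^-mono-≤ r (0≤* (^-nonNeg q 0≤γ) (<⇒≤ (^-pos c 0<x))) γ-low)
        (≤-reflexive (^-assocʳ x a r))))

  s₂ : Yd < Δ * Yb
  s₂ = subst₂ _<_ (^-assocʳ y d q)
    (trans (^-distrib-* (δ ^ r) (y ^ b) q)
      (cong₂ _*_ (trans (^-assocʳ δ r q) (cong (δ ^_) (ℕ.*-comm r q))) (^-assocʳ y b q)))
    (^-mono-< q 1≤q (<⇒≤ (^-pos d 0<y)) δ-high)

  lower : V * V * δ < γ → W * Xc * Yd < Xa * Yb
  lower lt = <-≤-trans (*-monoˡ-< (0<* 0<W 0<Xc) s₂)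
    (≤-trans (≤-reflexive (solve 4 (λ w c d b → w :* c :* (d :* b) := w :* d :* c :* b) refl W Xc Δ Yb))
      (*-monoʳ-≤ (<⇒≤ (^-pos (b ℕ.* q) 0<y)) (s₁ lt)))

  Ya = y ^ (a ℕ.* r)
  Yc = y ^ (c ℕ.* r)
  Ua = u ^ (a ℕ.* r)
  Uc = u ^ (c ℕ.* r)
  0≤Ua = ^-nonNeg (a ℕ.* r) 0≤u
  0≤Uc = ^-nonNeg (c ℕ.* r) 0≤u
  0≤Yb = <⇒≤ (^-pos (b ℕ.* q) 0<y)
  0≤Yd = <⇒≤ (^-pos (d ℕ.* q) 0<y)

  xa : Xa ≤ Ua * Ya
  xa = ≤-trans (^-mono-≤ (a ℕ.* r) (<⇒≤ 0<x) x≤uy) (≤-reflexive (^-distrib-* u y (a ℕ.* r)))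
  yc : Yc ≤ Uc * Xc
  yc = ≤-trans (^-mono-≤ (c ℕ.* r) (<⇒≤ 0<y) y≤ux) (≤-reflexive (^-distrib-* u x (c ℕ.* r)))
  yy : Ya * Yb ≤ V ^ Q * (Yc * Yd)
  yy = subst₂ _≤_ (^-homo-* y (a ℕ.* r) (b ℕ.* q))
    (cong (λ z → V ^ Q * z) (^-homo-* y (c ℕ.* r) (d ℕ.* q)))
    (^-near K Q (a ℕ.* r ℕ.+ b ℕ.* q) (c ℕ.* r ℕ.+ d ℕ.* q) 0≤B 0<y y≤B 1≤By 1≤V B≤V^K near₁ near₂)
  uu : Ua * Uc ≤ V ^ Q
  uu = ≤-trans (≤-reflexive (sym (^-homo-* u (a ℕ.* r) (c ℕ.* r))))
    (≤-trans (^-monoʳ-≤ 1≤u (subst₂ ℕ._≤_ (ℕ.*-distribʳ-+ r a c) (ℕ.*-assoc M q r) (ℕ.*-monoˡ-≤ r a+c≤Mq)))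
      (≤-trans (≤-reflexive (sym (^-assocʳ u M Q))) (^-mono-≤ Q (^-nonNeg M 0≤u) u^M≤V)))

  upper : Xa * Yb ≤ W * Xc * Yd
  upper = ≤-trans (*-monoʳ-≤ 0≤Yb xa)
    (≤-trans (≤-reflexive (*-assoc Ua Ya Yb))
      (≤-trans (*-monoˡ-≤ 0≤Ua yy)
        (≤-trans (*-monoˡ-≤ 0≤Ua (*-monoˡ-≤ (<⇒≤ 0<V^Q) (*-monoʳ-≤ 0≤Yd yc)))
          (≤-trans (≤-reflexive (solve 5 (λ ua w uc xc yd → ua :* (w :* (uc :* xc :* yd)) := ua :* uc :* (w :* xc :* yd))
                     refl Ua (V ^ Q) Uc Xc Yd))
            (≤-trans (*-monoʳ-≤ (0≤* (0≤* (<⇒≤ 0<V^Q) (<⇒≤ 0<Xc)) 0≤Yd) uu)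
              (≤-reflexive (solve 3 (λ w xc yd → w :* (w :* xc :* yd) := w :* w :* xc :* yd)
                 refl (V ^ Q) Xc Yd)))))))

^-bound : ∀ {B x γ} M a c q → 1ℚ ≤ B → 0ℚ < x → x ≤ B → 1ℚ ≤ B * x → 1 ℕ.≤ q →
          a ℕ.+ c ℕ.≤ M ℕ.* q → 0ℚ ≤ γ → γ ^ q * x ^ c ≤ x ^ a → γ ≤ B ^ M
^-bound {B} {x} {γ} M a c q 1≤B 0<x x≤B 1≤Bx 1≤q a+c≤Mq 0≤γ h =
  ≮⇒≥ λ lt → <-irrefl refl (<-≤-trans (^-mono-< q 1≤q (^-nonNeg M 0≤B) lt) upper)
  where
  0≤B = ≤-trans 0≤1 1≤B
  upper : γ ^ q ≤ (B ^ M) ^ q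
  upper = ≤-trans
    (subst (_≤ γ ^ q * (B ^ c * x ^ c)) (*-identityʳ (γ ^ q))
      (*-monoˡ-≤ (^-nonNeg q 0≤γ) (≤-trans (1≤^ c 1≤Bx) (≤-reflexive (^-distrib-* B x c)))))
    (≤-trans (≤-reflexive (solve 3 (λ g b x → g :* (b :* x) := g :* x :* b) refl (γ ^ q) (B ^ c) (x ^ c)))
      (≤-trans (*-monoʳ-≤ (^-nonNeg c 0≤B) (≤-trans h (^-mono-≤ a (<⇒≤ 0<x) x≤B)))
        (≤-trans (≤-reflexive (sym (^-homo-* B a c)))
          (≤-trans (^-monoʳ-≤ 1≤B a+c≤Mq) (≤-reflexive (sym (^-assocʳ B M q)))))))

-- translating  |p/q - p′/r| ≤ 1/(k+1)
exponent-near : ∀ (α β : ℚ) k → α ≤ β + 1/suc k →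
  suc k ℕ.* ((↥ α) ⁺ ℕ.* ↧ₙ β ℕ.+ (↥ β) ⁻ ℕ.* ↧ₙ α) ℕ.≤
  suc k ℕ.* ((↥ α) ⁻ ℕ.* ↧ₙ β ℕ.+ (↥ β) ⁺ ℕ.* ↧ₙ α) ℕ.+ ↧ₙ α ℕ.* ↧ₙ β
exponent-near α@(mkℚ p q-1 _) β@(mkℚ p′ r-1 _) k α≤β+ = ℤ.drop‿+≤+ (subst₂ ℤ._≤_ (sym L) (sym R)
    (ℤ.≤-trans (ℤ.≤-reflexive l) (ℤ.≤-trans (ℤ.+-monoˡ-≤ S ineq) (ℤ.≤-reflexive r′))))
  where
  q = suc q-1
  r = suc r-1
  K = suc k
  S : ℤ
  S = + K ℤ.* (+ (p ⁻) ℤ.* + r ℤ.+ + (p′ ⁻) ℤ.* + q)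
  ineq : p ℤ.* (+ r ℤ.* + K) ℤ.≤ (p′ ℤ.* + K ℤ.+ + 1 ℤ.* + r) ℤ.* + q
  ineq = ℚᵘ.drop-*≤* (ℚᵘ.≤-trans (toℚᵘ-mono-≤ α≤β+) (ℚᵘ.≤-reflexive (toℚᵘ-homo-+ β (1/suc k))))
  cast : ∀ a b x y → + (a ℕ.* x ℕ.+ b ℕ.* y) ≡ + a ℤ.* + x ℤ.+ + b ℤ.* + y
  cast a b x y = trans (ℤ.pos-+ (a ℕ.* x) (b ℕ.* y)) (cong₂ ℤ._+_ (ℤ.pos-* a x) (ℤ.pos-* b y))
  L : + (K ℕ.* (p ⁺ ℕ.* r ℕ.+ p′ ⁻ ℕ.* q)) ≡ + K ℤ.* (+ (p ⁺) ℤ.* + r ℤ.+ + (p′ ⁻) ℤ.* + q)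
  L = trans (ℤ.pos-* K (p ⁺ ℕ.* r ℕ.+ p′ ⁻ ℕ.* q)) (cong (+ K ℤ.*_) (cast (p ⁺) (p′ ⁻) r q))
  R : + (K ℕ.* (p ⁻ ℕ.* r ℕ.+ p′ ⁺ ℕ.* q) ℕ.+ q ℕ.* r) ≡
      + K ℤ.* (+ (p ⁻) ℤ.* + r ℤ.+ + (p′ ⁺) ℤ.* + q) ℤ.+ + q ℤ.* + r
  R = trans (ℤ.pos-+ (K ℕ.* (p ⁻ ℕ.* r ℕ.+ p′ ⁺ ℕ.* q)) (q ℕ.* r)) (cong₂ ℤ._+_
    (trans (ℤ.pos-* K (p ⁻ ℕ.* r ℕ.+ p′ ⁺ ℕ.* q)) (cong (+ K ℤ.*_) (cast (p ⁻) (p′ ⁺) r q)))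
    (ℤ.pos-* q r))
  alg₁ : ∀ (K a c b q r : ℤ) → K ℤ.* (a ℤ.* r ℤ.+ b ℤ.* q) ≡
    (a ℤ.- c) ℤ.* (r ℤ.* K) ℤ.+ K ℤ.* (c ℤ.* r ℤ.+ b ℤ.* q)
  alg₁ = ℤSolver.solve-∀
  alg₂ : ∀ (K c d b q r : ℤ) →
    ((d ℤ.- b) ℤ.* K ℤ.+ + 1 ℤ.* r) ℤ.* q ℤ.+ K ℤ.* (c ℤ.* r ℤ.+ b ℤ.* q) ≡
    K ℤ.* (c ℤ.* r ℤ.+ d ℤ.* q) ℤ.+ q ℤ.* r
  alg₂ = ℤSolver.solve-∀
  l : + K ℤ.* (+ (p ⁺) ℤ.* + r ℤ.+ + (p′ ⁻) ℤ.* + q) ≡ p ℤ.* (+ r ℤ.* + K) ℤ.+ S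
  l = trans (alg₁ (+ K) (+ (p ⁺)) (+ (p ⁻)) (+ (p′ ⁻)) (+ q) (+ r))
        (cong (λ z → z ℤ.* (+ r ℤ.* + K) ℤ.+ S) (sym (⁺-⁻ p)))
  r′ : (p′ ℤ.* + K ℤ.+ + 1 ℤ.* + r) ℤ.* + q ℤ.+ S ≡
       + K ℤ.* (+ (p ⁻) ℤ.* + r ℤ.+ + (p′ ⁺) ℤ.* + q) ℤ.+ + q ℤ.* + r
  r′ = trans (cong (λ z → (z ℤ.* + K ℤ.+ + 1 ℤ.* + r) ℤ.* + q ℤ.+ S) (⁺-⁻ p′))
        (alg₂ (+ K) (+ (p ⁻)) (+ (p′ ⁺)) (+ (p′ ⁻)) (+ q) (+ r))

exponent-size : ∀ (α : ℚ) M → ∣ α ∣ ≤ ι M → (↥ α) ⁺ ℕ.+ (↥ α) ⁻ ℕ.≤ M ℕ.* ↧ₙ α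
exponent-size (mkℚ p d _) M (*≤* h) = subst (ℕ._≤ M ℕ.* suc d) (sym (⁺+⁻ p))
  (ℤ.drop‿+≤+ (subst₂ ℤ._≤_ (ℤ.*-identityʳ (+ ℤ.∣ p ∣)) (sym (ℤ.pos-* M (suc d))) h))

greatest : (ℕ → Bool) → ℕ → ℕ
greatest P zero    = 0
greatest P (suc b) = if P (suc b) then suc b else greatest P b

greatest-true : ∀ (P : ℕ → Bool) (b : ℕ) → P 0 ≡ true → P (greatest P b) ≡ true
greatest-true P zero    P0 = P0
greatest-true P (suc b) P0 with P (suc b) in eq
... | true  = eq
... | false = greatest-true P b P0

greatest-max : ∀ (P : ℕ → Bool) (b : ℕ) → P (suc b) ≡ false → P (suc (greatest P b)) ≡ false
greatest-max P zero    h = h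
greatest-max P (suc b) h with P (suc b) in eq
... | true  = h
... | false = greatest-max P b eq

-- γ ≤ x^α  for rational x > 0 and rational α
below-power : (x α γ : ℚ) → Dec (γ ^ ↧ₙ α * x ^ ((↥ α) ⁻) ≤ x ^ ((↥ α) ⁺))
below-power x α γ = _ ≤? _

-- (n+1) x^α rounded down, provided that x > 0 and x^α < n+1
rootStep : ℕ → ℚ → ℚ → ℕ
rootStep n x α = greatest (λ c → does (below-power x α (ι c * 1/suc n))) (suc n ℕ.* suc n)

approxPower : ℕ → ℚ → ℚ → ℚ
approxPower n x α = ι (rootStep n x α) * 1/suc n

does-true : ∀ {A : Set} (d : Dec A) → does d ≡ true → A
does-true (yes a) _ = a

does-false : ∀ {A : Set} (d : Dec A) → does d ≡ false → ¬ A
does-false (no ¬a) _ = ¬a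

true-does : ∀ {A : Set} (d : Dec A) → A → does d ≡ true
true-does (yes _) _ = refl
true-does (no ¬a) a = ⊥-elim (¬a a)

false-does : ∀ {A : Set} (d : Dec A) → ¬ A → does d ≡ false
false-does (yes a) ¬a = ⊥-elim (¬a a)
false-does (no _)  _  = refl

approxPower-lower : ∀ n x α → 0ℚ ≤ x →
  approxPower n x α ^ ↧ₙ α * x ^ ((↥ α) ⁻) ≤ x ^ ((↥ α) ⁺)
approxPower-lower n x α 0≤x =
  does-true (below-power x α (approxPower n x α))
    (greatest-true P (suc n ℕ.* suc n) (true-does (below-power x α (ι 0 * 1/suc n)) zero-below))
  where
  P : ℕ → Bool
  P c = does (below-power x α (ι c * 1/suc n))
  zero-power : ∀ {z} m → z ≡ 0ℚ → z ^ suc m ≡ 0ℚ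
  zero-power m refl = *-zeroˡ (0ℚ ^ m)
  zero-below : (ι 0 * 1/suc n) ^ ↧ₙ α * x ^ ((↥ α) ⁻) ≤ x ^ ((↥ α) ⁺)
  zero-below = subst (_≤ x ^ ((↥ α) ⁺))
    (sym (trans (cong (_* x ^ ((↥ α) ⁻)) (zero-power (ℚ.denominator-1 α) (*-zeroˡ (1/suc n))))
      (*-zeroˡ (x ^ ((↥ α) ⁻)))))
    (^-nonNeg ((↥ α) ⁺) 0≤x)

approxPower-nonNeg : ∀ n x α → 0ℚ ≤ approxPower n x α
approxPower-nonNeg n x α = 0≤* (0≤ι (rootStep n x α)) (<⇒≤ (0<1/suc n))

grid-step : ∀ c n → ι (suc c) * 1/suc n ≡ ι c * 1/suc n + 1/suc n
grid-step c n = trans (cong (_* 1/suc n) (ι-suc c))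
  (solve 2 (λ c r → (con 1ℚ :+ c) :* r := c :* r :+ r) refl (ι c) (1/suc n))

grid-top : ∀ n → ι n < ι (suc (suc n ℕ.* suc n)) * 1/suc n
grid-top n = <-≤-trans
  (subst₂ _<_ (+-identityˡ (ι n)) (sym (ι-suc n)) (+-monoˡ-< (ι n) 0<1))
  (≤-trans (≤-reflexive (sym (trans (cong (_* 1/suc n) (ι-* (suc n) (suc n)))
      (trans (*-assoc (ι (suc n)) (ι (suc n)) (1/suc n))
        (trans (cong (λ z → ι (suc n) * z) (1/suc-inverse n)) (*-identityʳ (ι (suc n))))))))
    (*-monoʳ-≤ (<⇒≤ (0<1/suc n)) (ι-mono (ℕ.n≤1+n (suc n ℕ.* suc n)))))

approxPower-upper : ∀ n x α {B} M → 1ℚ ≤ B → 0ℚ < x → x ≤ B → 1ℚ ≤ B * x →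
  ∣ α ∣ ≤ ι M → B ^ M ≤ ι n →
  x ^ ((↥ α) ⁺) < (approxPower n x α + 1/suc n) ^ ↧ₙ α * x ^ ((↥ α) ⁻)
approxPower-upper n x α {B} M 1≤B 0<x x≤B 1≤Bx size B^M≤n = ≰⇒>
  (subst (λ z → ¬ (z ^ ↧ₙ α * x ^ ((↥ α) ⁻) ≤ x ^ ((↥ α) ⁺))) (grid-step (rootStep n x α) n)
    (does-false (below-power x α (ι (suc (rootStep n x α)) * 1/suc n))
      (greatest-max P (suc n ℕ.* suc n) (false-does (below-power x α (ι b * 1/suc n)) top))))
  where
  P : ℕ → Bool
  P c = does (below-power x α (ι c * 1/suc n))
  b = suc (suc n ℕ.* suc n)
  top : ¬ ((ι b * 1/suc n) ^ ↧ₙ α * x ^ ((↥ α) ⁻) ≤ x ^ ((↥ α) ⁺))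
  top h = <-irrefl refl (<-≤-trans (grid-top n) (≤-trans
    (^-bound M ((↥ α) ⁺) ((↥ α) ⁻) (↧ₙ α) 1≤B 0<x x≤B 1≤Bx (ℕ.s≤s ℕ.z≤n) (exponent-size α M size)
      (0≤* (0≤ι b) (<⇒≤ (0<1/suc n))) h) B^M≤n))

-- Real numbers: Cauchy sequences of rationals.  Equality of reals is
-- x ≤ᴿ y × y ≤ᴿ x; propositional equality is finer and is not used.  As in
-- constructive analysis, x <ᴿ y carries a positive rational gap.

Cauchy : (ℕ → ℚ) → Set
Cauchy s = ∀ e → 0ℚ < e → ∃[ N ] (∀ m n → N ℕ.≤ m → N ℕ.≤ n → ∣ s m - s n ∣ ≤ e)

record ℝ : Set where
  constructor mkℝ
  field
    seq    : ℕ → ℚ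
    cauchy : Cauchy seq

open ℝ public

infix  4 _≤ᴿ_ _<ᴿ_
infixl 6 _+ᴿ_
infixl 7 _*ᴿ_ _÷ᴿ_
infix  8 -ᴿ_
infixr 8 _^ᴿ_

_≤ᴿ_ _<ᴿ_ : ℝ → ℝ → Set
x ≤ᴿ y = ∀ e → 0ℚ < e → ∃[ N ] (∀ n → N ℕ.≤ n → seq x n ≤ seq y n + e)
x <ᴿ y = ∃[ e ] 0ℚ < e × ∃[ N ] (∀ n → N ℕ.≤ n → seq x n + e ≤ seq y n)

⊔-left : ∀ m n {i} → m ℕ.⊔ n ℕ.≤ i → m ℕ.≤ i
⊔-left m n = ℕ.≤-trans (ℕ.m≤m⊔n m n)

⊔-right : ∀ m n {i} → m ℕ.⊔ n ℕ.≤ i → n ℕ.≤ i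
⊔-right m n = ℕ.≤-trans (ℕ.m≤n⊔m m n)

½*-pos : ∀ {e} → 0ℚ < e → 0ℚ < ½ * e
½*-pos = 0<* (positive⁻¹ ½)

½+½ : ∀ e → ½ * e + ½ * e ≡ e
½+½ = solve 1 (λ e → con ½ :* e :+ con ½ :* e := e) refl

constᴿ : ℚ → ℝ
constᴿ q = mkℝ (λ _ → q) λ e 0<e → 0 , λ _ _ _ _ →
  ≤-trans (≤-reflexive (cong ∣_∣ (+-inverseʳ q))) (<⇒≤ 0<e)

fromℕ : ℕ → ℝ
fromℕ n = constᴿ (ι n)

0ᴿ 1ᴿ : ℝ
0ᴿ = fromℕ 0
1ᴿ = fromℕ 1

_+ᴿ_ : ℝ → ℝ → ℝ
x +ᴿ y = mkℝ (λ n → seq x n + seq y n) proof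
  where
  proof : Cauchy (λ n → seq x n + seq y n)
  proof e 0<e with cauchy x (½ * e) (½*-pos 0<e) | cauchy y (½ * e) (½*-pos 0<e)
  ... | N₁ , h₁ | N₂ , h₂ = N₁ ℕ.⊔ N₂ , λ m n N≤m N≤n → subst₂ _≤_
    (cong ∣_∣ (solve 4 (λ a b c d → a :- c :+ (b :- d) := a :+ b :- (c :+ d)) refl
      (seq x m) (seq y m) (seq x n) (seq y n)))
    (½+½ e)
    (≤-trans (∣p+q∣≤∣p∣+∣q∣ (seq x m - seq x n) (seq y m - seq y n))
      (+-mono-≤ (h₁ m n (⊔-left N₁ N₂ N≤m) (⊔-left N₁ N₂ N≤n))
                (h₂ m n (⊔-right N₁ N₂ N≤m) (⊔-right N₁ N₂ N≤n))))

-ᴿ_ : ℝ → ℝ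
-ᴿ x = mkℝ (λ n → - seq x n) λ e 0<e → proj₁ (cauchy x e 0<e) , λ m n N≤m N≤n →
  subst (_≤ e) (trans (∣-∣-sym (seq x m) (seq x n))
      (cong ∣_∣ (solve 2 (λ a b → b :- a := :- a :- :- b) refl (seq x m) (seq x n))))
    (proj₂ (cauchy x e 0<e) m n N≤m N≤n)

eventually-bounded : ∀ x → ∃[ B ] 0ℚ < B × ∃[ N ] (∀ n → N ℕ.≤ n → ∣ seq x n ∣ ≤ B)
eventually-bounded x with cauchy x 1ℚ 0<1
... | N , h = ∣ seq x N ∣ + 1ℚ , +-mono-≤-< (0≤∣p∣ (seq x N)) 0<1 , N , λ n N≤n →
  subst (_≤ ∣ seq x N ∣ + 1ℚ) (cong ∣_∣ (solve 2 (λ a b → a :+ (b :- a) := b) refl (seq x N) (seq x n)))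
    (≤-trans (∣p+q∣≤∣p∣+∣q∣ (seq x N) (seq x n - seq x N))
      (+-monoʳ-≤ ∣ seq x N ∣ (h n N N≤n ℕ.≤-refl)))

*-close : ∀ {a b c d B C e} → 0ℚ < B → 0ℚ < C → 0ℚ < e → ∣ a ∣ ≤ B → ∣ d ∣ ≤ C →
  ∣ b - d ∣ ≤ e * inv (B + C) → ∣ a - c ∣ ≤ e * inv (B + C) → ∣ a * b - c * d ∣ ≤ e
*-close {a} {b} {c} {d} {B} {C} {e} 0<B 0<C 0<e a≤B d≤C bd ac = subst₂ _≤_
  (cong ∣_∣ (solve 4 (λ a b c d → a :* (b :- d) :+ d :* (a :- c) := a :* b :- c :* d) refl a b c d))
  total
  (≤-trans (∣p+q∣≤∣p∣+∣q∣ (a * (b - d)) (d * (a - c)))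
    (+-mono-≤
      (≤-trans (≤-reflexive (∣p*q∣≡∣p∣*∣q∣ a (b - d))) (*-mono-≤ (0≤∣p∣ a) 0≤e′ a≤B bd))
      (≤-trans (≤-reflexive (∣p*q∣≡∣p∣*∣q∣ d (a - c))) (*-mono-≤ (0≤∣p∣ d) 0≤e′ d≤C ac))))
  where
  0<S : 0ℚ < B + C
  0<S = +-mono-< 0<B 0<C
  0≤e′ : 0ℚ ≤ e * inv (B + C)
  0≤e′ = <⇒≤ (0<* 0<e (0<inv 0<S))
  total : B * (e * inv (B + C)) + C * (e * inv (B + C)) ≡ e
  total = trans (solve 4 (λ b c e i → b :* (e :* i) :+ c :* (e :* i) := e :* ((b :+ c) :* i)) refl B C e (inv (B + C)))
    (trans (cong (λ z → e * z) (inv-inverse 0<S)) (*-identityʳ e))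

_*ᴿ_ : ℝ → ℝ → ℝ
x *ᴿ y = mkℝ (λ n → seq x n * seq y n) proof
  where
  proof : Cauchy (λ n → seq x n * seq y n)
  proof e 0<e =
    let (B , 0<B , N₁ , bx) = eventually-bounded x
        (C , 0<C , N₂ , by) = eventually-bounded y
        0<e′ = 0<* 0<e (0<inv (+-mono-< 0<B 0<C))
        (N₃ , hx) = cauchy x (e * inv (B + C)) 0<e′
        (N₄ , hy) = cauchy y (e * inv (B + C)) 0<e′
    in (N₁ ℕ.⊔ N₂) ℕ.⊔ (N₃ ℕ.⊔ N₄) , λ m n N≤m N≤n →
      let m₁₂ = ⊔-left (N₁ ℕ.⊔ N₂) (N₃ ℕ.⊔ N₄) N≤m
          m₃₄ = ⊔-right (N₁ ℕ.⊔ N₂) (N₃ ℕ.⊔ N₄) N≤m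
          n₁₂ = ⊔-left (N₁ ℕ.⊔ N₂) (N₃ ℕ.⊔ N₄) N≤n
          n₃₄ = ⊔-right (N₁ ℕ.⊔ N₂) (N₃ ℕ.⊔ N₄) N≤n
      in *-close 0<B 0<C 0<e (bx m (⊔-left N₁ N₂ m₁₂)) (by n (⊔-right N₁ N₂ n₁₂))
        (hy m n (⊔-right N₃ N₄ m₃₄) (⊔-right N₃ N₄ n₃₄))
        (hx m n (⊔-left N₃ N₄ m₃₄) (⊔-left N₃ N₄ n₃₄))

eventually-positive : ∀ {x} → 0ᴿ <ᴿ x → ∃[ c ] 0ℚ < c × ∃[ N ] (∀ n → N ℕ.≤ n → c ≤ seq x n)
eventually-positive {x} (c , 0<c , N , h) =
  c , 0<c , N , λ n N≤n → subst (_≤ seq x n) (+-identityˡ c) (h n N≤n)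

inv-close : ∀ {a b c e} → 0ℚ < c → 0ℚ < e → c ≤ a → c ≤ b → ∣ b - a ∣ ≤ e * c * c →
  ∣ inv a - inv b ∣ ≤ e
inv-close {a} {b} {c} {e} 0<c 0<e c≤a c≤b h = subst₂ _≤_ (cong ∣_∣ key) total
  (≤-trans (≤-reflexive (trans (∣p*q∣≡∣p∣*∣q∣ (b - a) (i * j))
             (cong (λ z → ∣ b - a ∣ * z) (0≤p⇒∣p∣≡p 0≤ij))))
    (*-mono-≤ (0≤∣p∣ (b - a)) (0≤* 0≤ic 0≤ic) h
      (*-mono-≤ (<⇒≤ (0<inv 0<a)) 0≤ic (inv-anti 0<c c≤a) (inv-anti 0<c c≤b))))
  where
  i = inv a
  j = inv b
  0<a : 0ℚ < a
  0<a = <-≤-trans 0<c c≤a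
  0<b : 0ℚ < b
  0<b = <-≤-trans 0<c c≤b
  0≤ic : 0ℚ ≤ inv c
  0≤ic = <⇒≤ (0<inv 0<c)
  0≤ij : 0ℚ ≤ i * j
  0≤ij = 0≤* (<⇒≤ (0<inv 0<a)) (<⇒≤ (0<inv 0<b))
  key : (b - a) * (i * j) ≡ i - j
  key = trans (solve 4 (λ a b i j → (b :- a) :* (i :* j) := i :* (b :* j) :- j :* (a :* i)) refl a b i j)
    (cong₂ _-_ (trans (cong (λ z → i * z) (inv-inverse 0<b)) (*-identityʳ i))
               (trans (cong (λ z → j * z) (inv-inverse 0<a)) (*-identityʳ j)))
  total : e * c * c * (inv c * inv c) ≡ e
  total = trans (solve 3 (λ e c i → e :* c :* c :* (i :* i) := e :* (c :* i) :* (c :* i)) refl e c (inv c))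
    (trans (cong₂ (λ y z → e * y * z) (inv-inverse 0<c) (inv-inverse 0<c))
      (trans (*-identityʳ (e * 1ℚ)) (*-identityʳ e)))

invᴿ : (x : ℝ) → 0ᴿ <ᴿ x → ℝ
invᴿ x 0<x = mkℝ (λ n → inv (seq x n)) proof
  where
  proof : Cauchy (λ n → inv (seq x n))
  proof e 0<e =
    let (c , 0<c , N₁ , c≤x) = eventually-positive {x} 0<x
        (N₂ , hx) = cauchy x (e * c * c) (0<* (0<* 0<e 0<c) 0<c)
    in N₁ ℕ.⊔ N₂ , λ m n N≤m N≤n →
      inv-close 0<c 0<e (c≤x m (⊔-left N₁ N₂ N≤m)) (c≤x n (⊔-left N₁ N₂ N≤n))
        (hx n m (⊔-right N₁ N₂ N≤n) (⊔-right N₁ N₂ N≤m))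

_÷ᴿ_ : ℝ → (n : ℕ) .{{_ : ℕ.NonZero n}} → ℝ
x ÷ᴿ n = x *ᴿ constᴿ (+ 1 / n)

_/ᴿ_[_] : (x y : ℝ) → 0ᴿ <ᴿ y → ℝ
x /ᴿ y [ 0<y ] = x *ᴿ invᴿ y 0<y

_^ᴿ_ : ℝ → ℕ → ℝ
x ^ᴿ zero  = 1ᴿ
x ^ᴿ suc n = x *ᴿ x ^ᴿ n

1ᴿ≤⇒0ᴿ< : ∀ {x} → 1ᴿ ≤ᴿ x → 0ᴿ <ᴿ x
1ᴿ≤⇒0ᴿ< {x} 1≤x with 1≤x ½ (positive⁻¹ ½)
... | N , h = ½ , positive⁻¹ ½ , N , λ n N≤n →
  subst₂ _≤_ refl (solve 1 (λ a → a :+ con ½ :+ con (- ½) := a) refl (seq x n))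
    (+-monoˡ-≤ (- ½) (h n N≤n))

*ᴿ-pos : ∀ {x y} → 0ᴿ <ᴿ x → 0ᴿ <ᴿ y → 0ᴿ <ᴿ x *ᴿ y
*ᴿ-pos {x} {y} 0<x 0<y with eventually-positive {x} 0<x | eventually-positive {y} 0<y
... | a , 0<a , N₁ , hx | b , 0<b , N₂ , hy = a * b , 0<* 0<a 0<b , N₁ ℕ.⊔ N₂ , λ n N≤n →
  subst (_≤ seq x n * seq y n) (sym (+-identityˡ (a * b)))
    (*-mono-≤ (<⇒≤ 0<a) (<⇒≤ (<-≤-trans 0<b (hy n (⊔-right N₁ N₂ N≤n))))
      (hx n (⊔-left N₁ N₂ N≤n)) (hy n (⊔-right N₁ N₂ N≤n)))

^ᴿ-pos : ∀ {x} n → 0ᴿ <ᴿ x → 0ᴿ <ᴿ x ^ᴿ n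
^ᴿ-pos zero        0<x = 1ℚ , 0<1 , 0 , λ _ _ → ≤-refl
^ᴿ-pos {x} (suc n) 0<x = *ᴿ-pos {x} {x ^ᴿ n} 0<x (^ᴿ-pos {x} n 0<x)

choose-t : ∀ e R → 0ℚ < e → 0ℚ ≤ R → ∃[ t ] 0ℚ < t × t ≤ 1ℚ × ι 8 * R * t ≤ e
choose-t e R 0<e 0≤R = e * inv D , 0<t , t≤1 , 8Rt≤e
  where
  D = e + ι 8 * R
  0≤8R : 0ℚ ≤ ι 8 * R
  0≤8R = 0≤* (0≤ι 8) 0≤R
  0<D : 0ℚ < D
  0<D = +-mono-<-≤ 0<e 0≤8R
  0<t : 0ℚ < e * inv D
  0<t = 0<* 0<e (0<inv 0<D)
  Dt≡e : D * (e * inv D) ≡ e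
  Dt≡e = trans (solve 3 (λ d e i → d :* (e :* i) := e :* (d :* i)) refl D e (inv D))
    (trans (cong (λ z → e * z) (inv-inverse 0<D)) (*-identityʳ e))
  t≤1 : e * inv D ≤ 1ℚ
  t≤1 = subst (e * inv D ≤_) (inv-inverse 0<D) (*-monoʳ-≤ (<⇒≤ (0<inv 0<D))
    (subst (_≤ D) (+-identityʳ e) (+-monoʳ-≤ e 0≤8R)))
  8Rt≤e : ι 8 * R * (e * inv D) ≤ e
  8Rt≤e = subst (ι 8 * R * (e * inv D) ≤_) Dt≡e (*-monoʳ-≤ (<⇒≤ 0<t)
    (subst (_≤ D) (+-identityˡ (ι 8 * R)) (+-monoˡ-≤ (ι 8 * R) (<⇒≤ 0<e))))

choose-v : ∀ t M → 0ℚ < t → t ≤ 1ℚ → ∃[ v ] 0ℚ < v × (1ℚ + v) ^ M ≤ 1ℚ + t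
choose-v t M 0<t t≤1 = v , 0<v ,
  subst ((1ℚ + v) ^ M ≤_) (cong (λ z → 1ℚ + z) Lv≡t) (bernoulli-upper M (<⇒≤ 0<v) v≤1)
  where
  L = 3ℚ ^ M
  v = t * inv L
  1≤L : 1ℚ ≤ L
  1≤L = 1≤^ M 1≤3
  0<L : 0ℚ < L
  0<L = <-≤-trans 0<1 1≤L
  0<v : 0ℚ < v
  0<v = 0<* 0<t (0<inv 0<L)
  Lv≡t : L * v ≡ t
  Lv≡t = trans (solve 3 (λ d e i → d :* (e :* i) := e :* (d :* i)) refl L t (inv L))
    (trans (cong (λ z → t * z) (inv-inverse 0<L)) (*-identityʳ t))
  v≤1 : v ≤ 1ℚ
  v≤1 = ≤-trans (subst (_≤ L * v) (*-identityˡ v) (*-monoʳ-≤ (<⇒≤ 0<v) 1≤L))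
    (≤-trans (≤-reflexive Lv≡t) t≤1)

choose-k : ∀ B t → 0ℚ < t → ∃[ k ] B ≤ (1ℚ + t) ^ suc k
choose-k B t 0<t = let (k , B/t≤k) = archimedean (B * inv t) in k , ≤-trans
  (subst (_≤ ι (suc k) * t)
    (trans (*-assoc B (inv t) t) (trans (cong (λ z → B * z)
      (trans (*-comm (inv t) t) (inv-inverse 0<t))) (*-identityʳ B)))
    (*-monoʳ-≤ (<⇒≤ 0<t) (≤-trans B/t≤k (ι-mono (ℕ.n≤1+n k)))))
  (≤-trans (subst (_≤ 1ℚ + ι (suc k) * t) (+-identityˡ (ι (suc k) * t)) (+-monoˡ-≤ (ι (suc k) * t) 0≤1))
    (bernoulli (suc k) (<⇒≤ 0<t)))

choose-N : ∀ e → 0ℚ < e → ∃[ N ] (∀ n → N ℕ.≤ n → ι 8 * 1/suc n ≤ e)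
choose-N e 0<e = let (N , h) = archimedean (ι 8 * inv e) in N , λ n N≤n →
  subst₂ _≤_ (l n) (r n) (*-monoʳ-≤ (0≤* (<⇒≤ 0<e) (<⇒≤ (0<1/suc n)))
    (≤-trans h (ι-mono (ℕ.≤-trans N≤n (ℕ.n≤1+n n)))))
  where
  l : ∀ n → ι 8 * inv e * (e * 1/suc n) ≡ ι 8 * 1/suc n
  l n = trans (solve 4 (λ a i e r → a :* i :* (e :* r) := a :* r :* (e :* i)) refl (ι 8) (inv e) e (1/suc n))
    (trans (cong (λ z → ι 8 * 1/suc n * z) (inv-inverse 0<e)) (*-identityʳ (ι 8 * 1/suc n)))
  r : ∀ n → ι (suc n) * (e * 1/suc n) ≡ e
  r n = trans (solve 3 (λ i e r → i :* (e :* r) := e :* (i :* r)) refl (ι (suc n)) e (1/suc n))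
    (trans (cong (λ z → e * z) (1/suc-inverse n)) (*-identityʳ e))

ratio-to-difference : ∀ {σ τ ρ R t e} → 0ℚ ≤ t → t ≤ 1ℚ → 0ℚ ≤ σ → 0ℚ ≤ ρ → σ ≤ R →
  ι 8 * R * t ≤ e → ι 8 * ρ ≤ e → τ ≤ (1ℚ + t) * (1ℚ + t) * (σ + ρ) → τ - σ ≤ e
ratio-to-difference {σ} {τ} {ρ} {R} {t} {e} 0≤t t≤1 0≤σ 0≤ρ σ≤R 8Rt≤e 8ρ≤e h =
  ≤+⇒-≤ (≤-trans h (subst (_≤ σ + e) expand (+-monoʳ-≤ σ small)))
  where
  V = 1ℚ + t
  0≤V : 0ℚ ≤ V
  0≤V = 0≤+ 0≤1 0≤t
  0≤½ : 0ℚ ≤ ½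
  0≤½ = <⇒≤ (positive⁻¹ ½)
  tt≤t : t * t ≤ t
  tt≤t = subst (t * t ≤_) (*-identityʳ t) (*-monoˡ-≤ 0≤t t≤1)
  VV-1≤4t : t + t + t * t ≤ ι 4 * t
  VV-1≤4t = ≤-trans (subst (_≤ t + t + t + t) (+-identityʳ (t + t + t * t))
      (+-mono-≤ (+-monoʳ-≤ (t + t) tt≤t) 0≤t))
    (≤-reflexive (solve 1 (λ t → t :+ t :+ t :+ t := con (ι 4) :* t) refl t))
  V≤2 : V ≤ ι 2
  V≤2 = +-monoʳ-≤ 1ℚ t≤1
  VV≤4 : V * V ≤ ι 4
  VV≤4 = *-mono-≤ 0≤V (0≤ι 2) V≤2 V≤2
  part₁ : (t + t + t * t) * σ ≤ ½ * e
  part₁ = ≤-trans (*-mono-≤ (0≤+ (0≤+ 0≤t 0≤t) (0≤* 0≤t 0≤t)) (≤-trans 0≤σ σ≤R) VV-1≤4t σ≤R)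
    (≤-trans (≤-reflexive (solve 2 (λ t r → con (ι 4) :* t :* r := con ½ :* (con (ι 8) :* r :* t)) refl t R))
      (*-monoˡ-≤ 0≤½ 8Rt≤e))
  part₂ : V * V * ρ ≤ ½ * e
  part₂ = ≤-trans (*-monoʳ-≤ 0≤ρ VV≤4)
    (≤-trans (≤-reflexive (solve 1 (λ r → con (ι 4) :* r := con ½ :* (con (ι 8) :* r)) refl ρ))
      (*-monoˡ-≤ 0≤½ 8ρ≤e))
  small : (t + t + t * t) * σ + V * V * ρ ≤ e
  small = subst ((t + t + t * t) * σ + V * V * ρ ≤_) (½+½ e) (+-mono-≤ part₁ part₂)
  expand : σ + ((t + t + t * t) * σ + V * V * ρ) ≡ V * V * (σ + ρ)
  expand = solve 3 (λ s t r → s :+ ((t :+ t :+ t :* t) :* s :+ (con 1ℚ :+ t) :* (con 1ℚ :+ t) :* r)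
    := (con 1ℚ :+ t) :* (con 1ℚ :+ t) :* (s :+ r)) refl σ t ρ

record Good (B : ℚ) (M : ℕ) (e : ℚ) (n : ℕ) (x α : ℚ) : Set where
  field
    0<x  : 0ℚ < x
    x≤B  : x ≤ B
    1≤Bx : 1ℚ ≤ B * x
    α≤M  : ∣ α ∣ ≤ ι M
    R≤n  : B ^ M ≤ ι n
    8≤e  : ι 8 * 1/suc n ≤ e

approxPower-close : ∀ {B M e t v k m n x y α β} → 1ℚ ≤ B →
  0ℚ < t → t ≤ 1ℚ → ι 8 * B ^ M * t ≤ e → 0ℚ < v → (1ℚ + v) ^ M ≤ 1ℚ + t → B ≤ (1ℚ + t) ^ suc k →
  Good B M e m x α → Good B M e n y β →
  x ≤ (1ℚ + v) * y → y ≤ (1ℚ + v) * x → α ≤ β + 1/suc k → β ≤ α + 1/suc k →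
  approxPower m x α - approxPower n y β ≤ e
approxPower-close {B} {M} {e} {t} {v} {k} {m} {n} {x} {y} {α} {β}
  1≤B 0<t t≤1 8Rt≤e 0<v u^M≤V B≤V^K gx gy x≤uy y≤ux α≲β β≲α =
  ratio-to-difference (<⇒≤ 0<t) t≤1 0≤σ (<⇒≤ (0<1/suc n)) σ≤R 8Rt≤e (Good.8≤e gy) ratio
  where
  0≤B = ≤-trans 0≤1 1≤B
  p⁺ = (↥ α) ⁺
  p⁻ = (↥ α) ⁻
  q  = ↧ₙ α
  s⁺ = (↥ β) ⁺
  s⁻ = (↥ β) ⁻
  r  = ↧ₙ β
  1≤1+ : ∀ {z} → 0ℚ < z → 1ℚ ≤ 1ℚ + z
  1≤1+ {z} 0<z = subst (_≤ 1ℚ + z) (+-identityʳ 1ℚ) (+-monoʳ-≤ 1ℚ (<⇒≤ 0<z))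
  0≤σ : 0ℚ ≤ approxPower n y β
  0≤σ = approxPower-nonNeg n y β
  σ≤R : approxPower n y β ≤ B ^ M
  σ≤R = ^-bound M s⁺ s⁻ r 1≤B (Good.0<x gy) (Good.x≤B gy) (Good.1≤Bx gy) (ℕ.s≤s ℕ.z≤n)
    (exponent-size β M (Good.α≤M gy)) 0≤σ (approxPower-lower n y β (<⇒≤ (Good.0<x gy)))
  near₂ : suc k ℕ.* (p⁻ ℕ.* r ℕ.+ s⁺ ℕ.* q) ℕ.≤ suc k ℕ.* (p⁺ ℕ.* r ℕ.+ s⁻ ℕ.* q) ℕ.+ q ℕ.* r
  near₂ = subst₂ ℕ._≤_
    (cong (suc k ℕ.*_) (ℕ.+-comm (s⁺ ℕ.* q) (p⁻ ℕ.* r)))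
    (cong₂ ℕ._+_ (cong (suc k ℕ.*_) (ℕ.+-comm (s⁻ ℕ.* q) (p⁺ ℕ.* r))) (ℕ.*-comm r q))
    (exponent-near β α k β≲α)
  ratio : approxPower m x α ≤ (1ℚ + t) * (1ℚ + t) * (approxPower n y β + 1/suc n)
  ratio = ^-compare (suc k) M p⁺ p⁻ q s⁺ s⁻ r
    0≤B (Good.0<x gx) (Good.0<x gy) (Good.x≤B gy) (Good.1≤Bx gy)
    (1≤1+ 0<v) x≤uy y≤ux u^M≤V (1≤1+ 0<t) B≤V^K
    (ℕ.s≤s ℕ.z≤n) (exponent-size α M (Good.α≤M gx))
    (exponent-near α β k α≲β) near₂
    (approxPower-nonNeg m x α) (0≤+ 0≤σ (<⇒≤ (0<1/suc n)))
    (approxPower-lower m x α (<⇒≤ (Good.0<x gx)))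
    (approxPower-upper n y β M 1≤B (Good.0<x gy) (Good.x≤B gy) (Good.1≤Bx gy) (Good.α≤M gy) (Good.R≤n gy))

ratio-close : ∀ {x y v c} → 0ℚ < v → c ≤ y → ∣ x - y ∣ ≤ v * c → x ≤ (1ℚ + v) * y
ratio-close {x} {y} {v} {c} 0<v c≤y h = ≤-trans (∣∣⇒≤+ h)
  (≤-trans (+-monoʳ-≤ y (*-monoˡ-≤ (<⇒≤ 0<v) c≤y))
    (≤-reflexive (solve 2 (λ y v → y :+ v :* y := (con 1ℚ :+ v) :* y) refl y v)))

common-bound : ∀ x → 0ᴿ <ᴿ x → ∃[ c ] ∃[ B ] 0ℚ < c × 1ℚ ≤ B × 1ℚ ≤ B * c ×
  ∃[ N ] (∀ n → N ℕ.≤ n → c ≤ seq x n × seq x n ≤ B)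
common-bound x 0<x =
  let (c , 0<c , N₁ , c≤x) = eventually-positive {x} 0<x
      (A , 0<A , N₂ , x≤A) = eventually-bounded x
      (b , A+1/c≤b) = archimedean (A + inv c)
      sum≤B = ≤-trans A+1/c≤b (ι-mono (ℕ.n≤1+n b))
      A≤B = ≤-trans (subst (_≤ A + inv c) (+-identityʳ A) (+-monoʳ-≤ A (<⇒≤ (0<inv 0<c)))) sum≤B
      1/c≤B = ≤-trans (subst (_≤ A + inv c) (+-identityˡ (inv c)) (+-monoˡ-≤ (inv c) (<⇒≤ 0<A))) sum≤B
  in c , ι (suc b) , 0<c , ι-mono {1} {suc b} (ℕ.s≤s ℕ.z≤n) ,
     subst (_≤ ι (suc b) * c) (trans (*-comm (inv c) c) (inv-inverse 0<c)) (*-monoʳ-≤ (<⇒≤ 0<c) 1/c≤B) ,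
     N₁ ℕ.⊔ N₂ , λ n N≤n →
       c≤x n (⊔-left N₁ N₂ N≤n) ,
       ≤-trans (p≤∣p∣ (seq x n)) (≤-trans (x≤A n (⊔-right N₁ N₂ N≤n)) A≤B)

power-cauchy : ∀ x → 0ᴿ <ᴿ x → ∀ α → Cauchy (λ n → approxPower n (seq x n) (seq α n))
power-cauchy x 0<x α e 0<e =
  let (c , B , 0<c , 1≤B , 1≤Bc , N₁ , bx) = common-bound x 0<x
      (A , _ , N₂ , bα) = eventually-bounded α
      (M , A≤M) = archimedean A
      0≤B = ≤-trans 0≤1 1≤B
      (t , 0<t , t≤1 , 8Rt≤e) = choose-t e (B ^ M) 0<e (^-nonNeg M 0≤B)
      (v , 0<v , u^M≤V) = choose-v t M 0<t t≤1
      (k , B≤V^K) = choose-k B t 0<t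
      (N₃ , cx) = cauchy x (v * c) (0<* 0<v 0<c)
      (N₄ , cα) = cauchy α (1/suc k) (0<1/suc k)
      (N₅ , R≤N₅) = archimedean (B ^ M)
      (N₆ , 8≤) = choose-N e 0<e
      N₁₂ = N₁ ℕ.⊔ N₂
      N₃₄ = N₃ ℕ.⊔ N₄
      N₅₆ = N₅ ℕ.⊔ N₆
      N₁₄ = N₁₂ ℕ.⊔ N₃₄
      h₁ = λ n (h : N₁₄ ℕ.⊔ N₅₆ ℕ.≤ n) → ⊔-left N₁ N₂ (⊔-left N₁₂ N₃₄ (⊔-left N₁₄ N₅₆ h))
      h₂ = λ n (h : N₁₄ ℕ.⊔ N₅₆ ℕ.≤ n) → ⊔-right N₁ N₂ (⊔-left N₁₂ N₃₄ (⊔-left N₁₄ N₅₆ h))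
      h₃ = λ n (h : N₁₄ ℕ.⊔ N₅₆ ℕ.≤ n) → ⊔-left N₃ N₄ (⊔-right N₁₂ N₃₄ (⊔-left N₁₄ N₅₆ h))
      h₄ = λ n (h : N₁₄ ℕ.⊔ N₅₆ ℕ.≤ n) → ⊔-right N₃ N₄ (⊔-right N₁₂ N₃₄ (⊔-left N₁₄ N₅₆ h))
      h₅ = λ n (h : N₁₄ ℕ.⊔ N₅₆ ℕ.≤ n) → ⊔-left N₅ N₆ (⊔-right N₁₄ N₅₆ h)
      h₆ = λ n (h : N₁₄ ℕ.⊔ N₅₆ ℕ.≤ n) → ⊔-right N₅ N₆ (⊔-right N₁₄ N₅₆ h)
      good : ∀ n → N₁₄ ℕ.⊔ N₅₆ ℕ.≤ n → Good B M e n (seq x n) (seq α n)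
      good n h = record
        { 0<x  = <-≤-trans 0<c (proj₁ (bx n (h₁ n h)))
        ; x≤B  = proj₂ (bx n (h₁ n h))
        ; 1≤Bx = ≤-trans 1≤Bc (*-monoˡ-≤ 0≤B (proj₁ (bx n (h₁ n h))))
        ; α≤M  = ≤-trans (bα n (h₂ n h)) A≤M
        ; R≤n  = ≤-trans R≤N₅ (ι-mono (h₅ n h))
        ; 8≤e  = 8≤ n (h₆ n h)
        }
      one-sided : ∀ m n → N₁₄ ℕ.⊔ N₅₆ ℕ.≤ m → N₁₄ ℕ.⊔ N₅₆ ℕ.≤ n →
        approxPower m (seq x m) (seq α m) - approxPower n (seq x n) (seq α n) ≤ e
      one-sided m n hm hn = approxPower-close 1≤B 0<t t≤1 8Rt≤e 0<v u^M≤V B≤V^K (good m hm) (good n hn)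
        (ratio-close 0<v (proj₁ (bx n (h₁ n hn))) (cx m n (h₃ m hm) (h₃ n hn)))
        (ratio-close 0<v (proj₁ (bx m (h₁ m hm))) (cx n m (h₃ n hn) (h₃ m hm)))
        (∣∣⇒≤+ (cα m n (h₄ m hm) (h₄ n hn)))
        (∣∣⇒≤+ (cα n m (h₄ n hn) (h₄ m hm)))
  in N₁₄ ℕ.⊔ N₅₆ , λ m n hm hn → ∣∣-lub (one-sided m n hm hn)
       (subst (_≤ e) (solve 2 (λ a b → b :- a := :- (a :- b)) refl
           (approxPower m (seq x m) (seq α m)) (approxPower n (seq x n) (seq α n)))
         (one-sided n m hn hm))

-- Real powers x^α, x > 0:  the limit of the rational powers xₙ^αₙ, the n-th
-- of which is rounded down to a multiple of 1/(n+1).  The finitely many n at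
-- which xₙ ≤ 0, or xₙ^αₙ leaves the search range, do not affect the limit.
_^ᴿ[_]_ : (x : ℝ) → 0ᴿ <ᴿ x → ℝ → ℝ
x ^ᴿ[ 0<x ] α = mkℝ (λ n → approxPower n (seq x n) (seq α n)) (power-cauchy x 0<x α)

-- Only sets contained in some [X , 2X] with X ≥ 1 occur, so ℕ suffices for
-- sets of integers.
record FiniteSet : Set where
  field
    elements : List ℕ
    unique   : Unique elements

open FiniteSet public

infix 4 _∈ˢ_

_∈ˢ_ : ℕ → FiniteSet → Set
a ∈ˢ S = a ∈ elements S

card : FiniteSet → ℕ
card S = length (elements S)

∏ : ∀ {k} → (Fin k → ℕ) → ℕ
∏ = Vector.foldr ℕ._*_ 1

∏ᴿ : ∀ {k} → (Fin k → ℝ) → ℝ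
∏ᴿ = Vector.foldr _*ᴿ_ 1ᴿ

gcds : ∀ {k} → Vec ℕ k → ℕ
gcds = Vec.foldr′ gcd 0

⋃ : ∀ {k} → (Fin k → FiniteSet) → List ℕ
⋃ A = concat (tabulate (λ i → elements (A i)))

𝒫 : List ℕ → ℕ → Set
𝒫 S p = Prime p × Any (p ∣_) S

𝒫? : ∀ S p → Dec (𝒫 S p)
𝒫? S p = prime? p ×-dec any? (p ∣?_) S

#𝒫small : ℕ → List ℕ → ℕ
#𝒫small p₀ S = length (filter (𝒫? S) (upTo (suc p₀)))

-- "P holds for at least r elements of B", for real r.  Counting by a filter is
-- not possible since comparison of reals is not decidable.
AtLeast : {B : Set} → ℝ → (B → Set) → Set
AtLeast {B} r P = ∃[ T ] Unique {A = B} T × All P T × r ≤ᴿ fromℕ (length T)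

record Configuration (k : ℕ) : Set where
  field
    X     : Fin k → ℝ
    D δ   : ℝ
    A     : Fin k → FiniteSet
    1≤X   : ∀ i → 1ᴿ ≤ᴿ X i
    1≤D   : 1ᴿ ≤ᴿ D
    D≤X   : ∀ i → D ≤ᴿ X i
    0<δ   : 0ᴿ <ᴿ δ
    δ≤1   : δ ≤ᴿ 1ᴿ
    A⊂    : ∀ i {a} → a ∈ˢ A i → X i ≤ᴿ fromℕ a × fromℕ a ≤ᴿ fromℕ 2 *ᴿ X i
    large : AtLeast {Vec ℕ k} (δ *ᴿ fromℕ (∏ (λ i → card (A i))))
              (λ a → (∀ i → lookup a i ∈ˢ A i) × D ≤ᴿ fromℕ (gcds a))

  D^k>0 : 0ᴿ <ᴿ D ^ᴿ k
  D^k>0 = ^ᴿ-pos {D} k (1ᴿ≤⇒0ᴿ< {D} 1≤D)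

k-1≢0 : ∀ {k} → 3 ℕ.≤ k → ℕ.NonZero (k ℕ.∸ 1)
k-1≢0 (ℕ.s≤s (ℕ.s≤s (ℕ.s≤s _))) = _

{-# OPTIONS --safe #-}
module Submission where

-- For a prime p let i be the vector of p-adic valuations of a tuple t, m = min i and
-- d_j = i_j - m.  Write the exponent as u/v, with u = v + w, and consider
--   |T|^u ∏ c_j^v D^{kv} / (∏ |A_j|^w g^{kv}),
-- where c_j divides the elements of A_j and g carries the part of the gcds found so far.
-- Primes are treated in decreasing order: the tuples with given valuations i, with A_j cut down to
-- the elements of valuation i_j, satisfy the claim for the smaller primes, with c_j p^{i_j} and g p^m
-- in place of c_j and g; so do the tuples with given m, with A_j cut down to the multiples of p^m.
-- These bounds have the form  N_i ≤ Φ^{1/u} (∏ α_j(i_j)^w p^{-v Σ d_j})^{1/u}, where α_j is the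
-- distribution of the valuation on A_j, and by AM-GM the right hand side is at most Φ^{1/u} times a
-- rational number ω_i.  Summing the ω_i costs a factor 4^k for a small prime.  For a large prime it
-- costs nothing unless every A_j is concentrated on a common level m up to proportion O(1/p); then
-- the tuples with minimum m are bounded at no cost and the others contribute O(p^{-1-1/H}), so that
-- the losses of all large primes multiply to at most 2.
-- When no prime is left, gcd(t) ≤ g and |A_j| ≤ 2X_j/c_j.

open import Defs

-- What ε buys is kw ≥ u + 1. At the exponent k/(k-1) itself one has kw = u, AM-GM uses up all of ∏
-- α_j(i_j)^w, and this method would lose a factor 1 + O(1/p) at a concentrated large prime; the
-- product of such factors diverges. With kw > u one factor ∏ α_j(i_j) is left over after AM-GM, and
-- where it is O(1/p) it improves the loss to 1 + O(p^(-1-1/u)), weakened to 1 + O(p^(-1-1/H)) by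
-- rational constants. A second loss of order 1/p is not cured by ε. A vector with one entry i_j = m
-- + 1 and all others m has weight α_j(m+1)^(w/u) p^(-v/u), and this is 1/p when α_j(m+1) = 1/p. So
-- at a concentrated prime the tuples with minimum m must not be split any further, which is why the
-- claim is also applied to the multiples of p^m. Roots of order u are in general irrational, so
-- bounds are kept in the form x^u ≤ Φ a^u with rational x, Φ and a.

module Proof where

  open import Algebra.Bundles using (CommutativeRing)
  open import Data.Bool.Base using (true; false)
  open import Data.Empty using (⊥-elim)
  open import Data.Fin.Base as Fin using (Fin)
  import Data.Fin.Properties as Fin
  import Data.Integer.Base as ℤ
  import Data.Integer.Properties as ℤ
  import Data.Integer.Tactic.RingSolver as ℤSolver
  open import Data.List.Base as List using (List; []; _∷_; _++_; length; filter; upTo)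
  open import Data.List.Membership.Propositional using (_∈_; find; lose)
  open import Data.List.Membership.Propositional.Properties
    using ( ∈-upTo⁺; ∈-upTo⁻; ∈-cartesianProductWith⁺; ∈-cartesianProductWith⁻; ∈-filter⁺; ∈-filter⁻
          ; ∈-map⁺; ∈-concat⁺′; ∈-tabulate⁺)
  open import Data.List.Properties
    using (map-upTo; length-map; length-upTo; length-++; length-filter; upTo-∷ʳ; filter-++; filter-accept)
  import Data.List.Relation.Unary.All as All
  open import Data.List.Relation.Unary.AllPairs using (_∷_)
  open import Data.List.Relation.Unary.Any using (Any; any?; here; there)
  open import Data.List.Relation.Unary.Unique.Propositional using (Unique)
  open import Data.List.Relation.Unary.Unique.Propositional.Properties using (Unique[x∷xs]⇒x∉xs; filter⁺)
  open import Data.Nat.Base as ℕ using (ℕ; zero; suc)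
  open import Data.Nat.Coprimality using (Coprime; coprime-divisor)
  open import Data.Nat.Divisibility
  open import Data.Nat.DivMod using (m/n*n≤m; m*n/n≡m; /-mono-≤)
  open import Data.Nat.GCD using (gcd[m,n]∣m; gcd[m,n]∣n; gcd-greatest)
  open import Data.Nat.Primality
  import Data.Nat.Properties as ℕ
  open import Data.Product.Base using (∃-syntax; _×_; _,_; proj₁; proj₂)
  open import Data.Rational.Base
  open import Data.Rational.Properties
  open import Data.Rational.Solver using (module +-*-Solver)
  import Data.Rational.Unnormalised.Base as ℚᵘ
  import Data.Rational.Unnormalised.Properties as ℚᵘ
  open import Data.Sum.Base using (_⊎_; inj₁; inj₂; [_,_]′)
  open import Data.Vec.Base as Vec using (Vec; []; _∷_; lookup)
  import Data.Vec.Functional as Vector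
  open import Data.Vec.Properties using (≡-dec; lookup-map)
  open import Function.Base using (_∘_; id)
  open import Relation.Binary.Definitions using (DecidableEquality)
  open import Relation.Binary.PropositionalEquality
    using (_≡_; _≢_; refl; sym; trans; cong; cong₂; subst; subst₂)
  open import Relation.Nullary using (Dec; yes; no; does; ¬_)
  open import Relation.Nullary.Decidable using (toWitness; ¬?)

  open import Algebra.Properties.CommutativeSemiring.Exp
    (CommutativeRing.commutativeSemiring +-*-commutativeRing)
    using (_^_; ^-homo-*; ^-assocʳ; ^-distrib-*)
  open +-*-Solver using (solve; con; _:=_; _:+_; _:*_; _:-_; :-_)

  -- Rational sums and products

  ^-cancel-≤ : ∀ {x y} n → 1 ℕ.≤ n → 0ℚ ≤ y → x ^ n ≤ y ^ n → x ≤ y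
  ^-cancel-≤ n 1≤n 0≤y h = ≮⇒≥ λ y<x → <-irrefl refl (<-≤-trans (^-mono-< n 1≤n 0≤y y<x) h)

  ^-antiʳ-≤ : ∀ {x m n} → 0ℚ ≤ x → x ≤ 1ℚ → m ℕ.≤ n → x ^ n ≤ x ^ m
  ^-antiʳ-≤ {x} {n = n} 0≤x x≤1 ℕ.z≤n = subst (x ^ n ≤_) (1^n≡1 n) (^-mono-≤ n 0≤x x≤1)
  ^-antiʳ-≤ 0≤x x≤1 (ℕ.s≤s m≤n) = *-monoˡ-≤ 0≤x (^-antiʳ-≤ 0≤x x≤1 m≤n)

  ^≤1 : ∀ {x} n → 0ℚ ≤ x → x ≤ 1ℚ → x ^ n ≤ 1ℚ
  ^≤1 {x} n 0≤x x≤1 = ^-antiʳ-≤ {x} {0} {n} 0≤x x≤1 ℕ.z≤n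

  ^≤self : ∀ {x} n → 1 ℕ.≤ n → 0ℚ ≤ x → x ≤ 1ℚ → x ^ n ≤ x
  ^≤self {x} n 1≤n 0≤x x≤1 = subst (x ^ n ≤_) (*-identityʳ x) (^-antiʳ-≤ {x} {1} {n} 0≤x x≤1 1≤n)

  0≤-sq : ∀ x → 0ℚ ≤ x * x
  0≤-sq x with ≤-total 0ℚ x
  ... | inj₁ 0≤x = 0≤* 0≤x 0≤x
  ... | inj₂ x≤0 = subst (0ℚ ≤_) (solve 1 (λ x → :- x :* :- x := x :* x) refl x)
    (0≤* (neg-antimono-≤ x≤0) (neg-antimono-≤ x≤0))

  p≤q⇒0≤q-p : ∀ {p q} → p ≤ q → 0ℚ ≤ q - p
  p≤q⇒0≤q-p {p} {q} p≤q = subst (_≤ q - p) (+-inverseʳ p) (+-monoˡ-≤ (- p) p≤q)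

  0≤q-p⇒p≤q : ∀ {p q} → 0ℚ ≤ q - p → p ≤ q
  0≤q-p⇒p≤q {p} {q} h = subst₂ _≤_ (+-identityˡ p)
    (solve 2 (λ p q → q :- p :+ p := q) refl p q) (+-monoˡ-≤ p h)

  ≤-by-gap : ∀ {p q} g → 0ℚ ≤ g → q ≡ p + g → p ≤ q
  ≤-by-gap {p} {q} g 0≤g eq = subst₂ _≤_ (+-identityʳ p) (sym eq) (+-monoʳ-≤ p 0≤g)

  p≤p+q : ∀ {p q} → 0ℚ ≤ q → p ≤ p + q
  p≤p+q {p} {q} 0≤q = ≤-by-gap q 0≤q refl

  p≤q+p : ∀ {p q} → 0ℚ ≤ q → p ≤ q + p
  p≤q+p {p} {q} 0≤q = ≤-by-gap q 0≤q (+-comm q p)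

  *≤ˡ : ∀ {x y} → 0ℚ ≤ y → x ≤ 1ℚ → x * y ≤ y
  *≤ˡ {x} {y} 0≤y x≤1 = subst (x * y ≤_) (*-identityˡ y) (*-monoʳ-≤ 0≤y x≤1)

  *≤ʳ : ∀ {x y} → 0ℚ ≤ x → y ≤ 1ℚ → x * y ≤ x
  *≤ʳ {x} {y} 0≤x y≤1 = subst (x * y ≤_) (*-identityʳ x) (*-monoˡ-≤ 0≤x y≤1)

  *≤1 : ∀ {x y} → 0ℚ ≤ y → x ≤ 1ℚ → y ≤ 1ℚ → x * y ≤ 1ℚ
  *≤1 0≤y x≤1 y≤1 = ≤-trans (*≤ˡ 0≤y x≤1) y≤1

  -- Convexity of x ↦ x^(n+1): the graph lies above its tangent at y. The gap at n + 1 is x times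
  -- the gap at n plus (n+1) y^n (x - y)^2. Both AM-GM and Bernoulli's inequality are drawn from
  -- this.
  tangent : ∀ {x y} n → 0ℚ ≤ x → 0ℚ ≤ y → ι (suc n) * x * y ^ n ≤ x ^ suc n + ι n * y ^ suc n
  tangent {x} {y} zero 0≤x 0≤y = ≤-reflexive
    (solve 2 (λ x y → con 1ℚ :* x :* con 1ℚ := x :* con 1ℚ :+ con 0ℚ :* (y :* con 1ℚ)) refl x y)
  tangent {x} {y} (suc n) 0≤x 0≤y = 0≤q-p⇒p≤q (subst (0ℚ ≤_) eq
      (0≤+ (0≤* 0≤x (p≤q⇒0≤q-p (tangent n 0≤x 0≤y)))
           (0≤* (0≤* (0≤ι (suc n)) (^-nonNeg n 0≤y)) (0≤-sq (x - y)))))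
    where
    identity : ∀ X Y i {i₁ i₂} → i₁ ≡ 1ℚ + i → i₂ ≡ 1ℚ + i₁ →
      x * (x * X + i * (y * Y) - i₁ * x * Y) + i₁ * Y * ((x - y) * (x - y))
      ≡ x * (x * X) + i₁ * (y * (y * Y)) - i₂ * x * (y * Y)
    identity X Y i refl refl = solve 5 (λ x y X Y i →
        x :* (x :* X :+ i :* (y :* Y) :- (con 1ℚ :+ i) :* x :* Y) :+ (con 1ℚ :+ i) :* Y :* ((x :- y) :* (x :- y))
        := x :* (x :* X) :+ (con 1ℚ :+ i) :* (y :* (y :* Y)) :- (con 1ℚ :+ (con 1ℚ :+ i)) :* x :* (y :* Y))
      refl x y X Y i
    eq = identity (x ^ n) (y ^ n) (ι n) (ι-suc n) (ι-suc (suc n))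

  ∑ : ∀ {k} → (Fin k → ℚ) → ℚ
  ∑ = Vector.foldr _+_ 0ℚ

  Π : ∀ {k} → (Fin k → ℚ) → ℚ
  Π = Vector.foldr _*_ 1ℚ

  ∑-nonNeg : ∀ {k} {f : Fin k → ℚ} → (∀ j → 0ℚ ≤ f j) → 0ℚ ≤ ∑ f
  ∑-nonNeg {zero}  h = ≤-refl
  ∑-nonNeg {suc k} h = 0≤+ (h Fin.zero) (∑-nonNeg (h ∘ Fin.suc))

  ∑-mono : ∀ {k} {f g : Fin k → ℚ} → (∀ j → f j ≤ g j) → ∑ f ≤ ∑ g
  ∑-mono {zero}  h = ≤-refl
  ∑-mono {suc k} h = +-mono-≤ (h Fin.zero) (∑-mono (h ∘ Fin.suc))

  ∑-const : ∀ k c → ∑ {k} (λ _ → c) ≡ ι k * c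
  ∑-const zero    c = sym (*-zeroˡ c)
  ∑-const (suc k) c = trans (cong (c +_) (∑-const k c))
    (trans (solve 2 (λ i c → c :+ i :* c := (con 1ℚ :+ i) :* c) refl (ι k) c) (cong (_* c) (sym (ι-suc k))))

  ∑-term : ∀ {k} {f : Fin k → ℚ} → (∀ j → 0ℚ ≤ f j) → ∀ j → f j ≤ ∑ f
  ∑-term h Fin.zero    = p≤p+q (∑-nonNeg (h ∘ Fin.suc))
  ∑-term h (Fin.suc j) = ≤-trans (∑-term (h ∘ Fin.suc) j) (p≤q+p (h Fin.zero))

  ∑-*ˡ : ∀ {k} c (f : Fin k → ℚ) → ∑ (λ j → c * f j) ≡ c * ∑ f
  ∑-*ˡ {zero}  c f = sym (*-zeroʳ c)
  ∑-*ˡ {suc k} c f = trans (cong (c * f Fin.zero +_) (∑-*ˡ c (f ∘ Fin.suc)))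
    (sym (*-distribˡ-+ c (f Fin.zero) (∑ (f ∘ Fin.suc))))

  Π-nonNeg : ∀ {k} {f : Fin k → ℚ} → (∀ j → 0ℚ ≤ f j) → 0ℚ ≤ Π f
  Π-nonNeg {zero}  h = 0≤1
  Π-nonNeg {suc k} h = 0≤* (h Fin.zero) (Π-nonNeg (h ∘ Fin.suc))

  Π-pos : ∀ {k} {f : Fin k → ℚ} → (∀ j → 0ℚ < f j) → 0ℚ < Π f
  Π-pos {zero}  h = 0<1
  Π-pos {suc k} h = 0<* (h Fin.zero) (Π-pos (h ∘ Fin.suc))

  Π-mono : ∀ {k} {f g : Fin k → ℚ} → (∀ j → 0ℚ ≤ f j) → (∀ j → f j ≤ g j) → Π f ≤ Π g
  Π-mono {zero}  _   h = ≤-refl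
  Π-mono {suc k} 0≤f h = *-mono-≤ (0≤f Fin.zero)
    (Π-nonNeg (λ j → ≤-trans (0≤f (Fin.suc j)) (h (Fin.suc j))))
    (h Fin.zero) (Π-mono (0≤f ∘ Fin.suc) (h ∘ Fin.suc))

  Π-const : ∀ k c → Π {k} (λ _ → c) ≡ c ^ k
  Π-const zero    c = refl
  Π-const (suc k) c = cong (c *_) (Π-const k c)

  Π-≤1 : ∀ {k} {f : Fin k → ℚ} → (∀ j → 0ℚ ≤ f j) → (∀ j → f j ≤ 1ℚ) → Π f ≤ 1ℚ
  Π-≤1 {k} {f} 0≤f f≤1 = subst (Π f ≤_) (trans (Π-const k 1ℚ) (1^n≡1 k)) (Π-mono {k} {f} 0≤f f≤1)

  Π-≤factor : ∀ {k} {f : Fin k → ℚ} → (∀ j → 0ℚ ≤ f j) → (∀ j → f j ≤ 1ℚ) → ∀ j → Π f ≤ f j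
  Π-≤factor 0≤f f≤1 Fin.zero    = *≤ʳ (0≤f Fin.zero) (Π-≤1 (0≤f ∘ Fin.suc) (f≤1 ∘ Fin.suc))
  Π-≤factor 0≤f f≤1 (Fin.suc j) = ≤-trans
    (*≤ˡ (Π-nonNeg (0≤f ∘ Fin.suc)) (f≤1 Fin.zero)) (Π-≤factor (0≤f ∘ Fin.suc) (f≤1 ∘ Fin.suc) j)

  *-interchange : ∀ a b c d → a * b * (c * d) ≡ a * c * (b * d)
  *-interchange = solve 4 (λ a b c d → a :* b :* (c :* d) := a :* c :* (b :* d)) refl

  Π-* : ∀ {k} (f g : Fin k → ℚ) → Π (λ j → f j * g j) ≡ Π f * Π g
  Π-* {zero}  f g = refl
  Π-* {suc k} f g = trans (cong (f Fin.zero * g Fin.zero *_) (Π-* (f ∘ Fin.suc) (g ∘ Fin.suc)))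
    (*-interchange (f Fin.zero) (g Fin.zero) _ _)

  Π-cong : ∀ {k} {f g : Fin k → ℚ} → (∀ j → f j ≡ g j) → Π f ≡ Π g
  Π-cong {zero}  h = refl
  Π-cong {suc k} h = cong₂ _*_ (h Fin.zero) (Π-cong (h ∘ Fin.suc))

  ∑-cong : ∀ {k} {f g : Fin k → ℚ} → (∀ j → f j ≡ g j) → ∑ f ≡ ∑ g
  ∑-cong {zero}  h = refl
  ∑-cong {suc k} h = cong₂ _+_ (h Fin.zero) (∑-cong (h ∘ Fin.suc))

  -- For k = 0 the truncated subtraction gives the divisor 1, so `avg-sum` holds for every k.
  avg : ∀ {k} → (Fin k → ℚ) → ℚ
  avg {k} f = ∑ f * 1/suc (k ℕ.∸ 1)

  avg-nonNeg : ∀ {k} {f : Fin k → ℚ} → (∀ j → 0ℚ ≤ f j) → 0ℚ ≤ avg f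
  avg-nonNeg {k} h = 0≤* (∑-nonNeg h) (<⇒≤ (0<1/suc (k ℕ.∸ 1)))

  avg-sum : ∀ {k} (f : Fin k → ℚ) → ι k * avg f ≡ ∑ f
  avg-sum {zero}  f = refl
  avg-sum {suc k} f = trans (solve 3 (λ i s r → i :* (s :* r) := s :* (i :* r)) refl (ι (suc k)) (∑ f) (1/suc k))
    (trans (cong (∑ f *_) (1/suc-inverse k)) (*-identityʳ (∑ f)))

  -- Induction on k: the tail has some mean b and product at most b^k. Since (k+1) x = a + k b for
  -- the first term a, `tangent` at b turns into a b^k ≤ x^(k+1).
  am-gm-mean : ∀ {k} (f : Fin k → ℚ) x → (∀ j → 0ℚ ≤ f j) → 0ℚ ≤ x → ι k * x ≡ ∑ f → Π f ≤ x ^ k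
  am-gm-mean {zero}  f x 0≤f 0≤x eq = ≤-refl
  am-gm-mean {suc k} f x 0≤f 0≤x eq = ≤-trans
    (*-monoˡ-≤ (0≤f Fin.zero) (am-gm-mean (f ∘ Fin.suc) b (0≤f ∘ Fin.suc) 0≤b (avg-sum (f ∘ Fin.suc))))
    (0≤q-p⇒p≤q (subst (0ℚ ≤_) eq′ (p≤q⇒0≤q-p (tangent k 0≤x 0≤b))))
    where
    b = avg (f ∘ Fin.suc)
    0≤b = avg-nonNeg (0≤f ∘ Fin.suc)
    identity : ∀ X i B a {S} → S ≡ a + i * b → X + i * (b * B) - S * B ≡ X - a * B
    identity X i B a refl = solve 5 (λ X i b B a → X :+ i :* (b :* B) :- (a :+ i :* b) :* B := X :- a :* B) refl X i b B a
    eq′ = identity (x ^ suc k) (ι k) (b ^ k) (f Fin.zero)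
      (trans eq (cong (f Fin.zero +_) (sym (avg-sum (f ∘ Fin.suc)))))

  am-gm : ∀ {k} (f : Fin k → ℚ) → (∀ j → 0ℚ ≤ f j) → Π f ≤ avg f ^ k
  am-gm f 0≤f = am-gm-mean f (avg f) 0≤f (avg-nonNeg 0≤f) (avg-sum f)

  -- Indicators and sums over lists

  infix 6 ⟦_⟧
  ⟦_⟧ : ∀ {A : Set} → Dec A → ℚ
  ⟦ yes _ ⟧ = 1ℚ
  ⟦ no _ ⟧ = 0ℚ

  ⟦⟧-nonNeg : ∀ {A : Set} (d : Dec A) → 0ℚ ≤ ⟦ d ⟧
  ⟦⟧-nonNeg (yes _) = 0≤1
  ⟦⟧-nonNeg (no _) = ≤-refl

  ⟦⟧-≤1 : ∀ {A : Set} (d : Dec A) → ⟦ d ⟧ ≤ 1ℚ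
  ⟦⟧-≤1 (yes _) = ≤-refl
  ⟦⟧-≤1 (no _) = 0≤1

  ⟦⟧-yes : ∀ {A : Set} (d : Dec A) → A → ⟦ d ⟧ ≡ 1ℚ
  ⟦⟧-yes (yes _) _ = refl
  ⟦⟧-yes (no ¬a) a = ⊥-elim (¬a a)

  ⟦⟧-no : ∀ {A : Set} (d : Dec A) → ¬ A → ⟦ d ⟧ ≡ 0ℚ
  ⟦⟧-no (yes a) ¬a = ⊥-elim (¬a a)
  ⟦⟧-no (no _)  _  = refl

  Σ : ∀ {A : Set} → List A → (A → ℚ) → ℚ
  Σ []       f = 0ℚ
  Σ (x ∷ xs) f = f x + Σ xs f

  module _ {A : Set} where

    Σ-cong : ∀ (xs : List A) {f g : A → ℚ} → (∀ x → f x ≡ g x) → Σ xs f ≡ Σ xs g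
    Σ-cong []       h = refl
    Σ-cong (x ∷ xs) h = cong₂ _+_ (h x) (Σ-cong xs h)

    Σ-mono : ∀ (xs : List A) {f g : A → ℚ} → (∀ x → x ∈ xs → f x ≤ g x) → Σ xs f ≤ Σ xs g
    Σ-mono []       h = ≤-refl
    Σ-mono (x ∷ xs) h = +-mono-≤ (h x (here refl)) (Σ-mono xs (λ y y∈ → h y (there y∈)))

    Σ-nonNeg : ∀ (xs : List A) {f : A → ℚ} → (∀ x → 0ℚ ≤ f x) → 0ℚ ≤ Σ xs f
    Σ-nonNeg []       h = ≤-refl
    Σ-nonNeg (x ∷ xs) h = 0≤+ (h x) (Σ-nonNeg xs h)

    Σ-+ : ∀ (xs : List A) (f g : A → ℚ) → Σ xs (λ x → f x + g x) ≡ Σ xs f + Σ xs g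
    Σ-+ []       f g = refl
    Σ-+ (x ∷ xs) f g = trans (cong (f x + g x +_) (Σ-+ xs f g))
      (solve 4 (λ a b c d → a :+ b :+ (c :+ d) := a :+ c :+ (b :+ d)) refl (f x) (g x) (Σ xs f) (Σ xs g))

    Σ-*ˡ : ∀ (xs : List A) c (f : A → ℚ) → Σ xs (λ x → c * f x) ≡ c * Σ xs f
    Σ-*ˡ []       c f = sym (*-zeroʳ c)
    Σ-*ˡ (x ∷ xs) c f = trans (cong (c * f x +_) (Σ-*ˡ xs c f)) (sym (*-distribˡ-+ c (f x) (Σ xs f)))

    Σ-*ʳ : ∀ (xs : List A) c (f : A → ℚ) → Σ xs (λ x → f x * c) ≡ Σ xs f * c
    Σ-*ʳ xs c f = trans (Σ-cong xs (λ x → *-comm (f x) c)) (trans (Σ-*ˡ xs c f) (*-comm c (Σ xs f)))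

    Σ-0 : ∀ (xs : List A) → Σ xs (λ _ → 0ℚ) ≡ 0ℚ
    Σ-0 []       = refl
    Σ-0 (x ∷ xs) = trans (+-identityˡ _) (Σ-0 xs)

    Σ-1 : ∀ (xs : List A) → Σ xs (λ _ → 1ℚ) ≡ ι (length xs)
    Σ-1 []       = refl
    Σ-1 (x ∷ xs) = trans (cong (1ℚ +_) (Σ-1 xs)) (sym (ι-suc (length xs)))

    Σ-++ : ∀ (xs ys : List A) (f : A → ℚ) → Σ (xs ++ ys) f ≡ Σ xs f + Σ ys f
    Σ-++ []       ys f = sym (+-identityˡ _)
    Σ-++ (x ∷ xs) ys f = trans (cong (f x +_) (Σ-++ xs ys f)) (sym (+-assoc (f x) _ _))

    Σ-term : ∀ {xs : List A} {f : A → ℚ} → (∀ x → 0ℚ ≤ f x) → ∀ {x} → x ∈ xs → f x ≤ Σ xs f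
    Σ-term {y ∷ xs} h (here refl) = p≤p+q (Σ-nonNeg xs h)
    Σ-term {y ∷ xs} h (there x∈)  = ≤-trans (Σ-term h x∈) (p≤q+p (h y))

    Σ-∑ : ∀ {k} (xs : List A) (f : Fin k → A → ℚ) → Σ xs (λ x → ∑ (λ j → f j x)) ≡ ∑ (λ j → Σ xs (f j))
    Σ-∑ {zero}  xs f = Σ-0 xs
    Σ-∑ {suc k} xs f = trans (Σ-+ xs (f Fin.zero) (λ x → ∑ (λ j → f (Fin.suc j) x)))
      (cong (Σ xs (f Fin.zero) +_) (Σ-∑ xs (f ∘ Fin.suc)))

    Σ-map : ∀ {B : Set} (h : B → A) (xs : List B) (f : A → ℚ) → Σ (List.map h xs) f ≡ Σ xs (f ∘ h)
    Σ-map h []       f = refl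
    Σ-map h (x ∷ xs) f = cong (f (h x) +_) (Σ-map h xs f)

    Σ-swap : ∀ {B : Set} (xs : List A) (ys : List B) (f : A → B → ℚ) →
      Σ xs (λ x → Σ ys (f x)) ≡ Σ ys (λ y → Σ xs (λ x → f x y))
    Σ-swap []       ys f = sym (zeros ys)
      where
      zeros : ∀ ys → Σ ys (λ _ → 0ℚ) ≡ 0ℚ
      zeros []       = refl
      zeros (y ∷ ys) = trans (+-identityˡ _) (zeros ys)
    Σ-swap (x ∷ xs) ys f = trans (cong (Σ ys (f x) +_) (Σ-swap xs ys f)) (sym (lem ys))
      where
      lem : ∀ ys → Σ ys (λ y → f x y + Σ xs (λ x → f x y)) ≡ Σ ys (f x) + Σ ys (λ y → Σ xs (λ x → f x y))
      lem []       = refl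
      lem (y ∷ ys) = trans (cong (f x y + Σ xs (λ x → f x y) +_) (lem ys))
        (solve 4 (λ a b c d → a :+ b :+ (c :+ d) := a :+ c :+ (b :+ d)) refl (f x y) (Σ xs (λ x → f x y)) _ _)

    Σ-filter : ∀ {P : A → Set} (P? : ∀ x → Dec (P x)) (xs : List A) (f : A → ℚ) →
      Σ (filter P? xs) f ≡ Σ xs (λ x → ⟦ P? x ⟧ * f x)
    Σ-filter P? []       f = refl
    Σ-filter P? (x ∷ xs) f with P? x
    ... | yes _ = cong₂ _+_ (sym (*-identityˡ (f x))) (Σ-filter P? xs f)
    ... | no _  = trans (Σ-filter P? xs f) (sym (trans (cong (_+ _) (*-zeroˡ (f x))) (+-identityˡ _)))

  -- Closure under addition of  x ≤ Φ^(1/u) a,  where the root need not be rational.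
  ≼-+ : ∀ {Φ x y a b} u → 1 ℕ.≤ u → 0ℚ ≤ Φ → 0ℚ ≤ x → 0ℚ ≤ y → 0ℚ ≤ a → 0ℚ ≤ b →
    x ^ u ≤ Φ * a ^ u → y ^ u ≤ Φ * b ^ u → (x + y) ^ u ≤ Φ * (a + b) ^ u
  ≼-+ {Φ} {x} {y} {a} {b} u 1≤u 0≤Φ 0≤x 0≤y 0≤a 0≤b hx hy =
    [ half 0≤x 0≤a 0≤b 0≤y hx hy
    , (λ yb≤xa → subst₂ (λ s t → s ^ u ≤ Φ * t ^ u) (+-comm y x) (+-comm b a) (half 0≤y 0≤b 0≤a 0≤x hy hx yb≤xa)) ]′
    (≤-total (x * b) (y * a))
    where
    -- If x/a ≤ y/b, then the mediant (x+y)/(a+b) is at most y/b, which is at most Φ^(1/u).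
    -- Multiplying by b avoids the quotients; if b = 0, then y = 0 as well.
    half : ∀ {x y a b} → 0ℚ ≤ x → 0ℚ ≤ a → 0ℚ ≤ b → 0ℚ ≤ y → x ^ u ≤ Φ * a ^ u → y ^ u ≤ Φ * b ^ u →
           x * b ≤ y * a → (x + y) ^ u ≤ Φ * (a + b) ^ u
    half {x} {y} {a} {b} 0≤x 0≤a 0≤b 0≤y hx hy xb≤ya with 0ℚ <? b
    half {x} {y} {a} {b} 0≤x 0≤a 0≤b 0≤y hx hy xb≤ya | no b≤0 = subst₂ (λ s t → s ^ u ≤ Φ * t ^ u)
      (sym (trans (cong (x +_) y≡0) (+-identityʳ x))) (sym (trans (cong (a +_) b≡0) (+-identityʳ a))) hx
      where
      b≡0 : b ≡ 0ℚ
      b≡0 = ≤-antisym (≮⇒≥ b≤0) 0≤b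
      0^u≡0 : ∀ {u} → 1 ℕ.≤ u → 0ℚ ^ u ≡ 0ℚ
      0^u≡0 {suc u} (ℕ.s≤s _) = *-zeroˡ (0ℚ ^ u)
      y≡0 : y ≡ 0ℚ
      y≡0 = ≤-antisym (^-cancel-≤ u 1≤u ≤-refl (subst (y ^ u ≤_)
        (trans (cong (λ z → Φ * z) (trans (cong (_^ u) b≡0) (0^u≡0 1≤u)))
               (trans (*-zeroʳ Φ) (sym (0^u≡0 1≤u)))) hy)) 0≤y
    half {x} {y} {a} {b} 0≤x 0≤a 0≤b 0≤y hx hy xb≤ya | yes 0<b = *-cancelˡ-≤ (^-pos u 0<b) (≤-trans (≤-reflexive (sym (^-distrib-* b (x + y) u)))
      (≤-trans (^-mono-≤ u (0≤* 0≤b (0≤+ 0≤x 0≤y)) cross)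
        (≤-trans (≤-reflexive (^-distrib-* y (a + b) u))
          (≤-trans (*-monoʳ-≤ (^-nonNeg u (0≤+ 0≤a 0≤b)) hy)
            (≤-reflexive (solve 3 (λ p b c → p :* b :* c := b :* (p :* c)) refl Φ (b ^ u) ((a + b) ^ u)))))))
      where
      cross : b * (x + y) ≤ y * (a + b)
      cross = subst₂ _≤_ (solve 3 (λ x y b → x :* b :+ y :* b := b :* (x :+ y)) refl x y b)
        (sym (*-distribˡ-+ y a b)) (+-monoˡ-≤ (y * b) xb≤ya)

  -- Sums over vectors of exponents

  Σ-upTo-suc : ∀ n (f : ℕ → ℚ) → Σ (upTo (suc n)) f ≡ f 0 + Σ (upTo n) (f ∘ suc)
  Σ-upTo-suc n f = cong (f 0 +_) (trans (cong (λ xs → Σ xs f) (sym (map-upTo suc n))) (Σ-map suc (upTo n) f))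

  Σ-≼ : ∀ {A : Set} {Φ} u (xs : List A) (f g : A → ℚ) → 1 ℕ.≤ u → 0ℚ ≤ Φ →
    (∀ x → 0ℚ ≤ f x) → (∀ x → 0ℚ ≤ g x) → (∀ x → x ∈ xs → f x ^ u ≤ Φ * g x ^ u) →
    Σ xs f ^ u ≤ Φ * Σ xs g ^ u
  Σ-≼ {Φ = Φ} u [] f g 1≤u 0≤Φ 0≤f 0≤g h = lem 1≤u
    where
    lem : 1 ℕ.≤ u → 0ℚ ^ u ≤ Φ * 0ℚ ^ u
    lem (ℕ.s≤s {n = n} _) = ≤-reflexive (trans (*-zeroˡ (0ℚ ^ n))
      (sym (trans (cong (Φ *_) (*-zeroˡ (0ℚ ^ n))) (*-zeroʳ Φ))))
  Σ-≼ u (x ∷ xs) f g 1≤u 0≤Φ 0≤f 0≤g h = ≼-+ u 1≤u 0≤Φ (0≤f x) (Σ-nonNeg xs 0≤f) (0≤g x) (Σ-nonNeg xs 0≤g)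
    (h x (here refl)) (Σ-≼ u xs f g 1≤u 0≤Φ 0≤f 0≤g (λ y y∈ → h y (there y∈)))

  ≼-mono : ∀ {Φ x a b} u → 0ℚ ≤ Φ → 0ℚ ≤ a → a ≤ b → x ^ u ≤ Φ * a ^ u → x ^ u ≤ Φ * b ^ u
  ≼-mono u 0≤Φ 0≤a a≤b h = ≤-trans h (*-monoˡ-≤ 0≤Φ (^-mono-≤ u 0≤a a≤b))

  vecs : ∀ k → ℕ → List (Vec ℕ k)
  vecs zero    L = [] ∷ []
  vecs (suc k) L = List.cartesianProductWith _∷_ (upTo L) (vecs k L)

  Σ-cartesian : ∀ {A B C : Set} (h : A → B → C) xs ys (f : C → ℚ) →
    Σ (List.cartesianProductWith h xs ys) f ≡ Σ xs (λ x → Σ ys (λ y → f (h x y)))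
  Σ-cartesian h []       ys f = refl
  Σ-cartesian h (x ∷ xs) ys f = trans (Σ-++ (List.map (h x) ys) _ f)
    (cong₂ _+_ (Σ-map (h x) ys f) (Σ-cartesian h xs ys f))

  ∈-vecs⁺ : ∀ {k L} (i : Vec ℕ k) → (∀ j → lookup i j ℕ.< L) → i ∈ vecs k L
  ∈-vecs⁺ []      h = here refl
  ∈-vecs⁺ (x ∷ i) h = ∈-cartesianProductWith⁺ _∷_ (∈-upTo⁺ (h Fin.zero)) (∈-vecs⁺ i (h ∘ Fin.suc))

  ∈-vecs⁻ : ∀ {k L} (i : Vec ℕ k) → i ∈ vecs k L → ∀ j → lookup i j ℕ.< L
  ∈-vecs⁻ {suc k} {L} i i∈ j with ∈-cartesianProductWith⁻ _∷_ (upTo L) (vecs k L) i∈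
  ∈-vecs⁻ {suc k} {L} i i∈ Fin.zero    | x , i′ , x∈ , i′∈ , refl = ∈-upTo⁻ x∈
  ∈-vecs⁻ {suc k} {L} i i∈ (Fin.suc j) | x , i′ , x∈ , i′∈ , refl = ∈-vecs⁻ i′ i′∈ j

  Σ-vecs-Π : ∀ k L (f : Fin k → ℕ → ℚ) →
    Σ (vecs k L) (λ i → Π (λ j → f j (lookup i j))) ≡ Π (λ j → Σ (upTo L) (f j))
  Σ-vecs-Π zero    L f = refl
  Σ-vecs-Π (suc k) L f = trans (Σ-cartesian _∷_ (upTo L) (vecs k L) _)
    (trans (Σ-cong (upTo L) (λ x → trans (Σ-*ˡ (vecs k L) (f Fin.zero x) _)
        (cong (f Fin.zero x *_) (Σ-vecs-Π k L (f ∘ Fin.suc)))))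
      (Σ-*ʳ (upTo L) _ (f Fin.zero)))

  minv : ∀ {k} → Vec ℕ (suc k) → ℕ
  minv (x ∷ [])     = x
  minv (x ∷ y ∷ ys) = x ℕ.⊓ minv (y ∷ ys)

  minv-≤ : ∀ {k} (i : Vec ℕ (suc k)) j → minv i ℕ.≤ lookup i j
  minv-≤ (x ∷ [])     Fin.zero    = ℕ.≤-refl
  minv-≤ (x ∷ y ∷ ys) Fin.zero    = ℕ.m⊓n≤m x _
  minv-≤ (x ∷ y ∷ ys) (Fin.suc j) = ℕ.≤-trans (ℕ.m⊓n≤n x _) (minv-≤ (y ∷ ys) j)

  minv-attained : ∀ {k} (i : Vec ℕ (suc k)) → ∃[ j ] lookup i j ≡ minv i
  minv-attained (x ∷ [])     = Fin.zero , refl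
  minv-attained (x ∷ y ∷ ys) with ℕ.⊓-sel x (minv (y ∷ ys)) | minv-attained (y ∷ ys)
  ... | inj₁ eq | _      = Fin.zero , sym eq
  ... | inj₂ eq | j , e = Fin.suc j , trans e (sym eq)

  ∑ⁿ : ∀ {k} → (Fin k → ℕ) → ℕ
  ∑ⁿ = Vector.foldr ℕ._+_ 0

  ∑ⁿ-term : ∀ {k} (f : Fin k → ℕ) j → f j ℕ.≤ ∑ⁿ f
  ∑ⁿ-term f Fin.zero    = ℕ.m≤m+n _ _
  ∑ⁿ-term f (Fin.suc j) = ℕ.≤-trans (∑ⁿ-term (f ∘ Fin.suc) j) (ℕ.m≤n+m _ _)

  ∑ⁿ-zero : ∀ {k} {f : Fin k → ℕ} → (∀ j → f j ≡ 0) → ∑ⁿ f ≡ 0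
  ∑ⁿ-zero {zero}  h = refl
  ∑ⁿ-zero {suc k} h = cong₂ ℕ._+_ (h Fin.zero) (∑ⁿ-zero (h ∘ Fin.suc))

  ^-∑ⁿ : ∀ {k} x (f : Fin k → ℕ) → x ^ ∑ⁿ f ≡ Π (λ j → x ^ f j)
  ^-∑ⁿ {zero}  x f = refl
  ^-∑ⁿ {suc k} x f = trans (^-homo-* x (f Fin.zero) _) (cong (x ^ f Fin.zero *_) (^-∑ⁿ x (f ∘ Fin.suc)))

  dev : ∀ {k} → Vec ℕ (suc k) → ℕ
  dev i = ∑ⁿ (λ j → lookup i j ℕ.∸ minv i)

  dev≡0⇒ : ∀ {k} (i : Vec ℕ (suc k)) → dev i ≡ 0 → ∀ j → lookup i j ≡ minv i
  dev≡0⇒ i eq j = ℕ.≤-antisym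
    (ℕ.m∸n≡0⇒m≤n (ℕ.n≤0⇒n≡0 (subst (lookup i j ℕ.∸ minv i ℕ.≤_) eq (∑ⁿ-term (λ j → lookup i j ℕ.∸ minv i) j)))) (minv-≤ i j)

  ⇒dev≡0 : ∀ {k} (i : Vec ℕ (suc k)) m → (∀ j → lookup i j ≡ m) → dev i ≡ 0
  ⇒dev≡0 i m h = ∑ⁿ-zero (λ j → trans (cong₂ ℕ._∸_ (h j)
    (trans (sym (proj₂ (minv-attained i))) (h _))) (ℕ.n∸n≡0 m))

  -- `s` bounds the geometric series with ratio `r`. The single inequality 1 + rs ≤ s carries all
  -- inductions over partial sums without dividing by 1 - r.
  module Geometric {r s : ℚ} (0≤r : 0ℚ ≤ r) (0≤s : 0ℚ ≤ s) (1+rs≤s : 1ℚ + r * s ≤ s) where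

    -- This is r^(l-m) for m ≤ l and 0 otherwise. Defined by recursion, it makes the index shifts
    -- below definitional.
    h : ℕ → ℕ → ℚ
    h zero    l       = r ^ l
    h (suc m) zero    = 0ℚ
    h (suc m) (suc l) = h m l

    h-nonNeg : ∀ m l → 0ℚ ≤ h m l
    h-nonNeg zero    l       = ^-nonNeg l 0≤r
    h-nonNeg (suc m) zero    = ≤-refl
    h-nonNeg (suc m) (suc l) = h-nonNeg m l

    h-≤ : ∀ {m l} → m ℕ.≤ l → h m l ≡ r ^ (l ℕ.∸ m)
    h-≤ ℕ.z≤n       = refl
    h-≤ (ℕ.s≤s m≤l) = h-≤ m≤l

    geo : ℕ → ℚ
    geo zero    = 0ℚ
    geo (suc n) = 1ℚ + r * geo n

    geo-nonNeg : ∀ n → 0ℚ ≤ geo n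
    geo-nonNeg zero    = ≤-refl
    geo-nonNeg (suc n) = 0≤+ 0≤1 (0≤* 0≤r (geo-nonNeg n))

    geo≤s : ∀ n → geo n ≤ s
    geo≤s zero    = 0≤s
    geo≤s (suc n) = ≤-trans (+-monoʳ-≤ 1ℚ (*-monoˡ-≤ 0≤r (geo≤s n))) 1+rs≤s

    geo-suc : ∀ n → geo (suc n) ≡ r ^ n + geo n
    geo-suc zero    = cong (1ℚ +_) (*-zeroʳ r)
    geo-suc (suc n) = trans (cong (λ z → 1ℚ + r * z) (geo-suc n)) (lem r (r ^ n) (geo n))
      where
      lem : ∀ r p g → 1ℚ + r * (p + g) ≡ r * p + (1ℚ + r * g)
      lem = solve 3 (λ r p g → con 1ℚ :+ r :* (p :+ g) := r :* p :+ (con 1ℚ :+ r :* g)) refl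

    Σ-powers : ∀ L → Σ (upTo L) (r ^_) ≤ geo L
    Σ-powers zero    = ≤-refl
    Σ-powers (suc L) = ≤-trans (≤-reflexive (Σ-upTo-suc L (r ^_)))
      (+-monoʳ-≤ 1ℚ (≤-trans (≤-reflexive (Σ-*ˡ (upTo L) r (r ^_))) (*-monoˡ-≤ 0≤r (Σ-powers L))))

    Σ-h-right : ∀ m L → Σ (upTo L) (h m) ≤ s
    Σ-h-right zero    L       = ≤-trans (Σ-powers L) (geo≤s L)
    Σ-h-right (suc m) zero    = 0≤s
    Σ-h-right (suc m) (suc L) = subst (_≤ s) (sym (trans (Σ-upTo-suc L (h (suc m))) (+-identityˡ _))) (Σ-h-right m L)

    -- The bound `s` would not survive the induction, whose step adds r^(l+1); the partial sum `geo`
    -- absorbs exactly this term.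
    Σ-h-left : ∀ l L → Σ (upTo L) (λ m → h m l) ≤ geo (suc l)
    Σ-h-left l       zero    = geo-nonNeg (suc l)
    Σ-h-left zero    (suc L) = ≤-reflexive (trans (Σ-upTo-suc L (λ m → h m 0))
      (cong₂ _+_ {1ℚ} refl (trans (Σ-0 (upTo L)) (sym (*-zeroʳ r)))))
    Σ-h-left (suc l) (suc L) = ≤-trans (≤-reflexive (Σ-upTo-suc L (λ m → h m (suc l))))
      (≤-trans (+-monoʳ-≤ (r ^ suc l) (Σ-h-left l L)) (≤-reflexive (sym (geo-suc (suc l)))))

    Σ-vecs-factor : ∀ k L (f h : ℕ → ℚ) (j : Fin (suc k)) → (∀ l → 0ℚ ≤ f l) → (∀ l → 0ℚ ≤ h l) → Σ (upTo L) h ≤ s →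
      Σ (vecs (suc k) L) (λ i → f (lookup i j) * Π (λ l → h (lookup i l))) ≤ Σ (upTo L) (λ l → f l * h l) * s ^ k
    Σ-vecs-factor k L f h Fin.zero 0≤f 0≤h Σh≤s = ≤-trans (≤-reflexive
        (trans (Σ-cartesian _∷_ (upTo L) (vecs k L) _)
          (trans (Σ-cong (upTo L) (λ x → trans (Σ-cong (vecs k L) (λ i → sym (*-assoc (f x) (h x) _)))
                   (Σ-*ˡ (vecs k L) (f x * h x) _)))
            (Σ-*ʳ (upTo L) _ (λ x → f x * h x)))))
      (*-monoˡ-≤ (Σ-nonNeg (upTo L) (λ l → 0≤* (0≤f l) (0≤h l)))
        (≤-trans (≤-reflexive (Σ-vecs-Π k L (λ _ → h)))
          (≤-trans (≤-reflexive (Π-const k (Σ (upTo L) h))) (^-mono-≤ k (Σ-nonNeg (upTo L) 0≤h) Σh≤s))))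
    Σ-vecs-factor (suc k) L f h (Fin.suc j) 0≤f 0≤h Σh≤s = ≤-trans (≤-reflexive
        (trans (Σ-cartesian _∷_ (upTo L) (vecs (suc k) L) _)
          (trans (Σ-cong (upTo L) (λ x → trans
                   (Σ-cong (vecs (suc k) L) (λ i → swap (f (lookup i j)) (h x) _))
                   (Σ-*ˡ (vecs (suc k) L) (h x) _)))
            (Σ-*ʳ (upTo L) _ h))))
      (≤-trans (*-mono-≤ (Σ-nonNeg (upTo L) 0≤h) (0≤* 0≤Σfh (^-nonNeg k 0≤s)) Σh≤s
                 (Σ-vecs-factor k L f h j 0≤f 0≤h Σh≤s))
        (≤-reflexive (swap s (Σ (upTo L) (λ l → f l * h l)) (s ^ k))))
      where
      0≤Σfh = Σ-nonNeg (upTo L) (λ l → 0≤* (0≤f l) (0≤h l))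
      swap : ∀ a b c → a * (b * c) ≡ b * (a * c)
      swap = solve 3 (λ a b c → a :* (b :* c) := b :* (a :* c)) refl

    -- Sort the vectors i by a level m ≤ min i; for fixed m the sum is a product of geometric series.
    Σ-dev : ∀ {k} L (f : ℕ → ℚ) (j : Fin (suc k)) → (∀ l → 0ℚ ≤ f l) →
      Σ (vecs (suc k) L) (λ i → r ^ dev i * f (lookup i j)) ≤ s ^ suc k * Σ (upTo L) f
    Σ-dev {k} L f j 0≤f = ≤-trans (Σ-mono (vecs (suc k) L) by-level)
      (≤-trans (≤-reflexive (Σ-swap (vecs (suc k) L) (upTo L) _))
        (≤-trans (Σ-mono (upTo L) (λ m _ → Σ-vecs-factor k L f (h m) j 0≤f (h-nonNeg m) (Σ-h-right m L)))
          (≤-trans (≤-reflexive (trans (Σ-*ʳ (upTo L) (s ^ k) _) (cong (_* s ^ k)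
              (trans (Σ-swap (upTo L) (upTo L) _) (Σ-cong (upTo L) (λ l → Σ-*ˡ (upTo L) (f l) _))))))
            (≤-trans (*-monoʳ-≤ (^-nonNeg k 0≤s) (≤-trans
                (Σ-mono (upTo L) (λ l _ → *-monoˡ-≤ (0≤f l) (≤-trans (Σ-h-left l L) (geo≤s (suc l)))))
                (≤-reflexive (Σ-*ʳ (upTo L) s f))))
              (≤-reflexive (lem (Σ (upTo L) f) s (s ^ k)))))))
      where
      lem : ∀ a s p → a * s * p ≡ s * p * a
      lem = solve 3 (λ a s p → a :* s :* p := s :* p :* a) refl
      term : Vec ℕ (suc k) → ℕ → ℚ
      term i m = f (lookup i j) * Π (λ l → h m (lookup i l))
      -- Among the nonnegative terms, the one at m = `minv i` already equals the left-hand side.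
      by-level : ∀ i → i ∈ vecs (suc k) L → r ^ dev i * f (lookup i j) ≤ Σ (upTo L) (term i)
      by-level i i∈ = subst (_≤ Σ (upTo L) (term i)) eq
        (Σ-term {f = term i} (λ m → 0≤* (0≤f _) (Π-nonNeg (λ l → h-nonNeg m (lookup i l)))) (∈-upTo⁺ minv<L))
        where
        minv<L : minv i ℕ.< L
        minv<L = let (j , e) = minv-attained i in subst (ℕ._< L) e (∈-vecs⁻ i i∈ j)
        eq : term i (minv i) ≡ r ^ dev i * f (lookup i j)
        eq = trans (cong (f (lookup i j) *_) (trans (Π-cong (λ l → h-≤ (minv-≤ i l)))
            (sym (^-∑ⁿ r (λ l → lookup i l ℕ.∸ minv i)))))
          (*-comm (f (lookup i j)) (r ^ dev i))

    Σ-dev-∑ : ∀ {k} L (f : Fin (suc k) → ℕ → ℚ) {c} → (∀ j l → 0ℚ ≤ f j l) → (∀ j → Σ (upTo L) (f j) ≤ c) →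
      Σ (vecs (suc k) L) (λ i → r ^ dev i * ∑ (λ j → f j (lookup i j))) ≤ s ^ suc k * (ι (suc k) * c)
    Σ-dev-∑ {k} L f {c} 0≤f Σf≤c = ≤-trans (≤-reflexive
        (trans (Σ-cong (vecs (suc k) L) (λ i → sym (∑-*ˡ (r ^ dev i) (λ j → f j (lookup i j)))))
          (Σ-∑ (vecs (suc k) L) (λ j i → r ^ dev i * f j (lookup i j)))))
      (≤-trans (∑-mono (λ j → ≤-trans (Σ-dev L (f j) j (0≤f j)) (*-monoˡ-≤ (^-nonNeg (suc k) 0≤s) (Σf≤c j))))
        (≤-reflexive (trans (∑-const (suc k) (s ^ suc k * c)) (lem (ι (suc k)) (s ^ suc k) c))))
      where
      lem : ∀ a b c → a * (b * c) ≡ b * (a * c)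
      lem = solve 3 (λ a b c → a :* (b :* c) := b :* (a :* c)) refl

    Σ-dev-avg : ∀ {k} L (f : Fin (suc k) → ℕ → ℚ) {c} → (∀ j l → 0ℚ ≤ f j l) → (∀ j → Σ (upTo L) (f j) ≤ c) →
      Σ (vecs (suc k) L) (λ i → r ^ dev i * avg (λ j → f j (lookup i j))) ≤ s ^ suc k * c
    Σ-dev-avg {k} L f {c} 0≤f Σf≤c = ≤-trans (≤-reflexive
        (trans (Σ-cong (vecs (suc k) L) (λ i → sym (*-assoc (r ^ dev i) _ (1/suc k)))) (Σ-*ʳ (vecs (suc k) L) (1/suc k) _)))
      (≤-trans (*-monoʳ-≤ (<⇒≤ (0<1/suc k)) (Σ-dev-∑ L f 0≤f Σf≤c))
        (≤-reflexive (trans (lem (s ^ suc k) (ι (suc k)) c (1/suc k))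
          (trans (cong (s ^ suc k * c *_) (1/suc-inverse k)) (*-identityʳ _)))))
      where
      lem : ∀ a b c d → a * (b * c) * d ≡ a * c * (b * d)
      lem = solve 4 (λ a b c d → a :* (b :* c) :* d := a :* c :* (b :* d)) refl

  Σ-upTo-point : ∀ L m → Σ (upTo L) (λ l → ⟦ l ℕ.≟ m ⟧) ≤ 1ℚ
  Σ-upTo-point zero    m       = 0≤1
  Σ-upTo-point (suc L) zero    = ≤-reflexive (trans (Σ-upTo-suc L (λ l → ⟦ l ℕ.≟ 0 ⟧))
    (cong (1ℚ +_) (trans (Σ-cong (upTo L) (λ l → ⟦⟧-no (suc l ℕ.≟ 0) (λ ()))) (Σ-0 (upTo L)))))
  Σ-upTo-point (suc L) (suc m) = ≤-trans (≤-reflexive (trans (Σ-upTo-suc L (λ l → ⟦ l ℕ.≟ suc m ⟧))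
    (trans (+-identityˡ _) (Σ-cong (upTo L) same)))) (Σ-upTo-point L m)
    where
    same : ∀ l → ⟦ suc l ℕ.≟ suc m ⟧ ≡ ⟦ l ℕ.≟ m ⟧
    same l with l ℕ.≟ m
    ... | yes refl = ⟦⟧-yes (suc l ℕ.≟ suc l) refl
    ... | no l≢m   = ⟦⟧-no (suc l ℕ.≟ suc m) (λ eq → l≢m (ℕ.suc-injective eq))

  -- The inequality at a single prime

  ¾ : ℚ
  ¾ = ½ + ½ * ½

  0≤½ : 0ℚ ≤ ½
  0≤½ = <⇒≤ (positive⁻¹ ½)

  0≤¾ : 0ℚ ≤ ¾
  0≤¾ = <⇒≤ (positive⁻¹ ¾)

  ½≤1 : ½ ≤ 1ℚ
  ½≤1 = toWitness {a? = ½ ≤? 1ℚ} _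

  -- Ratio 3/4 serves the small primes, 1/2 the off-diagonal vectors at the large primes, and 0 the
  -- diagonal: as 0^0 = 1, the power 0^(dev i) is the indicator of the constant vectors.
  module Geo¾ = Geometric {¾} {ι 4} 0≤¾ (0≤ι 4) (toWitness {a? = 1ℚ + ¾ * ι 4 ≤? ι 4} _)
  module Geo½ = Geometric {½} {ι 2} 0≤½ (0≤ι 2) (toWitness {a? = 1ℚ + ½ * ι 2 ≤? ι 2} _)
  module Geo0 = Geometric {0ℚ} {1ℚ} ≤-refl 0≤1 (toWitness {a? = 1ℚ + 0ℚ * 1ℚ ≤? 1ℚ} _)

  -- `tangent` with 1 - t in place of x, at the point 1.
  bernoulli⁻ : ∀ t n → 0ℚ ≤ 1ℚ - t → 1ℚ - ι n * t ≤ (1ℚ - t) ^ n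
  bernoulli⁻ t zero    0≤1-t = ≤-reflexive (lem t)
    where
    lem : ∀ t → 1ℚ - 0ℚ * t ≡ 1ℚ
    lem = solve 1 (λ t → con 1ℚ :- con 0ℚ :* t := con 1ℚ) refl
  bernoulli⁻ t (suc n) 0≤1-t = 0≤q-p⇒p≤q (subst (0ℚ ≤_) eq (p≤q⇒0≤q-p (tangent n 0≤1-t 0≤1)))
    where
    identity : ∀ t X i {o o′ i′} → o ≡ 1ℚ → o′ ≡ 1ℚ → i′ ≡ 1ℚ + i → X + i * o - i′ * (1ℚ - t) * o′ ≡ X - (1ℚ - i′ * t)
    identity t X i refl refl refl = solve 3 (λ t X i → X :+ i :* con 1ℚ :- (con 1ℚ :+ i) :* (con 1ℚ :- t) :* con 1ℚ
      := X :- (con 1ℚ :- (con 1ℚ :+ i) :* t)) refl t X i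
    eq = identity t ((1ℚ - t) ^ suc n) (ι n) (1^n≡1 (suc n)) (1^n≡1 n) (ι-suc n)

  ^-comm : ∀ x m n → (x ^ m) ^ n ≡ (x ^ n) ^ m
  ^-comm x m n = trans (^-assocʳ x m n) (trans (cong (x ^_) (ℕ.*-comm m n)) (sym (^-assocʳ x n m)))

  0^dev : ∀ {k} (i : Vec ℕ (suc k)) → dev i ≡ 0 → 0ℚ ^ dev i ≡ 1ℚ
  0^dev i eq rewrite eq = refl

  -- Here `π` is 1/p, `α j l` is the proportion of A_j at valuation l, and (Φ * B i)^(1/u) will
  -- bound the count N_i. The exponent v of `π` is split as w + v′: in `level-bound` the part w is
  -- grouped with P i ^ w, and the part v′ ≥ 1 makes the sum over i converge.
  module LocalWeights (k₁ u v w v′ : ℕ) (u≡v+w : u ≡ v ℕ.+ w) (v≡w+v′ : v ≡ w ℕ.+ v′) (1≤v′ : 1 ℕ.≤ v′) (1≤w : 1 ℕ.≤ w)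
    (u<kw : suc u ℕ.≤ suc k₁ ℕ.* w)
    (L : ℕ) (π : ℚ) (0≤π : 0ℚ ≤ π) (π≤1 : π ≤ 1ℚ)
    (α : Fin (suc k₁) → ℕ → ℚ) (0≤α : ∀ j l → 0ℚ ≤ α j l) (Σα≤1 : ∀ j → Σ (upTo L) (α j) ≤ 1ℚ)
    (Φ : ℚ) (0≤Φ : 0ℚ ≤ Φ) where

    k = suc k₁
    I = vecs k L

    1≤v : 1 ℕ.≤ v
    1≤v = ℕ.≤-trans 1≤w (subst (w ℕ.≤_) (sym v≡w+v′) (ℕ.m≤m+n w v′))

    1≤u : 1 ℕ.≤ u
    1≤u = ℕ.≤-trans 1≤v (subst (v ℕ.≤_) (sym u≡v+w) (ℕ.m≤m+n v w))

    P : Vec ℕ k → ℚ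
    P i = Π (λ j → α j (lookup i j))

    A : Vec ℕ k → ℚ
    A i = avg (λ j → α j (lookup i j))

    B : Vec ℕ k → ℚ
    B i = P i ^ w * (π ^ v) ^ dev i

    0≤P : ∀ i → 0ℚ ≤ P i
    0≤P i = Π-nonNeg (λ j → 0≤α j (lookup i j))

    0≤A : ∀ i → 0ℚ ≤ A i
    0≤A i = avg-nonNeg (λ j → 0≤α j (lookup i j))

    α≤1 : ∀ {l} j → l ℕ.< L → α j l ≤ 1ℚ
    α≤1 j l<L = ≤-trans (Σ-term {f = α j} (0≤α j) (∈-upTo⁺ l<L)) (Σα≤1 j)

    α[_]≤1 : ∀ {i} → i ∈ I → ∀ j → α j (lookup i j) ≤ 1ℚ
    α[_]≤1 {i} i∈ j = α≤1 j (∈-vecs⁻ i i∈ j)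

    P≤1 : ∀ {i} → i ∈ I → P i ≤ 1ℚ
    P≤1 {i} i∈ = Π-≤1 (λ j → 0≤α j (lookup i j)) α[ i∈ ]≤1

    P≤α : ∀ {i} → i ∈ I → ∀ j → P i ≤ α j (lookup i j)
    P≤α {i} i∈ j = Π-≤factor (λ j → 0≤α j (lookup i j)) α[ i∈ ]≤1 j

    0≤π^ : ∀ {n} m → 0ℚ ≤ (π ^ n) ^ m
    0≤π^ {n} m = ^-nonNeg m (^-nonNeg n 0≤π)

    0≤B : ∀ i → 0ℚ ≤ B i
    0≤B i = 0≤* (^-nonNeg w (0≤P i)) (0≤π^ {v} (dev i))

    π^v≤ : ∀ {x} → π ≤ x → π ^ v ≤ x
    π^v≤ h = ≤-trans (^≤self v 1≤v 0≤π π≤1) h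

    dev-power : ∀ x (i : Vec ℕ k) → π ^ v ≤ x ^ u → (π ^ v) ^ dev i ≤ (x ^ dev i) ^ u
    dev-power x i h = ≤-trans (^-mono-≤ (dev i) (^-nonNeg v 0≤π) h) (≤-reflexive (^-comm x u (dev i)))

    -- Raised to the power k, the first factor is P^(kw) ≤ P^(u+1) = P * P^u, because P ≤ 1 and
    -- `u<kw`. AM-GM turns P^u into A^(ku); the gain `a` is drawn from the spare factor P.
    B-avg : ∀ {i} a e → i ∈ I → 0ℚ ≤ a → 0ℚ ≤ e → P i ≤ (a ^ u) ^ k → (π ^ v) ^ dev i ≤ e ^ u → B i ≤ (a * e * A i) ^ u
    B-avg {i} a e i∈ 0≤a 0≤e hP hQ = ^-cancel-≤ k (ℕ.s≤s ℕ.z≤n) (^-nonNeg u (0≤* (0≤* 0≤a 0≤e) (0≤A i)))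
      (≤-trans (≤-reflexive (^-distrib-* (P i ^ w) ((π ^ v) ^ dev i) k))
        (≤-trans (*-mono-≤ (^-nonNeg k (^-nonNeg w (0≤P i))) (^-nonNeg k (^-nonNeg u 0≤e)) P-part (^-mono-≤ k (0≤π^ {v} (dev i)) hQ))
          (≤-reflexive collect)))
      where
      P-part : (P i ^ w) ^ k ≤ (a ^ u) ^ k * (A i ^ u) ^ k
      P-part = ≤-trans (≤-reflexive (trans (^-assocʳ (P i) w k) (cong (P i ^_) (ℕ.*-comm w k))))
        (≤-trans (^-antiʳ-≤ (0≤P i) (P≤1 i∈) u<kw)
          (*-mono-≤ (0≤P i) (^-nonNeg k (^-nonNeg u (0≤A i))) hP
            (≤-trans (^-mono-≤ u (0≤P i) (am-gm (λ j → α j (lookup i j)) (λ j → 0≤α j (lookup i j))))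
              (≤-reflexive (^-comm (A i) k u)))))
      collect : (a ^ u) ^ k * (A i ^ u) ^ k * (e ^ u) ^ k ≡ ((a * e * A i) ^ u) ^ k
      collect = sym (trans (cong (_^ k) (trans (^-distrib-* (a * e) (A i) u) (cong (_* A i ^ u) (^-distrib-* a e u))))
        (trans (^-distrib-* (a ^ u * e ^ u) (A i ^ u) k) (trans (cong (_* (A i ^ u) ^ k) (^-distrib-* (a ^ u) (e ^ u) k))
          (lem ((a ^ u) ^ k) ((e ^ u) ^ k) ((A i ^ u) ^ k)))))
        where
        lem : ∀ x y z → x * y * z ≡ x * z * y
        lem = solve 3 (λ x y z → x :* y :* z := x :* z :* y) refl

    P≤1^ : ∀ {i} → i ∈ I → P i ≤ (1ℚ ^ u) ^ k
    P≤1^ i∈ = ≤-trans (P≤1 i∈) (≤-reflexive (sym (trans (cong (_^ k) (1^n≡1 u)) (1^n≡1 k))))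

    module _ (N : Vec ℕ k → ℚ) (0≤N : ∀ i → 0ℚ ≤ N i) (N≼B : ∀ i → i ∈ I → N i ^ u ≤ Φ * B i) where

      -- No gain is drawn from the spare factor here (a = 1). The series with ratio 3/4 sums to 4,
      -- once for each of the k factors.
      small-bound : π ^ v ≤ ¾ ^ u → Σ I N ^ u ≤ Φ * (ι 4 ^ k) ^ u
      small-bound π^v≤¾^u = ≼-mono u 0≤Φ (Σ-nonNeg I 0≤ω)
        (≤-trans (Geo¾.Σ-dev-avg L α 0≤α Σα≤1) (≤-reflexive (*-identityʳ _)))
        (Σ-≼ u I N ω 1≤u 0≤Φ 0≤N 0≤ω λ i i∈ → ≤-trans (N≼B i i∈)
          (*-monoˡ-≤ 0≤Φ (≤-trans
            (B-avg 1ℚ (¾ ^ dev i) i∈ 0≤1 (^-nonNeg (dev i) 0≤¾) (P≤1^ i∈) (dev-power ¾ i π^v≤¾^u))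
            (≤-reflexive (cong (_^ u) (cong (_* A i) (*-identityˡ (¾ ^ dev i))))))))
        where
        ω : Vec ℕ k → ℚ
        ω i = ¾ ^ dev i * A i
        0≤ω : ∀ i → 0ℚ ≤ ω i
        0≤ω i = 0≤* (^-nonNeg (dev i) 0≤¾) (0≤A i)

      module _ (b θ : ℚ) (0≤b : 0ℚ ≤ b) (b≤1 : b ≤ 1ℚ) (0≤θ : 0ℚ ≤ θ) (π≤½^u : π ≤ ½ ^ u) where

        -- A rational upper bound for (1 - b^u)^(1/(ku)), by Bernoulli's inequality; the denominator
        -- is really ku + 1.
        1-b^u/ku : ℚ
        1-b^u/ku = 1ℚ - b ^ u * 1/suc (k ℕ.* u)

        -- No level is shared by all the A_j: at each m some α_j(m) ≤ 1 - b^u, so on the diagonal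
        -- the spare factor of `B-avg` gains ρ = 1 - t. The off-diagonal weights sum to at most θ
        -- 2^k ≤ t, and the total stays at most 1.
        spread-bound : θ * ι 2 ^ k ≤ b ^ u * 1/suc (k ℕ.* u) → π ≤ (θ * ½) ^ u →
          (∀ m → m ∈ upTo L → ∃[ j ] α j m ≤ 1ℚ - b ^ u) → Σ I N ^ u ≤ Φ
        spread-bound θ-small π≤θ½ spread = subst (λ z → Σ I N ^ u ≤ z) (trans (cong (Φ *_) (1^n≡1 u)) (*-identityʳ Φ))
          (≼-mono u 0≤Φ (Σ-nonNeg I 0≤ω) Σω≤1
            (Σ-≼ u I N ω 1≤u 0≤Φ 0≤N 0≤ω λ i i∈ → ≤-trans (N≼B i i∈) (*-monoˡ-≤ 0≤Φ (B≤ω i i∈))))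
          where
          ρ = 1-b^u/ku
          t = b ^ u * 1/suc (k ℕ.* u)
          0≤t : 0ℚ ≤ t
          0≤t = 0≤* (^-nonNeg u 0≤b) (<⇒≤ (0<1/suc (k ℕ.* u)))
          ku·t≤ : ι (k ℕ.* u) * t ≤ b ^ u
          ku·t≤ = ≤-trans (*-monoʳ-≤ 0≤t (ι-mono (ℕ.n≤1+n (k ℕ.* u)))) (≤-reflexive
            (trans (lem (ι (suc (k ℕ.* u))) (b ^ u) (1/suc (k ℕ.* u)))
              (trans (cong (b ^ u *_) (1/suc-inverse (k ℕ.* u))) (*-identityʳ (b ^ u)))))
            where
            lem : ∀ x y z → x * (y * z) ≡ y * (x * z)
            lem = solve 3 (λ x y z → x :* (y :* z) := y :* (x :* z)) refl
          0≤ρ : 0ℚ ≤ ρ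
          0≤ρ = p≤q⇒0≤q-p (*≤1 (<⇒≤ (0<1/suc (k ℕ.* u))) (^≤1 u 0≤b b≤1)
            (≤-trans (p≤ (1/suc (k ℕ.* u)) (<⇒≤ (0<1/suc (k ℕ.* u)))) (≤-reflexive (1/suc-inverse (k ℕ.* u)))))
            where
            p≤ : ∀ x → 0ℚ ≤ x → x ≤ ι (suc (k ℕ.* u)) * x
            p≤ x 0≤x = subst (_≤ ι (suc (k ℕ.* u)) * x) (*-identityˡ x) (*-monoʳ-≤ 0≤x (ι-mono {1} (ℕ.s≤s ℕ.z≤n)))
          1-b^u≤ : 1ℚ - b ^ u ≤ (ρ ^ u) ^ k
          1-b^u≤ = ≤-trans (+-monoʳ-≤ 1ℚ (neg-antimono-≤ ku·t≤))
            (≤-trans (bernoulli⁻ t (k ℕ.* u) 0≤ρ)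
              (≤-reflexive (trans (cong (ρ ^_) (ℕ.*-comm k u)) (sym (^-assocʳ ρ u k)))))
          ω : Vec ℕ k → ℚ
          ω i = ρ * (0ℚ ^ dev i * A i) + θ * (½ ^ dev i * A i)
          0≤diag : ∀ i → 0ℚ ≤ ρ * (0ℚ ^ dev i * A i)
          0≤diag i = 0≤* 0≤ρ (0≤* (^-nonNeg (dev i) ≤-refl) (0≤A i))
          0≤off : ∀ i → 0ℚ ≤ θ * (½ ^ dev i * A i)
          0≤off i = 0≤* 0≤θ (0≤* (^-nonNeg (dev i) 0≤½) (0≤A i))
          0≤ω : ∀ i → 0ℚ ≤ ω i
          0≤ω i = 0≤+ (0≤diag i) (0≤off i)
          -- Off the diagonal dev ≥ 1, so at least one factor θ survives; the others are only used
          -- as θ ≤ 1.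
          θ-power : ∀ n → 1 ℕ.≤ n → (θ * ½) ^ n ≤ θ * ½ ^ n
          θ-power (suc n) _ = ≤-trans (≤-reflexive (*-assoc θ ½ ((θ * ½) ^ n)))
            (*-monoˡ-≤ 0≤θ (*-monoˡ-≤ 0≤½ (^-mono-≤ n (0≤* 0≤θ 0≤½) (*≤ˡ 0≤½ θ≤1))))
            where
            θ≤1 : θ ≤ 1ℚ
            θ≤1 = ≤-trans (subst (_≤ θ * ι 2 ^ k) (*-identityʳ θ) (*-monoˡ-≤ 0≤θ (1≤^ k (ι-mono {1} {2} (ℕ.s≤s ℕ.z≤n)))))
              (≤-trans θ-small (0≤q-p⇒p≤q 0≤ρ))
          B≤ω : ∀ i → i ∈ I → B i ≤ ω i ^ u
          B≤ω i i∈ with dev i ℕ.≟ 0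
          ... | yes dev≡0 = ≤-trans (B-avg ρ 1ℚ i∈ 0≤ρ 0≤1 P≤ (≤-reflexive π^≡))
              (^-mono-≤ u (0≤* (0≤* 0≤ρ 0≤1) (0≤A i)) (≤-trans (≤-reflexive
                (trans (*-assoc ρ 1ℚ (A i)) (cong (λ z → ρ * (z * A i)) (sym (0^dev i dev≡0)))))
                (p≤p+q (0≤off i))))
            where
            π^≡ : (π ^ v) ^ dev i ≡ 1ℚ ^ u
            π^≡ = trans (cong ((π ^ v) ^_) dev≡0) (sym (1^n≡1 u))
            P≤ : P i ≤ (ρ ^ u) ^ k
            P≤ = let m∈ = ∈-upTo⁺ (subst (ℕ._< L) (dev≡0⇒ i dev≡0 Fin.zero) (∈-vecs⁻ i i∈ Fin.zero))
                     (j , αj≤) = spread (minv i) m∈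
                 in ≤-trans (P≤α i∈ j) (≤-trans (subst (λ l → α j l ≤ 1ℚ - b ^ u) (sym (dev≡0⇒ i dev≡0 j)) αj≤) 1-b^u≤)
          ... | no dev≢0 = ≤-trans (B-avg 1ℚ ((θ * ½) ^ dev i) i∈ 0≤1 (^-nonNeg (dev i) (0≤* 0≤θ 0≤½)) (P≤1^ i∈)
                (dev-power (θ * ½) i (π^v≤ π≤θ½)))
              (^-mono-≤ u (0≤* (0≤* 0≤1 (^-nonNeg (dev i) (0≤* 0≤θ 0≤½))) (0≤A i))
                (≤-trans (≤-reflexive (cong (_* A i) (*-identityˡ ((θ * ½) ^ dev i))))
                  (≤-trans (*-monoʳ-≤ (0≤A i) (θ-power (dev i) (ℕ.n≢0⇒n>0 dev≢0)))
                    (≤-trans (≤-reflexive (*-assoc θ (½ ^ dev i) (A i))) (p≤q+p (0≤diag i))))))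
          Σω≤1 : Σ I ω ≤ 1ℚ
          Σω≤1 = ≤-trans (≤-reflexive (trans (Σ-+ I _ _) (cong₂ _+_ (Σ-*ˡ I ρ _) (Σ-*ˡ I θ _))))
            (≤-trans (+-mono-≤
                (*-monoˡ-≤ 0≤ρ (≤-trans (Geo0.Σ-dev-avg L α 0≤α Σα≤1) (≤-reflexive (trans (*-identityʳ _) (1^n≡1 k)))))
                (*-monoˡ-≤ 0≤θ (≤-trans (Geo½.Σ-dev-avg L α 0≤α Σα≤1) (≤-reflexive (*-identityʳ (ι 2 ^ k))))))
              (≤-trans (+-monoʳ-≤ (ρ * 1ℚ) θ-small) (≤-reflexive (lem t))))
            where
            lem : ∀ t → (1ℚ - t) * 1ℚ + t ≡ 1ℚ
            lem = solve 1 (λ t → (con 1ℚ :- t) :* con 1ℚ :+ t := con 1ℚ) refl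

        -- `j₀` is the index least concentrated on level m. Its defect `η` therefore bounds the
        -- proportion of every A_j off m.
        module Concentrated (m : ℕ) (m<L : m ℕ.< L) (j₀ : Fin k) (least : ∀ j → α j₀ m ≤ α j m) where

          η : ℚ
          η = 1ℚ - α j₀ m

          t : ℚ
          t = ι 2 ^ k

          0≤t : 0ℚ ≤ t
          0≤t = ^-nonNeg k (0≤ι 2)

          0≤η : 0ℚ ≤ η
          0≤η = p≤q⇒0≤q-p (α≤1 j₀ m<L)

          η≤1 : η ≤ 1ℚ
          η≤1 = 0≤q-p⇒p≤q (subst (0ℚ ≤_) (lem (α j₀ m)) (0≤α j₀ m))
            where
            lem : ∀ a → a ≡ 1ℚ - (1ℚ - a)
            lem = solve 1 (λ a → a := con 1ℚ :- (con 1ℚ :- a)) refl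

          g : Fin k → ℕ → ℚ
          g j l = ⟦ ¬? (l ℕ.≟ m) ⟧ * α j l

          0≤g : ∀ j l → 0ℚ ≤ g j l
          0≤g j l = 0≤* (⟦⟧-nonNeg (¬? (l ℕ.≟ m))) (0≤α j l)

          Σg≤η : ∀ j → Σ (upTo L) (g j) ≤ η
          Σg≤η j = ≤-trans (0≤q-p⇒p≤q (subst (0ℚ ≤_) (lem (α j m) (Σ (upTo L) (g j))) (p≤q⇒0≤q-p total)))
            (+-monoʳ-≤ 1ℚ (neg-antimono-≤ (least j)))
            where
            lem : ∀ a s → 1ℚ - (a + s) ≡ 1ℚ - a - s
            lem = solve 2 (λ a s → con 1ℚ :- (a :+ s) := con 1ℚ :- a :- s) refl
            at : ℕ → ℚ
            at l = ⟦ l ℕ.≟ m ⟧ * α j l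
            split : ∀ l → α j l ≡ at l + g j l
            split l with l ℕ.≟ m
            ... | yes _ = sym (trans (cong₂ _+_ (*-identityˡ (α j l)) (*-zeroˡ (α j l))) (+-identityʳ (α j l)))
            ... | no _  = sym (trans (cong₂ _+_ (*-zeroˡ (α j l)) (*-identityˡ (α j l))) (+-identityˡ (α j l)))
            at-m : α j m ≡ at m
            at-m = sym (trans (cong (_* α j m) (⟦⟧-yes (m ℕ.≟ m) refl)) (*-identityˡ (α j m)))
            total : α j m + Σ (upTo L) (g j) ≤ 1ℚ
            total = ≤-trans (+-monoˡ-≤ (Σ (upTo L) (g j)) (≤-trans (≤-reflexive at-m)
                (Σ-term {f = at} (λ l → 0≤* (⟦⟧-nonNeg (l ℕ.≟ m)) (0≤α j l)) (∈-upTo⁺ m<L))))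
              (≤-trans (≤-reflexive (sym (trans (Σ-cong (upTo L) split) (Σ-+ (upTo L) at (g j))))) (Σα≤1 j))

          g≡α : ∀ j {l} → l ≢ m → g j l ≡ α j l
          g≡α j {l} l≢m = trans (cong (_* α j l) (⟦⟧-yes (¬? (l ℕ.≟ m)) l≢m)) (*-identityˡ (α j l))

          α≤η : ∀ j {l} → l ℕ.< L → l ≢ m → α j l ≤ η
          α≤η j l<L l≢m = ≤-trans (≤-reflexive (sym (g≡α j l≢m))) (≤-trans (Σ-term {f = g j} (0≤g j) (∈-upTo⁺ l<L)) (Σg≤η j))

          G : Vec ℕ k → ℚ
          G i = avg (λ j → g j (lookup i j))

          0≤G : ∀ i → 0ℚ ≤ G i
          0≤G i = avg-nonNeg (λ j → 0≤g j (lookup i j))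

          -- A majorant of the indicator of the vectors that meet level m. Being a sum over the
          -- coordinates, it can be summed by `Σ-dev-∑`.
          hits : Vec ℕ k → ℚ
          hits i = ∑ (λ j → ⟦ lookup i j ℕ.≟ m ⟧)

          0≤hits : ∀ i → 0ℚ ≤ hits i
          0≤hits i = ∑-nonNeg (λ j → ⟦⟧-nonNeg (lookup i j ℕ.≟ m))

          1≤hits : ∀ i j → lookup i j ≡ m → 1ℚ ≤ hits i
          1≤hits i j eq = subst (_≤ hits i) (⟦⟧-yes (lookup i j ℕ.≟ m) eq)
            (∑-term {f = λ j → ⟦ lookup i j ℕ.≟ m ⟧} (λ j → ⟦⟧-nonNeg (lookup i j ℕ.≟ m)) j)

          0≤½^ : ∀ n → 0ℚ ≤ ½ ^ n
          0≤½^ n = ^-nonNeg n 0≤½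

          -- All coordinates avoid m, so each α_j(i_j) is at most η ≤ ζ^u, and the spare factor of
          -- `B-avg` gains ζ.
          B-away : ∀ {i} ζ → i ∈ I → 0ℚ ≤ ζ → η ≤ ζ ^ u → (∀ j → lookup i j ≢ m) → B i ≤ (ζ * (½ ^ dev i * G i)) ^ u
          B-away {i} ζ i∈ 0≤ζ η≤ζ^u away = ≤-trans
            (B-avg ζ (½ ^ dev i) i∈ 0≤ζ (0≤½^ (dev i)) P≤ (dev-power ½ i (π^v≤ π≤½^u)))
            (≤-reflexive (cong (_^ u) (trans (*-assoc ζ _ _)
              (cong (λ z → ζ * (½ ^ dev i * (z * 1/suc k₁))) (∑-cong (λ j → sym (g≡α j (away j))))))))
            where
            P≤ : P i ≤ (ζ ^ u) ^ k
            P≤ = ≤-trans (Π-mono (λ j → 0≤α j (lookup i j)) (λ j → ≤-trans (α≤η j (∈-vecs⁻ i i∈ j) (away j)) η≤ζ^u))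
              (≤-reflexive (Π-const k (ζ ^ u)))

          ½^-halve : ∀ n → ι 2 * ½ ^ suc n ≡ ½ ^ n
          ½^-halve n = trans (sym (*-assoc (ι 2) ½ (½ ^ n))) (*-identityˡ (½ ^ n))

          some-away : ∀ i → dev i ≢ 0 → ∃[ j ] lookup i j ≢ m
          some-away i dev≢0 = Fin.¬∀⟶∃¬ k (λ j → lookup i j ≡ m) (λ j → lookup i j ℕ.≟ m)
            (λ all-at → dev≢0 (⇒dev≡0 i m all-at))

          -- The defect is at least of order 1/p, and the diagonal pays for everything else: it
          -- saves c = η/k, while the vectors avoiding m cost bη 2^k and the mixed ones 2bη k 2^k.
          -- By `b-small` these costs are at most η/k.
          near-bound : b * t + t * (ι k * (ι 2 * b)) ≤ 1/suc k₁ → η ≤ b ^ u → π ≤ η * b ^ u → Σ I N ^ u ≤ Φ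
          near-bound b-small η≤b^u π≤ηb^u = subst (λ z → Σ I N ^ u ≤ z) (trans (cong (Φ *_) (1^n≡1 u)) (*-identityʳ Φ))
            (≼-mono u 0≤Φ (Σ-nonNeg I 0≤ω) Σω≤1
              (Σ-≼ u I N ω 1≤u 0≤Φ 0≤N 0≤ω λ i i∈ → ≤-trans (N≼B i i∈) (*-monoˡ-≤ 0≤Φ (B≤ω i i∈))))
            where
            c = η * 1/suc k₁
            kc≡η : ι k * c ≡ η
            kc≡η = trans (lem (ι k) η (1/suc k₁)) (trans (cong (η *_) (1/suc-inverse k₁)) (*-identityʳ η))
              where
              lem : ∀ x y z → x * (y * z) ≡ y * (x * z)
              lem = solve 3 (λ x y z → x :* (y :* z) := y :* (x :* z)) refl
            0≤c : 0ℚ ≤ c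
            0≤c = 0≤* 0≤η (<⇒≤ (0<1/suc k₁))
            c≤η : c ≤ η
            c≤η = subst₂ _≤_ (*-identityˡ c) kc≡η (*-monoʳ-≤ 0≤c (ι-mono {1} {k} (ℕ.s≤s ℕ.z≤n)))
            0≤1-c : 0ℚ ≤ 1ℚ - c
            0≤1-c = p≤q⇒0≤q-p (≤-trans c≤η η≤1)
            D₁ D₂ D₃ ω : Vec ℕ k → ℚ
            -- On the diagonal all coordinates agree, so coordinate 0 decides whether the level is
            -- m.
            D₁ i = (1ℚ - c) * (0ℚ ^ dev i * ⟦ lookup i Fin.zero ℕ.≟ m ⟧)
            D₂ i = b * (½ ^ dev i * G i)
            D₃ i = η * (ι 2 * b) * (½ ^ dev i * hits i)
            ω i = D₁ i + (D₂ i + D₃ i)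
            0≤D₁ : ∀ i → 0ℚ ≤ D₁ i
            0≤D₁ i = 0≤* 0≤1-c (0≤* (^-nonNeg (dev i) ≤-refl) (⟦⟧-nonNeg (lookup i Fin.zero ℕ.≟ m)))
            0≤D₂ : ∀ i → 0ℚ ≤ D₂ i
            0≤D₂ i = 0≤* 0≤b (0≤* (0≤½^ (dev i)) (0≤G i))
            0≤D₃ : ∀ i → 0ℚ ≤ D₃ i
            0≤D₃ i = 0≤* (0≤* 0≤η (0≤* (0≤ι 2) 0≤b)) (0≤* (0≤½^ (dev i)) (0≤hits i))
            0≤ω : ∀ i → 0ℚ ≤ ω i
            0≤ω i = 0≤+ (0≤D₁ i) (0≤+ (0≤D₂ i) (0≤D₃ i))
            -- Bernoulli gives 1 - η = 1 - kc ≤ (1 - c)^k, and then kw ≥ u.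
            1-η≤ : (1ℚ - η) ^ w ≤ (1ℚ - c) ^ u
            1-η≤ = ≤-trans (^-mono-≤ w (p≤q⇒0≤q-p η≤1) (≤-trans (≤-reflexive (cong (λ z → 1ℚ - z) (sym kc≡η))) (bernoulli⁻ c k 0≤1-c)))
              (≤-trans (≤-reflexive (^-assocʳ (1ℚ - c) k w))
                (^-antiʳ-≤ 0≤1-c (+-mono-≤ {1ℚ} ≤-refl (neg-antimono-≤ 0≤c)) (ℕ.≤-trans (ℕ.n≤1+n u) u<kw)))
            diagonal : ∀ i → i ∈ I → ∀ {j} → lookup i j ≡ m → dev i ≡ 0 → B i ≤ D₁ i ^ u
            diagonal i i∈ {j} i-j≡m dev≡0 = ≤-trans
              (≤-reflexive (trans (cong (λ n → P i ^ w * (π ^ v) ^ n) dev≡0) (*-identityʳ (P i ^ w))))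
              (≤-trans (^-mono-≤ w (0≤P i) (≤-trans (P≤α i∈ j₀) (≤-reflexive
                  (trans (cong (α j₀) (at j₀)) (lem (α j₀ m))))))
                (≤-trans 1-η≤ (≤-reflexive (cong (_^ u) (sym (trans
                  (cong₂ (λ x y → (1ℚ - c) * (x * y)) (0^dev i dev≡0) (⟦⟧-yes (lookup i Fin.zero ℕ.≟ m) (at Fin.zero)))
                  (*-identityʳ (1ℚ - c))))))))
              where
              at : ∀ j′ → lookup i j′ ≡ m
              at j′ = trans (dev≡0⇒ i dev≡0 j′) (trans (sym (dev≡0⇒ i dev≡0 j)) i-j≡m)
              lem : ∀ a → a ≡ 1ℚ - (1ℚ - a)
              lem = solve 1 (λ a → a := con 1ℚ :- (con 1ℚ :- a)) refl
            mixed : ∀ i → i ∈ I → ∀ {j} → lookup i j ≡ m → dev i ≢ 0 → B i ≤ D₃ i ^ u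
            mixed i i∈ {j} i-j≡m dev≢0 = power (dev i) dev≢0
              where
              j′ = proj₁ (some-away i dev≢0)
              away = proj₂ (some-away i dev≢0)
              -- A coordinate away from m gives η^w. One of the d factors π^v is spent as (η b^u)^v,
              -- which completes η^w to η^u and leaves b^u; the remaining d - 1 factors give powers
              -- of 1/2. The 2 in 2b pays for the missing one.
              power : ∀ d → d ≢ 0 → P i ^ w * (π ^ v) ^ d ≤ (η * (ι 2 * b) * (½ ^ d * hits i)) ^ u
              power zero    d≢0 = ⊥-elim (d≢0 refl)
              power (suc n) _   = ≤-trans
                (*-mono-≤ (^-nonNeg w (0≤P i)) (0≤* (^-nonNeg v (0≤* 0≤η (^-nonNeg u 0≤b))) (^-nonNeg u (0≤½^ n)))
                  (^-mono-≤ w (0≤P i) (≤-trans (P≤α i∈ j′) (α≤η j′ (∈-vecs⁻ i i∈ j′) away)))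
                  (*-mono-≤ (^-nonNeg v 0≤π) (^-nonNeg u (0≤½^ n)) (^-mono-≤ v 0≤π π≤ηb^u)
                    (≤-trans (^-mono-≤ n (^-nonNeg v 0≤π) (π^v≤ π≤½^u)) (≤-reflexive (^-comm ½ u n)))))
                (≤-trans (*-monoˡ-≤ (^-nonNeg w 0≤η) (*-monoʳ-≤ (^-nonNeg u (0≤½^ n))
                    (≤-trans (≤-reflexive (^-distrib-* η (b ^ u) v))
                      (*-monoˡ-≤ (^-nonNeg v 0≤η) (^≤self v 1≤v (^-nonNeg u 0≤b) (^≤1 u 0≤b b≤1))))))
                  (≤-trans (≤-reflexive collect)
                    (^-mono-≤ u (0≤* (0≤* 0≤η 0≤b) (0≤½^ n)) (≤-trans (≤-reflexive (unhalve (½^-halve n)))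
                      (*-monoˡ-≤ (0≤* 0≤η (0≤* (0≤ι 2) 0≤b)) (subst (_≤ ½ ^ suc n * hits i) (*-identityʳ (½ ^ suc n))
                        (*-monoˡ-≤ (0≤½^ (suc n)) (1≤hits i j i-j≡m))))))))
                where
                  unhalve : ∀ {x y} → ι 2 * x ≡ y → η * b * y ≡ η * (ι 2 * b) * x
                  unhalve {x} refl = lem η b (ι 2) x
                    where
                    lem : ∀ h b z x → h * b * (z * x) ≡ h * (z * b) * x
                    lem = solve 4 (λ h b z x → h :* b :* (z :* x) := h :* (z :* b) :* x) refl
                  collect : η ^ w * (η ^ v * b ^ u * (½ ^ n) ^ u) ≡ (η * b * ½ ^ n) ^ u
                  collect = trans (lem (η ^ w) (η ^ v) (b ^ u) ((½ ^ n) ^ u))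
                    (trans (cong (λ z → z * b ^ u * (½ ^ n) ^ u) (trans (sym (^-homo-* η v w)) (cong (η ^_) (sym u≡v+w))))
                      (trans (cong (_* (½ ^ n) ^ u) (sym (^-distrib-* η b u))) (sym (^-distrib-* (η * b) (½ ^ n) u))))
                    where
                    lem : ∀ a b c d → a * (b * c * d) ≡ b * a * c * d
                    lem = solve 4 (λ a b c d → a :* (b :* c :* d) := b :* a :* c :* d) refl
            B≤ω : ∀ i → i ∈ I → B i ≤ ω i ^ u
            B≤ω i i∈ with Fin.any? (λ j → lookup i j ℕ.≟ m) | dev i ℕ.≟ 0
            ... | no none | _ = ≤-trans (B-away b i∈ 0≤b η≤b^u (λ j eq → none (j , eq)))
              (^-mono-≤ u (0≤D₂ i) (≤-trans (p≤p+q (0≤D₃ i)) (p≤q+p (0≤D₁ i))))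
            ... | yes (j , eq) | yes dev≡0 = ≤-trans (diagonal i i∈ eq dev≡0)
              (^-mono-≤ u (0≤D₁ i) (p≤p+q (0≤+ (0≤D₂ i) (0≤D₃ i))))
            ... | yes (j , eq) | no dev≢0 = ≤-trans (mixed i i∈ eq dev≢0)
              (^-mono-≤ u (0≤D₃ i) (≤-trans (p≤q+p (0≤D₂ i)) (p≤q+p (0≤D₁ i))))
            Σω≤1 : Σ I ω ≤ 1ℚ
            Σω≤1 = ≤-trans (≤-reflexive (trans (Σ-+ I D₁ _) (cong₂ _+_ (Σ-*ˡ I (1ℚ - c) _)
                (trans (Σ-+ I D₂ D₃) (cong₂ _+_ (Σ-*ˡ I b _) (Σ-*ˡ I (η * (ι 2 * b)) _))))))
              (≤-trans (+-mono-≤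
                  (*-monoˡ-≤ 0≤1-c (≤-trans (Geo0.Σ-dev L (λ l → ⟦ l ℕ.≟ m ⟧) Fin.zero (λ l → ⟦⟧-nonNeg (l ℕ.≟ m)))
                    (*≤1 (Σ-nonNeg (upTo L) (λ l → ⟦⟧-nonNeg (l ℕ.≟ m))) (≤-reflexive (1^n≡1 k)) (Σ-upTo-point L m))))
                  (+-mono-≤ (*-monoˡ-≤ 0≤b (Geo½.Σ-dev-avg L g 0≤g Σg≤η))
                    (*-monoˡ-≤ (0≤* 0≤η (0≤* (0≤ι 2) 0≤b))
                      (Geo½.Σ-dev-∑ L (λ _ l → ⟦ l ℕ.≟ m ⟧) (λ _ l → ⟦⟧-nonNeg (l ℕ.≟ m)) (λ _ → Σ-upTo-point L m)))))
                (≤-trans (≤-reflexive (lem c b t η (ι k) (ι 2)))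
                  (≤-trans (+-monoʳ-≤ (1ℚ - c) (*-monoˡ-≤ 0≤η b-small)) (≤-reflexive (lem′ c)))))
              where
              lem : ∀ c b t η k z → (1ℚ - c) * 1ℚ + (b * (t * η) + η * (z * b) * (t * (k * 1ℚ)))
                                  ≡ 1ℚ - c + η * (b * t + t * (k * (z * b)))
              lem = solve 6 (λ c b t η k z → (con 1ℚ :- c) :* con 1ℚ :+ (b :* (t :* η) :+ η :* (z :* b) :* (t :* (k :* con 1ℚ)))
                                  := con 1ℚ :- c :+ η :* (b :* t :+ t :* (k :* (z :* b)))) refl
              lem′ : ∀ c → 1ℚ - c + c ≡ 1ℚ
              lem′ = solve 1 (λ c → con 1ℚ :- c :+ c := con 1ℚ) refl

          -- The defect is O(1/p). The vectors with minimum m are bounded together by the hypothesis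
          -- on their sum. The others either avoid m entirely, where `B-away` gains ζ, or meet m
          -- with a smaller minimum, where every coordinate contributes a factor χ.
          level-bound : ∀ χ ζ → 0ℚ ≤ ζ → π ≤ χ → χ ≤ 1ℚ → η ≤ χ → χ ≤ ζ ^ u →
            Σ I (λ i → ⟦ minv i ℕ.≟ m ⟧ * N i) ^ u ≤ Φ →
            Σ I N ^ u ≤ Φ * (1ℚ + ζ * χ * (t + t * ι k)) ^ u
          level-bound χ ζ 0≤ζ π≤χ χ≤1 η≤χ χ≤ζ^u level = subst (λ z → z ^ u ≤ Φ * (1ℚ + ζ * χ * (t + t * ι k)) ^ u) (sym split)
            (≼-+ u 1≤u 0≤Φ (Σ-nonNeg I 0≤N-at) (Σ-nonNeg I 0≤N-off) 0≤1 (0≤* (0≤* 0≤ζ 0≤χ) (0≤+ 0≤t (0≤* 0≤t (0≤ι k))))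
              (subst (_ ≤_) (sym (trans (cong (Φ *_) (1^n≡1 u)) (*-identityʳ Φ))) level)
              (≼-mono u 0≤Φ (Σ-nonNeg I 0≤ω) Σω≤
                (Σ-≼ u I N-off ω 1≤u 0≤Φ 0≤N-off 0≤ω N-off≼ω)))
            where
            0≤χ : 0ℚ ≤ χ
            0≤χ = ≤-trans 0≤π π≤χ
            N-at N-off D₂ D₃ ω : Vec ℕ k → ℚ
            N-at i = ⟦ minv i ℕ.≟ m ⟧ * N i
            N-off i = ⟦ ¬? (minv i ℕ.≟ m) ⟧ * N i
            D₂ i = ζ * (½ ^ dev i * G i)
            D₃ i = ζ * χ * (½ ^ dev i * hits i)
            ω i = D₂ i + D₃ i
            0≤N-at : ∀ i → 0ℚ ≤ N-at i
            0≤N-at i = 0≤* (⟦⟧-nonNeg (minv i ℕ.≟ m)) (0≤N i)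
            0≤N-off : ∀ i → 0ℚ ≤ N-off i
            0≤N-off i = 0≤* (⟦⟧-nonNeg (¬? (minv i ℕ.≟ m))) (0≤N i)
            0≤D₂ : ∀ i → 0ℚ ≤ D₂ i
            0≤D₂ i = 0≤* 0≤ζ (0≤* (0≤½^ (dev i)) (0≤G i))
            0≤D₃ : ∀ i → 0ℚ ≤ D₃ i
            0≤D₃ i = 0≤* (0≤* 0≤ζ 0≤χ) (0≤* (0≤½^ (dev i)) (0≤hits i))
            0≤ω : ∀ i → 0ℚ ≤ ω i
            0≤ω i = 0≤+ (0≤D₂ i) (0≤D₃ i)
            split : Σ I N ≡ Σ I N-at + Σ I N-off
            split = trans (Σ-cong I pointwise) (Σ-+ I N-at N-off)
              where
              pointwise : ∀ i → N i ≡ N-at i + N-off i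
              pointwise i with minv i ℕ.≟ m
              ... | yes _ = sym (trans (cong₂ _+_ (*-identityˡ (N i)) (*-zeroˡ (N i))) (+-identityʳ (N i)))
              ... | no _  = sym (trans (cong₂ _+_ (*-zeroˡ (N i)) (*-identityˡ (N i))) (+-identityˡ (N i)))
            -- Pair each α_l with π^(d_l). A coordinate at m lies above the minimum, so π^(d_l) ≤ χ;
            -- any other has α_l ≤ η ≤ χ. Hence the w-th power is at most χ^(kw) ≤ χ * χ^u ≤ (ζχ)^u,
            -- and π^(v′ dev) is left for the summation.
            mixed : ∀ i → i ∈ I → ∀ {j} → lookup i j ≡ m → minv i ≢ m → B i ≤ D₃ i ^ u
            mixed i i∈ {j} i-j≡m min≢m = ≤-trans (≤-reflexive regroup)
              (≤-trans (*-mono-≤ (^-nonNeg w (Π-nonNeg 0≤factor)) (^-nonNeg u (0≤½^ (dev i)))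
                  (≤-trans (^-mono-≤ w (Π-nonNeg 0≤factor) (≤-trans (Π-mono 0≤factor factor≤χ) (≤-reflexive (Π-const k χ))))
                    (≤-trans (≤-reflexive (^-assocʳ χ k w)) (≤-trans (^-antiʳ-≤ 0≤χ χ≤1 u<kw) (*-monoʳ-≤ (^-nonNeg u 0≤χ) χ≤ζ^u))))
                  (≤-trans (^-mono-≤ (dev i) (^-nonNeg v′ 0≤π) (≤-trans (^≤self v′ 1≤v′ 0≤π π≤1) π≤½^u))
                    (≤-reflexive (^-comm ½ u (dev i)))))
                (≤-trans (≤-reflexive (trans (cong (_* (½ ^ dev i) ^ u) (sym (^-distrib-* ζ χ u))) (sym (^-distrib-* (ζ * χ) (½ ^ dev i) u))))
                  (^-mono-≤ u (0≤* (0≤* 0≤ζ 0≤χ) (0≤½^ (dev i))) (*-monoˡ-≤ (0≤* 0≤ζ 0≤χ)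
                    (subst (_≤ ½ ^ dev i * hits i) (*-identityʳ (½ ^ dev i)) (*-monoˡ-≤ (0≤½^ (dev i)) (1≤hits i j i-j≡m)))))))
              where
              d : Fin k → ℕ
              d l = lookup i l ℕ.∸ minv i
              factor : Fin k → ℚ
              factor l = α l (lookup i l) * π ^ d l
              0≤factor : ∀ l → 0ℚ ≤ factor l
              0≤factor l = 0≤* (0≤α l (lookup i l)) (^-nonNeg (d l) 0≤π)
              regroup : B i ≡ Π factor ^ w * (π ^ v′) ^ dev i
              regroup = trans (cong (λ z → P i ^ w * z ^ dev i) (trans (cong (π ^_) v≡w+v′) (^-homo-* π w v′)))
                (trans (cong (P i ^ w *_) (trans (^-distrib-* (π ^ w) (π ^ v′) (dev i)) (cong (_* (π ^ v′) ^ dev i) (^-comm π w (dev i)))))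
                  (trans (sym (*-assoc (P i ^ w) ((π ^ dev i) ^ w) ((π ^ v′) ^ dev i)))
                    (cong (_* (π ^ v′) ^ dev i) (trans (sym (^-distrib-* (P i) (π ^ dev i) w))
                      (cong (_^ w) (trans (cong (P i *_) (^-∑ⁿ π d)) (sym (Π-* (λ l → α l (lookup i l)) (λ l → π ^ d l)))))))))
              factor≤χ : ∀ l → factor l ≤ χ
              factor≤χ l with lookup i l ℕ.≟ m
              ... | yes at = ≤-trans (*≤ˡ (^-nonNeg (d l) 0≤π) (α[ i∈ ]≤1 l)) (≤-trans (^≤self (d l) 1≤d 0≤π π≤1) π≤χ)
                where
                1≤d : 1 ℕ.≤ d l
                1≤d = ℕ.m<n⇒0<n∸m (ℕ.≤∧≢⇒< (minv-≤ i l) (λ eq → min≢m (trans eq at)))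
              ... | no away = ≤-trans (*≤ʳ (0≤α l (lookup i l)) (^≤1 (d l) 0≤π π≤1)) (≤-trans (α≤η l (∈-vecs⁻ i i∈ l) away) η≤χ)
            N-off≼ω : ∀ i → i ∈ I → N-off i ^ u ≤ Φ * ω i ^ u
            N-off≼ω i i∈ with minv i ℕ.≟ m
            ... | yes _ = ≤-trans (≤-reflexive (cong (_^ u) (*-zeroˡ (N i)))) (subst (_≤ Φ * ω i ^ u)
                   (sym (0^ 1≤u)) (0≤* 0≤Φ (^-nonNeg u (0≤ω i))))
              where
              0^ : ∀ {n} → 1 ℕ.≤ n → 0ℚ ^ n ≡ 0ℚ
              0^ {suc n} _ = *-zeroˡ (0ℚ ^ n)
            ... | no min≢m with Fin.any? (λ j → lookup i j ℕ.≟ m)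
            ...   | no none = ≤-trans (≤-reflexive (cong (_^ u) (*-identityˡ (N i)))) (≤-trans (N≼B i i∈) (*-monoˡ-≤ 0≤Φ
                    (≤-trans (B-away ζ i∈ 0≤ζ (≤-trans η≤χ χ≤ζ^u) (λ j eq → none (j , eq)))
                      (^-mono-≤ u (0≤D₂ i) (p≤p+q (0≤D₃ i))))))
            ...   | yes (j , eq) = ≤-trans (≤-reflexive (cong (_^ u) (*-identityˡ (N i)))) (≤-trans (N≼B i i∈) (*-monoˡ-≤ 0≤Φ
                    (≤-trans (mixed i i∈ eq min≢m) (^-mono-≤ u (0≤D₃ i) (p≤q+p (0≤D₂ i))))))
            Σω≤ : Σ I ω ≤ ζ * χ * (t + t * ι k)
            Σω≤ = ≤-trans (≤-reflexive (trans (Σ-+ I D₂ D₃) (cong₂ _+_ (Σ-*ˡ I ζ _) (Σ-*ˡ I (ζ * χ) _))))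
              (≤-trans (+-mono-≤ (*-monoˡ-≤ 0≤ζ (≤-trans (Geo½.Σ-dev-avg L g 0≤g Σg≤η) (*-monoˡ-≤ 0≤t η≤χ)))
                  (*-monoˡ-≤ (0≤* 0≤ζ 0≤χ)
                    (Geo½.Σ-dev-∑ L (λ _ l → ⟦ l ℕ.≟ m ⟧) (λ _ l → ⟦⟧-nonNeg (l ℕ.≟ m)) (λ _ → Σ-upTo-point L m))))
                (≤-reflexive (lem ζ χ t (ι k))))
              where
              lem : ∀ ζ χ t k → ζ * (t * χ) + ζ * χ * (t * (k * 1ℚ)) ≡ ζ * χ * (t + t * k)
              lem = solve 4 (λ ζ χ t k → ζ :* (t :* χ) :+ ζ :* χ :* (t :* (k :* con 1ℚ)) := ζ :* χ :* (t :+ t :* k)) refl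

  argmin : ∀ {n} (f : Fin (suc n) → ℚ) → ∃[ j₀ ] (∀ j → f j₀ ≤ f j)
  argmin {zero}  f = Fin.zero , λ { Fin.zero → ≤-refl }
  argmin {suc n} f with argmin (f ∘ Fin.suc)
  ... | j₀ , least with ≤-total (f Fin.zero) (f (Fin.suc j₀))
  ...   | inj₁ h = Fin.zero , λ { Fin.zero → ≤-refl ; (Fin.suc j) → ≤-trans h (least j) }
  ...   | inj₂ h = Fin.suc j₀ , λ { Fin.zero → h ; (Fin.suc j) → least j }

  1/suc≤1 : ∀ n → 1/suc n ≤ 1ℚ
  1/suc≤1 n = subst₂ _≤_ (*-identityˡ (1/suc n)) (1/suc-inverse n) (*-monoʳ-≤ (<⇒≤ (0<1/suc n)) (ι-mono {1} {suc n} (ℕ.s≤s ℕ.z≤n)))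

  1/suc-≤ : ∀ {σ} → 0ℚ < σ → ∃[ P ] (∀ n → P ℕ.≤ n → 1/suc n ≤ σ)
  1/suc-≤ {σ} 0<σ = let (P , h) = archimedean (inv σ) in P , λ n P≤n →
    subst₂ _≤_ (trans (cong (_* 1/suc n) (inv-inverse 0<σ)) (*-identityˡ (1/suc n)))
      (trans (*-assoc σ (ι (suc n)) (1/suc n)) (trans (cong (σ *_) (1/suc-inverse n)) (*-identityʳ σ)))
      (*-monoʳ-≤ (<⇒≤ (0<1/suc n)) (*-monoˡ-≤ (<⇒≤ 0<σ)
        (≤-trans h (ι-mono (ℕ.≤-trans P≤n (ℕ.n≤1+n n))))))

  inv≤1 : ∀ {x} → 1ℚ ≤ x → inv x ≤ 1ℚ
  inv≤1 {x} 1≤x = subst₂ _≤_ (*-identityˡ (inv x)) (inv-inverse 0<x) (*-monoʳ-≤ (<⇒≤ (0<inv 0<x)) 1≤x)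
    where 0<x = <-≤-trans 0<1 1≤x

  1≤inv : ∀ {x} → 0ℚ < x → x ≤ 1ℚ → 1ℚ ≤ inv x
  1≤inv {x} 0<x x≤1 = subst₂ _≤_ (inv-inverse 0<x) (*-identityˡ (inv x)) (*-monoʳ-≤ (<⇒≤ (0<inv 0<x)) x≤1)

  -- Constants and the product of the losses at large primes

  module Constants (k₁ u : ℕ) (1≤u : 1 ℕ.≤ u) where

    k = suc k₁

    t : ℚ
    t = ι 2 ^ k

    1≤t : 1ℚ ≤ t
    1≤t = 1≤^ k (ι-mono {1} {2} (ℕ.s≤s ℕ.z≤n))

    0<t : 0ℚ < t
    0<t = <-≤-trans 0<1 1≤t

    c : ℚ
    c = t + t * (ι k * ι 2)

    1≤c : 1ℚ ≤ c
    1≤c = ≤-trans 1≤t (p≤p+q (0≤* (<⇒≤ 0<t) (0≤* (0≤ι k) (0≤ι 2))))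

    0<c : 0ℚ < c
    0<c = <-≤-trans 0<1 1≤c

    -- Solves `b-small` with equality.
    b : ℚ
    b = 1/suc k₁ * inv c

    0<b : 0ℚ < b
    0<b = 0<* (0<1/suc k₁) (0<inv 0<c)

    b≤1 : b ≤ 1ℚ
    b≤1 = *≤1 (<⇒≤ (0<inv 0<c)) (1/suc≤1 k₁) (inv≤1 1≤c)

    b-small : b * t + t * (ι k * (ι 2 * b)) ≤ 1/suc k₁
    b-small = ≤-reflexive (trans (lem (1/suc k₁) (inv c) t (ι k) (ι 2))
      (trans (cong (1/suc k₁ *_) (inv-inverse 0<c)) (*-identityʳ (1/suc k₁))))
      where
      lem : ∀ r i t k z → (r * i) * t + t * (k * (z * (r * i))) ≡ r * ((t + t * (k * z)) * i)
      lem = solve 5 (λ r i t k z → (r :* i) :* t :+ t :* (k :* (z :* (r :* i))) := r :* ((t :+ t :* (k :* z)) :* i)) refl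

    -- Solves `θ-small` with equality.
    θ : ℚ
    θ = b ^ u * 1/suc (k ℕ.* u) * inv t

    0<θ : 0ℚ < θ
    0<θ = 0<* (0<* (^-pos u 0<b) (0<1/suc (k ℕ.* u))) (0<inv 0<t)

    θ≤b^u : θ ≤ b ^ u
    θ≤b^u = ≤-trans (*≤ʳ (<⇒≤ (0<* (^-pos u 0<b) (0<1/suc (k ℕ.* u)))) (inv≤1 1≤t))
      (*≤ʳ (<⇒≤ (^-pos u 0<b)) (1/suc≤1 (k ℕ.* u)))

    θ-small : θ * t ≤ b ^ u * 1/suc (k ℕ.* u)
    θ-small = ≤-reflexive (lem (b ^ u * 1/suc (k ℕ.* u)) (inv t) (trans (*-comm (inv t) t) (inv-inverse 0<t)))
      where
      lem : ∀ z i → i * t ≡ 1ℚ → z * i * t ≡ z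
      lem z i eq = trans (*-assoc z i t) (trans (cong (z *_) eq) (*-identityʳ z))

    0<½ : 0ℚ < ½
    0<½ = positive⁻¹ ½

    -- A prime is large once 1/p is at most this value. Of the three requirements it is the
    -- strictest: `spread-bound` needs (θ/2)^u, the sums with ratio 1/2 need (1/2)^u, and χ ≤ 1
    -- needs b^u.
    θ½ : ℚ
    θ½ = (θ * ½) ^ u

    0<θ½ : 0ℚ < θ½
    0<θ½ = ^-pos u (0<* 0<θ 0<½)

    θ½≤½^u : θ½ ≤ ½ ^ u
    θ½≤½^u = ^-mono-≤ u (<⇒≤ (0<* 0<θ 0<½)) (*≤ˡ 0≤½ (≤-trans θ≤b^u (^≤1 u (<⇒≤ 0<b) b≤1)))

    θ½≤b^u : θ½ ≤ b ^ u
    θ½≤b^u = ≤-trans (^≤self u 1≤u (<⇒≤ (0<* 0<θ 0<½)) (≤-trans θ½≤θ (≤-trans θ≤b^u (^≤1 u (<⇒≤ 0<b) b≤1))))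
      (≤-trans θ½≤θ θ≤b^u)
      where
      θ½≤θ : θ * ½ ≤ θ
      θ½≤θ = *≤ʳ (<⇒≤ 0<θ) ½≤1

    β : ℚ
    β = inv b

    0<β : 0ℚ < β
    0<β = 0<inv 0<b

    1≤β : 1ℚ ≤ β
    1≤β = 1≤inv 0<b b≤1

    β^u*b^u : β ^ u * b ^ u ≡ 1ℚ
    β^u*b^u = trans (sym (^-distrib-* β b u)) (trans (cong (_^ u) (trans (*-comm β b) (inv-inverse 0<b))) (1^n≡1 u))

    -- With χ = β^u/p and ζ = β ψ(p-1), the loss in `level-bound` is 1 + K₁ ψ(p-1)/p.
    K₁ : ℚ
    K₁ = β * β ^ u * (t + t * ι k)

    0<K₁ : 0ℚ < K₁
    0<K₁ = 0<* (0<* 0<β (^-pos u 0<β)) (<-≤-trans 0<t (p≤p+q (0≤* (<⇒≤ 0<t) (0≤ι k))))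

    -- `ψ-lower` needs 2u ≤ H: then u x(n) is at most half of 1/(n+1).
    H : ℕ
    H = suc (u ℕ.+ u)

    -- A rational substitute for (n + 1)^(-1/H).
    ψ : ℕ → ℚ
    x : ℕ → ℚ
    x n = 1/suc (u ℕ.+ u) * 1/suc n
    ψ zero    = 1ℚ
    ψ (suc n) = ψ n * (1ℚ - x n)

    0≤x : ∀ n → 0ℚ ≤ x n
    0≤x n = 0≤* (<⇒≤ (0<1/suc (u ℕ.+ u))) (<⇒≤ (0<1/suc n))

    0≤1-x : ∀ n → 0ℚ ≤ 1ℚ - x n
    0≤1-x n = p≤q⇒0≤q-p (*≤1 (<⇒≤ (0<1/suc n)) (1/suc≤1 (u ℕ.+ u)) (1/suc≤1 n))

    0≤ψ : ∀ n → 0ℚ ≤ ψ n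
    0≤ψ zero    = 0≤1
    0≤ψ (suc n) = 0≤* (0≤ψ n) (0≤1-x n)

    Hx : ∀ n → ι H * x n ≡ 1/suc n
    Hx n = trans (sym (*-assoc (ι H) (1/suc (u ℕ.+ u)) (1/suc n)))
      (trans (cong (_* 1/suc n) (1/suc-inverse (u ℕ.+ u))) (*-identityˡ (1/suc n)))

    1/suc-step : ∀ n → 1/suc n ≡ 1/suc (suc n) * (1ℚ + 1/suc n)
    1/suc-step n = begin-equality
      1/suc n ≡⟨ *-identityˡ (1/suc n) ⟨
      1ℚ * 1/suc n ≡⟨ cong (_* 1/suc n) (1/suc-inverse (suc n)) ⟨
      ι (suc (suc n)) * 1/suc (suc n) * 1/suc n ≡⟨ cong (λ z → z * 1/suc (suc n) * 1/suc n) (ι-suc (suc n)) ⟩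
      (1ℚ + ι (suc n)) * 1/suc (suc n) * 1/suc n ≡⟨ lem (ι (suc n)) (1/suc (suc n)) (1/suc n) ⟩
      1/suc (suc n) * (1/suc n + ι (suc n) * 1/suc n) ≡⟨ cong (λ z → 1/suc (suc n) * (1/suc n + z)) (1/suc-inverse n) ⟩
      1/suc (suc n) * (1/suc n + 1ℚ) ≡⟨ cong (1/suc (suc n) *_) (+-comm (1/suc n) 1ℚ) ⟩
      1/suc (suc n) * (1ℚ + 1/suc n) ∎
      where
      open ≤-Reasoning
      lem : ∀ i a c → (1ℚ + i) * a * c ≡ a * (c + i * c)
      lem = solve 3 (λ i a c → (con 1ℚ :+ i) :* a :* c := a :* (c :+ i :* c)) refl

    -- This half of (n+1)^(-1/u) ≤ ψ(n) ≤ (n+1)^(-1/H) provides χ ≤ ζ^u in `level-bound`. By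
    -- Bernoulli, (1 - x)^u ≥ 1 - ux, and this exceeds the ratio (n+1)/(n+2) of consecutive
    -- left-hand sides.
    ψ-lower : ∀ n → 1/suc n ≤ ψ n ^ u
    ψ-lower zero    = ≤-reflexive (sym (1^n≡1 u))
    ψ-lower (suc n) = ≤-trans step
      (≤-trans (*-mono-≤ (<⇒≤ (0<1/suc n)) (^-nonNeg u (0≤1-x n)) (ψ-lower n) (bernoulli⁻ (x n) u (0≤1-x n)))
        (≤-reflexive (sym (^-distrib-* (ψ n) (1ℚ - x n) u))))
      where
      q = 1/suc n
      y = ι u * x n
      0≤y : 0ℚ ≤ y
      0≤y = 0≤* (0≤ι u) (0≤x n)
      y+y≤q : y + y ≤ q
      y+y≤q = subst₂ _≤_ (trans (cong (_* x n) ι+) (*-distribʳ-+ (x n) (ι u) (ι u))) (Hx n)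
        (*-monoʳ-≤ (0≤x n) (ι-mono (ℕ.n≤1+n (u ℕ.+ u))))
        where
        ι+ : ι (u ℕ.+ u) ≡ ι u + ι u
        ι+ = trans (cong ι (sym (cong (u ℕ.+_) (ℕ.+-identityʳ u)))) (trans (ι-* 2 u) (lem (ι u)))
          where
          lem : ∀ i → ι 2 * i ≡ i + i
          lem = solve 1 (λ i → con (ι 2) :* i := i :+ i) refl
      1≤[1+q][1-y] : ∀ q y → y + y ≤ q → 0ℚ ≤ y → q ≤ 1ℚ → 1ℚ ≤ (1ℚ + q) * (1ℚ - y)
      1≤[1+q][1-y] q y y+y≤q 0≤y q≤1 = ≤-by-gap _ (0≤+ (p≤q⇒0≤q-p y+y≤q) (0≤* 0≤y (p≤q⇒0≤q-p q≤1))) (lem q y)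
        where
        lem : ∀ q y → (1ℚ + q) * (1ℚ - y) ≡ 1ℚ + (q - (y + y) + y * (1ℚ - q))
        lem = solve 2 (λ q y → (con 1ℚ :+ q) :* (con 1ℚ :- y) := con 1ℚ :+ (q :- (y :+ y) :+ y :* (con 1ℚ :- q))) refl
      expand : ∀ {p q z} → q ≡ p * (1ℚ + q) → 0ℚ ≤ p → 1ℚ ≤ (1ℚ + q) * z → p ≤ q * z
      expand {p} {q} {z} eq 0≤p h = subst₂ _≤_ (*-identityʳ p)
        (trans (sym (*-assoc p (1ℚ + q) z)) (cong (_* z) (sym eq))) (*-monoˡ-≤ 0≤p h)
      step : 1/suc (suc n) ≤ q * (1ℚ - y)
      step = expand {1/suc (suc n)} {q} {1ℚ - y} (1/suc-step n) (<⇒≤ (0<1/suc (suc n))) (1≤[1+q][1-y] q y y+y≤q 0≤y (1/suc≤1 n))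

    -- Makes `ψ` tend to 0. The factor 1 + 1/(n+1) = 1 + Hx is at most (1 + x)^H, and (1 + x)(1 - x)
    -- ≤ 1.
    ψ-upper : ∀ n → ψ n ^ H ≤ 1/suc n
    ψ-upper zero    = ≤-reflexive (1^n≡1 H)
    ψ-upper (suc n) = ≤-trans (≤-reflexive (^-distrib-* (ψ n) (1ℚ - x n) H))
      (≤-trans (*-monoʳ-≤ (^-nonNeg H (0≤1-x n)) (ψ-upper n))
        (≤-trans (≤-reflexive (trans (cong (_* (1ℚ - x n) ^ H) (1/suc-step n)) (*-assoc (1/suc (suc n)) (1ℚ + 1/suc n) ((1ℚ - x n) ^ H))))
          (*≤ʳ (<⇒≤ (0<1/suc (suc n))) shrink)))
      where
      shrink : (1ℚ + 1/suc n) * (1ℚ - x n) ^ H ≤ 1ℚ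
      shrink = ≤-trans (*-monoʳ-≤ (^-nonNeg H (0≤1-x n)) (subst (λ z → 1ℚ + z ≤ (1ℚ + x n) ^ H) (Hx n) (bernoulli H (0≤x n))))
        (≤-trans (≤-reflexive (sym (^-distrib-* (1ℚ + x n) (1ℚ - x n) H)))
          (^≤1 H (0≤* (0≤+ 0≤1 (0≤x n)) (0≤1-x n)) (≤-by-gap (x n * x n) (0≤-sq (x n)) (lem (x n)))))
        where
        lem : ∀ x → 1ℚ ≡ (1ℚ + x) * (1ℚ - x) + x * x
        lem = solve 1 (λ x → con 1ℚ := (con 1ℚ :+ x) :* (con 1ℚ :- x) :+ x :* x) refl

    loss : ℕ → ℚ
    loss n = 1ℚ + K₁ * (ψ n * 1/suc n)

    1≤loss : ∀ n → 1ℚ ≤ loss n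
    1≤loss n = p≤p+q (0≤* (<⇒≤ 0<K₁) (0≤* (0≤ψ n) (<⇒≤ (0<1/suc n))))

    Ψ : ℕ → ℕ → ℚ
    Ψ p zero    = 1ℚ
    Ψ p (suc j) = Ψ p j * loss (p ℕ.+ j)

    0≤Ψ : ∀ p j → 0ℚ ≤ Ψ p j
    0≤Ψ p zero    = 0≤1
    0≤Ψ p (suc j) = 0≤* (0≤Ψ p j) (≤-trans 0≤1 (1≤loss (p ℕ.+ j)))

    κ : ℚ
    κ = ι 2 * K₁ * ι H

    0<κ : 0ℚ < κ
    0<κ = 0<* (0<* (<-≤-trans 0<1 (ι-mono {1} {2} (ℕ.s≤s ℕ.z≤n))) 0<K₁) (<-≤-trans 0<1 (ι-mono {1} {H} (ℕ.s≤s ℕ.z≤n)))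

    -- `Ψ` + κ `ψ` does not increase while Ψ ≤ 2: a step adds Ψ K₁ ψ(n)/(n+1) to the first term and
    -- takes κ ψ(n) x(n) = 2 K₁ ψ(n)/(n+1) from the second. This replaces the convergence of Σ
    -- n^(-1-1/H).
    Ψ-invariant : ∀ p → κ * ψ p ≤ 1ℚ → ∀ j → Ψ p j + κ * ψ (p ℕ.+ j) ≤ ι 2
    Ψ-invariant p h zero    = subst (λ n → 1ℚ + κ * ψ n ≤ ι 2) (sym (ℕ.+-identityʳ p)) (+-monoʳ-≤ 1ℚ h)
    Ψ-invariant p h (suc j) = subst (λ n → Ψ p (suc j) + κ * ψ n ≤ ι 2) (sym (ℕ.+-suc p j)) (≤-trans step ih)
      where
      n = p ℕ.+ j
      ih = Ψ-invariant p h j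
      Ψ≤2 : Ψ p j ≤ ι 2
      Ψ≤2 = ≤-trans (p≤p+q (0≤* (<⇒≤ 0<κ) (0≤ψ n))) ih
      lem : ∀ P K y q xn Hn two → Hn * xn ≡ q → P + two * K * Hn * y ≡ P * (1ℚ + K * (y * q)) + two * K * Hn * (y * (1ℚ - xn)) + (two - P) * (K * (y * q))
      lem P K y q xn Hn two refl = solve 6 (λ P K y xn Hn two → P :+ two :* K :* Hn :* y
        := P :* (con 1ℚ :+ K :* (y :* (Hn :* xn))) :+ two :* K :* Hn :* (y :* (con 1ℚ :- xn)) :+ (two :- P) :* (K :* (y :* (Hn :* xn)))) refl P K y xn Hn two
      step : Ψ p (suc j) + κ * ψ (suc n) ≤ Ψ p j + κ * ψ n
      step = ≤-by-gap ((ι 2 - Ψ p j) * (K₁ * (ψ n * 1/suc n)))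
        (0≤* (p≤q⇒0≤q-p Ψ≤2) (0≤* (<⇒≤ 0<K₁) (0≤* (0≤ψ n) (<⇒≤ (0<1/suc n)))))
        (lem (Ψ p j) K₁ (ψ n) (1/suc n) (x n) (ι H) (ι 2) (Hx n))

    threshold : ∃[ P ] (∀ n → P ℕ.≤ n → 1/suc n ≤ θ½ × κ * ψ n ≤ 1ℚ)
    threshold = let (P₁ , h₁) = 1/suc-≤ 0<θ½
                    (P₂ , h₂) = 1/suc-≤ (^-pos H (0<inv 0<κ))
      in P₁ ℕ.⊔ P₂ , λ n P≤n → h₁ n (⊔-left P₁ P₂ P≤n) ,
         subst (κ * ψ n ≤_) (inv-inverse 0<κ) (*-monoˡ-≤ (<⇒≤ 0<κ)
           (^-cancel-≤ H (ℕ.s≤s ℕ.z≤n) (<⇒≤ (0<inv 0<κ)) (≤-trans (ψ-upper n) (h₂ n (⊔-right P₁ P₂ P≤n)))))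

    Ψ≤2 : ∀ p → κ * ψ p ≤ 1ℚ → ∀ j → Ψ p j ≤ ι 2
    Ψ≤2 p h j = ≤-trans (p≤p+q (0≤* (<⇒≤ 0<κ) (0≤ψ (p ℕ.+ j)))) (Ψ-invariant p h j)

    module LargePrime (v w v′ : ℕ) (u≡v+w : u ≡ v ℕ.+ w) (v≡w+v′ : v ≡ w ℕ.+ v′) (1≤v′ : 1 ℕ.≤ v′) (1≤w : 1 ℕ.≤ w)
      (u<kw : suc u ℕ.≤ suc k₁ ℕ.* w) (L n : ℕ)
      (α : Fin (suc k₁) → ℕ → ℚ) (0≤α : ∀ j l → 0ℚ ≤ α j l) (Σα≤1 : ∀ j → Σ (upTo L) (α j) ≤ 1ℚ)
      (Φ : ℚ) (0≤Φ : 0ℚ ≤ Φ) where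

      open LocalWeights k₁ u v w v′ u≡v+w v≡w+v′ 1≤v′ 1≤w u<kw L (1/suc n) (<⇒≤ (0<1/suc n)) (1/suc≤1 n) α 0≤α Σα≤1 Φ 0≤Φ
        using (I; B; spread-bound; module Concentrated)

      -- Three regimes: no level on which every A_j is dense (`spread-bound`); such a level with
      -- defect at least χ (`near-bound`); such a level with defect at most χ (`level-bound`). Only
      -- the last one incurs a loss.
      large-bound : 1/suc n ≤ θ½ → (N : Vec ℕ k → ℚ) → (∀ i → 0ℚ ≤ N i) → (∀ i → i ∈ I → N i ^ u ≤ Φ * B i) →
        (∀ m → m ℕ.< L → Σ I (λ i → ⟦ minv i ℕ.≟ m ⟧ * N i) ^ u ≤ Φ) → Σ I N ^ u ≤ Φ * loss n ^ u
      large-bound π≤θ½ N 0≤N N≼B level =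
        by-spread (any? (λ m → Fin.all? (λ j → 1ℚ - b ^ u <? α j m)) (upTo L))
        where
        π = 1/suc n
        -- Chosen so that χ b^u = π: then χ ≤ η is just what `near-bound` requires of η.
        χ = π * β ^ u
        0≤b = <⇒≤ 0<b
        π≤½^u = ≤-trans π≤θ½ θ½≤½^u
        Φ≤ : Φ ≤ Φ * loss n ^ u
        Φ≤ = subst (_≤ Φ * loss n ^ u) (*-identityʳ Φ) (*-monoˡ-≤ 0≤Φ (1≤^ u (1≤loss n)))
        χb^u≡π : χ * b ^ u ≡ π
        χb^u≡π = trans (*-assoc π (β ^ u) (b ^ u)) (trans (cong (π *_) β^u*b^u) (*-identityʳ π))
        χ≤1 : χ ≤ 1ℚ
        χ≤1 = *-cancelˡ-≤ (^-pos u 0<b) (subst₂ _≤_ (sym (trans (*-comm (b ^ u) χ) χb^u≡π)) (sym (*-identityʳ (b ^ u)))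
          (≤-trans π≤θ½ θ½≤b^u))
        π≤χ : π ≤ χ
        π≤χ = subst (_≤ χ) (*-identityʳ π) (*-monoˡ-≤ (<⇒≤ (0<1/suc n)) (1≤^ u 1≤β))
        χ≤ζ^u : χ ≤ (β * ψ n) ^ u
        χ≤ζ^u = ≤-trans (*-monoʳ-≤ (^-nonNeg u (<⇒≤ 0<β)) (ψ-lower n))
          (≤-reflexive (trans (*-comm (ψ n ^ u) (β ^ u)) (sym (^-distrib-* β (ψ n) u))))
        loss≡ : 1ℚ + β * ψ n * χ * (t + t * ι k) ≡ loss n
        loss≡ = cong (1ℚ +_) (lem β (ψ n) π (β ^ u) (t + t * ι k))
          where
          lem : ∀ b y p c s → b * y * (p * c) * s ≡ b * c * s * (y * p)
          lem = solve 5 (λ b y p c s → b :* y :* (p :* c) :* s := b :* c :* s :* (y :* p)) refl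
        by-spread : Dec (Any (λ m → ∀ j → 1ℚ - b ^ u < α j m) (upTo L)) → Σ I N ^ u ≤ Φ * loss n ^ u
        by-spread (no none) = ≤-trans
          (spread-bound N 0≤N N≼B b θ 0≤b b≤1 (<⇒≤ 0<θ) π≤½^u θ-small π≤θ½ λ m m∈ →
            let (j , ¬h) = Fin.¬∀⟶∃¬ k (λ j → 1ℚ - b ^ u < α j m) (λ j → 1ℚ - b ^ u <? α j m) (λ all → none (lose m∈ all))
            in j , ≮⇒≥ ¬h)
          Φ≤
        by-spread (yes some) = let (m , m∈ , dense) = find some ; (j₀ , least) = argmin (λ j → α j m) in concentrated m (∈-upTo⁻ m∈) j₀ least (dense j₀)
          where
          concentrated : ∀ m → m ℕ.< L → ∀ j₀ → (∀ j → α j₀ m ≤ α j m) → 1ℚ - b ^ u < α j₀ m → Σ I N ^ u ≤ Φ * loss n ^ u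
          concentrated m m<L j₀ least dense with ≤-total χ (1ℚ - α j₀ m)
          ... | inj₁ χ≤η = ≤-trans (near-bound b-small η≤b^u (≤-trans (≤-reflexive (sym χb^u≡π)) (*-monoʳ-≤ (^-nonNeg u 0≤b) χ≤η))) Φ≤
            where
            open Concentrated N 0≤N N≼B b θ 0≤b b≤1 (<⇒≤ 0<θ) π≤½^u m m<L j₀ least
            η≤b^u : 1ℚ - α j₀ m ≤ b ^ u
            η≤b^u = 0≤q-p⇒p≤q (subst (0ℚ ≤_) (lem (α j₀ m) (b ^ u)) (p≤q⇒0≤q-p (<⇒≤ dense)))
              where
              lem : ∀ a y → a - (1ℚ - y) ≡ y - (1ℚ - a)
              lem = solve 2 (λ a y → a :- (con 1ℚ :- y) := y :- (con 1ℚ :- a)) refl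
          ... | inj₂ η≤χ = subst (λ z → Σ I N ^ u ≤ Φ * z ^ u) loss≡
                (level-bound χ (β * ψ n) (0≤* (<⇒≤ 0<β) (0≤ψ n)) π≤χ χ≤1 η≤χ χ≤ζ^u (level m m<L))
            where open Concentrated N 0≤N N≼B b θ 0≤b b≤1 (<⇒≤ 0<θ) π≤½^u m m<L j₀ least using (level-bound)

  -- Valuations and gcds

  greatest-≤ : ∀ P b → greatest P b ℕ.≤ b
  greatest-≤ P zero    = ℕ.z≤n
  greatest-≤ P (suc b) with P (suc b)
  ... | true  = ℕ.≤-refl
  ... | false = ℕ.m≤n⇒m≤1+n (greatest-≤ P b)

  -- Searching up to a suffices for a ≥ 1, since p^(a+1) > a.
  val : ℕ → ℕ → ℕ
  val p a = greatest (λ e → does (p ℕ.^ e ∣? a)) a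

  n<m^[1+n] : ∀ {m} n → 2 ℕ.≤ m → n ℕ.< m ℕ.^ suc n
  n<m^[1+n] {m} n 2≤m = ℕ.<-≤-trans (lem n) (ℕ.^-monoˡ-≤ (suc n) 2≤m)
    where
    lem : ∀ n → n ℕ.< 2 ℕ.^ suc n
    lem zero    = ℕ.s≤s ℕ.z≤n
    lem (suc n) = ℕ.≤-trans (ℕ.+-mono-≤ {1} (ℕ.≤-trans (ℕ.s≤s ℕ.z≤n) (lem n)) (lem n))
      (ℕ.≤-reflexive (cong (2 ℕ.^ suc n ℕ.+_) (sym (ℕ.+-identityʳ _))))

  val-∣ : ∀ p a → p ℕ.^ val p a ∣ a
  val-∣ p a = does-true (p ℕ.^ val p a ∣? a)
    (greatest-true (λ e → does (p ℕ.^ e ∣? a)) a (true-does (1 ∣? a) (1∣ a)))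

  val-∤ : ∀ {p a} → 2 ℕ.≤ p → 1 ℕ.≤ a → ¬ p ℕ.^ suc (val p a) ∣ a
  val-∤ {p} {a} 2≤p 1≤a = does-false (p ℕ.^ suc (val p a) ∣? a)
    (greatest-max (λ e → does (p ℕ.^ e ∣? a)) a (false-does (p ℕ.^ suc a ∣? a) top))
    where
    top : ¬ p ℕ.^ suc a ∣ a
    top h = ℕ.<⇒≱ (n<m^[1+n] a 2≤p) (∣⇒≤ {{ℕ.>-nonZero 1≤a}} h)

  val-≤ : ∀ p a → val p a ℕ.≤ a
  val-≤ p a = greatest-≤ _ a

  ^-∣ : ∀ p {m n} → m ℕ.≤ n → p ℕ.^ m ∣ p ℕ.^ n
  ^-∣ p {m} {n} m≤n = subst (λ e → p ℕ.^ m ∣ p ℕ.^ e) (ℕ.m+[n∸m]≡n m≤n)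
    (subst (p ℕ.^ m ∣_) (sym (ℕ.^-distribˡ-+-* p m (n ℕ.∸ m))) (m∣m*n (p ℕ.^ (n ℕ.∸ m))))

  prime⇒2≤ : ∀ {p} → Prime p → 2 ℕ.≤ p
  prime⇒2≤ {p} pp = ℕ.nonTrivial⇒n>1 p {{prime⇒nonTrivial pp}}

  ∤⇒coprime : ∀ {p h} → Prime p → ¬ p ∣ h → Coprime h p
  ∤⇒coprime {p} pp p∤h (d∣h , d∣p) with prime⇒irreducible pp d∣p
  ... | inj₁ d≡1 = d≡1
  ... | inj₂ refl = ⊥-elim (p∤h d∣h)

  coprime-power-divisor : ∀ {h p x} n → Coprime h p → h ∣ p ℕ.^ n ℕ.* x → h ∣ x
  coprime-power-divisor {h} {p} {x} zero    cop h∣ = subst (h ∣_) (ℕ.+-identityʳ x) h∣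
  coprime-power-divisor {h} {p} {x} (suc n) cop h∣ = coprime-power-divisor n cop
    (coprime-divisor cop (subst (h ∣_) (ℕ.*-assoc p (p ℕ.^ n) x) h∣))

  prime-power-divisor : ∀ {p c x} n → Prime p → ¬ p ∣ c → p ℕ.^ n ∣ c ℕ.* x → p ℕ.^ n ∣ x
  prime-power-divisor {p} {c} {x} zero    pp p∤c h = 1∣ x
  prime-power-divisor {p} {c} {x} (suc n) pp p∤c h with euclidsLemma c x pp (∣-trans (m∣m*n (p ℕ.^ n)) h)
  ... | inj₁ p∣c = ⊥-elim (p∤c p∣c)
  ... | inj₂ (divides y refl) = subst (p ℕ.^ suc n ∣_) (ℕ.*-comm p y) (*-monoʳ-∣ p
        (prime-power-divisor n pp p∤c (*-cancelˡ-∣ p {{prime⇒nonZero pp}}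
          (subst (p ℕ.^ suc n ∣_) (trans (sym (ℕ.*-assoc c y p)) (ℕ.*-comm (c ℕ.* y) p)) h))))

  coprime-product-∣ : ∀ {p c a} n → Prime p → ¬ p ∣ c → c ∣ a → p ℕ.^ n ∣ a → c ℕ.* p ℕ.^ n ∣ a
  coprime-product-∣ {p} {c} n pp p∤c (divides q refl) h = subst (c ℕ.* p ℕ.^ n ∣_) (ℕ.*-comm c q)
    (*-monoʳ-∣ c (prime-power-divisor n pp p∤c (subst (p ℕ.^ n ∣_) (ℕ.*-comm q c) h)))

  -- Write h = p^e h′ with h′ prime to p. Then e ≤ m, and h′ divides x. This moves the true power of
  -- p into `g` in place of the unknown p^K.
  cap-exponent : ∀ {p h K m x} → Prime p → 1 ℕ.≤ h → ¬ p ℕ.^ suc m ∣ h → h ∣ p ℕ.^ K ℕ.* x → h ∣ p ℕ.^ m ℕ.* x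
  cap-exponent {p} {h} {K} {m} {x} pp 1≤h ∤h h∣ = go (val-∣ p h)
    where
    2≤p = prime⇒2≤ pp
    e = val p h
    e≤m : e ℕ.≤ m
    e≤m = ℕ.≮⇒≥ λ m<e → ∤h (∣-trans (^-∣ p m<e) (val-∣ p h))
    go : p ℕ.^ e ∣ h → h ∣ p ℕ.^ m ℕ.* x
    go (divides h′ eq) = subst (_∣ p ℕ.^ m ℕ.* x) (sym (trans eq (ℕ.*-comm h′ (p ℕ.^ e))))
      (*-pres-∣ (^-∣ p e≤m) (coprime-power-divisor K (∤⇒coprime pp p∤h′) (∣-trans (divides (p ℕ.^ e) (trans eq (ℕ.*-comm h′ _))) h∣)))
      where
      p∤h′ : ¬ p ∣ h′
      p∤h′ p∣h′ = val-∤ 2≤p 1≤h (subst (p ℕ.^ suc e ∣_) (sym eq) (*-monoˡ-∣ (p ℕ.^ e) p∣h′))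

  gcds-∣ : ∀ {k} (t : Vec ℕ k) j → gcds t ∣ lookup t j
  gcds-∣ (x ∷ t) Fin.zero    = gcd[m,n]∣m x (gcds t)
  gcds-∣ (x ∷ t) (Fin.suc j) = ∣-trans (gcd[m,n]∣n x (gcds t)) (gcds-∣ t j)

  ^-pres-∣ : ∀ {m n} K → m ∣ n → m ℕ.^ K ∣ n ℕ.^ K
  ^-pres-∣ zero    h = ∣-refl
  ^-pres-∣ (suc K) h = *-pres-∣ h (^-pres-∣ K h)

  ∣! : ∀ {m n} → 1 ℕ.≤ m → m ℕ.≤ n → m ∣ n ℕ.!
  ∣! {suc m} _ m≤n = ∣-trans (m∣m*n (m ℕ.!)) (m≤n⇒m!∣n! m≤n)

  -- A proper factorisation n + 1 = qd has q, d ≤ n, so each factor divides n!. The square allows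
  -- for q = d.
  composite-! : ∀ n → ¬ Prime (suc n) → suc n ∣ n ℕ.! ℕ.* n ℕ.!
  composite-! zero    _  = ∣-refl
  composite-! n@(suc n′) ¬p = factor (¬prime⇒composite ¬p)
    where
    factor : Composite (suc n) → suc n ∣ n ℕ.! ℕ.* n ℕ.!
    factor (hasNonTrivialDivisor {divisor = d} d<n (divides q eq)) =
      subst (_∣ n ℕ.! ℕ.* n ℕ.!) (sym eq) (*-pres-∣ (∣! 1≤q q≤n) (∣! 1≤d (ℕ.≤-pred d<n)))
      where
      1<d = ℕ.nonTrivial⇒n>1 d
      1≤d = ℕ.<⇒≤ 1<d
      1≤q : 1 ℕ.≤ q
      1≤q = ℕ.n≢0⇒n>0 λ { refl → ℕ.1+n≢0 eq }
      q≤n : q ℕ.≤ n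
      q≤n = ℕ.≤-pred (subst (q ℕ.<_) (sym eq) (ℕ.m<m*n q d {{ℕ.>-nonZero 1≤q}} 1<d))

  composite-!^ : ∀ n K → ¬ Prime (suc n) → (suc n ℕ.!) ℕ.^ K ∣ (n ℕ.!) ℕ.^ (3 ℕ.* K)
  composite-!^ n K ¬p = subst ((suc n ℕ.!) ℕ.^ K ∣_) (ℕ.^-*-assoc (n ℕ.!) 3 K)
    (^-pres-∣ K (subst (suc n ℕ.! ∣_) (cube (n ℕ.!)) (*-pres-∣ (composite-! n ¬p) ∣-refl)))
    where
    cube : ∀ f → f ℕ.* f ℕ.* f ≡ f ℕ.^ 3
    cube f = trans (ℕ.*-assoc f f f) (cong (λ z → f ℕ.* (f ℕ.* z)) (sym (ℕ.*-identityʳ f)))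

  length-filter-Σ : ∀ {A : Set} {P : A → Set} (P? : ∀ x → Dec (P x)) xs → ι (length (filter P? xs)) ≡ Σ xs (λ x → ⟦ P? x ⟧)
  length-filter-Σ P? xs = trans (sym (Σ-1 (filter P? xs)))
    (trans (Σ-filter P? xs (λ _ → 1ℚ)) (Σ-cong xs (λ x → *-identityʳ ⟦ P? x ⟧)))

  module _ {A : Set} (_≟_ : DecidableEquality A) where

    Σ-unique-point : ∀ {xs} y → Unique xs → Σ xs (λ x → ⟦ x ≟ y ⟧) ≤ 1ℚ
    Σ-unique-point {[]}     y _  = 0≤1
    Σ-unique-point {x ∷ xs} y un@(_ ∷ un′) with x ≟ y
    ... | no _     = ≤-trans (≤-reflexive (+-identityˡ _)) (Σ-unique-point y un′)
    ... | yes refl = ≤-trans (+-monoʳ-≤ 1ℚ (≤-trans (Σ-mono xs zeros) (≤-reflexive (Σ-0 xs)))) (≤-reflexive (+-identityʳ 1ℚ))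
      where
      zeros : ∀ z → z ∈ xs → ⟦ z ≟ x ⟧ ≤ 0ℚ
      zeros z z∈ = ≤-reflexive (⟦⟧-no (z ≟ x) λ { refl → Unique[x∷xs]⇒x∉xs un z∈ })

    -- Double counting of the pairs x = y: every x occurs among the `ys`, and every y is hit at most
    -- once.
    unique-⊆-length : ∀ {xs ys : List A} → Unique xs → (∀ {x} → x ∈ xs → x ∈ ys) → ι (length xs) ≤ ι (length ys)
    unique-⊆-length {xs} {ys} un xs⊆ys = subst₂ _≤_ (Σ-1 xs) (Σ-1 ys)
      (≤-trans (Σ-mono xs λ x x∈ → subst (_≤ Σ ys (λ y → ⟦ x ≟ y ⟧)) (⟦⟧-yes (x ≟ x) refl)
          (Σ-term {f = λ y → ⟦ x ≟ y ⟧} (λ y → ⟦⟧-nonNeg (x ≟ y)) (xs⊆ys x∈)))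
        (≤-trans (≤-reflexive (Σ-swap xs ys (λ x y → ⟦ x ≟ y ⟧)))
          (Σ-mono ys (λ y _ → Σ-unique-point y un))))

  ^-distribʳ-*ⁿ : ∀ m n K → (m ℕ.* n) ℕ.^ K ≡ m ℕ.^ K ℕ.* n ℕ.^ K
  ^-distribʳ-*ⁿ m n zero    = refl
  ^-distribʳ-*ⁿ m n (suc K) = trans (cong (m ℕ.* n ℕ.*_) (^-distribʳ-*ⁿ m n K)) (ℕ.[m*n]*[o*p]≡[m*o]*[n*p] m n (m ℕ.^ K) (n ℕ.^ K))

  -- The induction over the primes

  ι-^ : ∀ m n → ι (m ℕ.^ n) ≡ ι m ^ n
  ι-^ m zero    = refl
  ι-^ m (suc n) = trans (ι-* m (m ℕ.^ n)) (cong (ι m *_) (ι-^ m n))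

  0<ι : ∀ {n} → 1 ℕ.≤ n → 0ℚ < ι n
  0<ι {n} 1≤n = <-≤-trans 0<1 (ι-mono 1≤n)

  ≤*inv : ∀ {x y s} → 0ℚ < s → x * s ≤ y → x ≤ y * inv s
  ≤*inv {x} {y} {s} 0<s h = subst (_≤ y * inv s)
    (trans (*-assoc x s (inv s)) (trans (cong (x *_) (inv-inverse 0<s)) (*-identityʳ x)))
    (*-monoʳ-≤ (<⇒≤ (0<inv 0<s)) h)

  empty-or-∈ : ∀ {A : Set} (xs : List A) → xs ≡ [] ⊎ ∃[ x ] x ∈ xs
  empty-or-∈ []       = inj₁ refl
  empty-or-∈ (x ∷ xs) = inj₂ (x , here refl)

  cartesian : ∀ {k} → (Fin k → List ℕ) → List (Vec ℕ k)
  cartesian {zero}  A = [] ∷ []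
  cartesian {suc k} A = List.cartesianProductWith _∷_ (A Fin.zero) (cartesian (A ∘ Fin.suc))

  ∈-cartesian : ∀ {k} (A : Fin k → List ℕ) (t : Vec ℕ k) → (∀ j → lookup t j ∈ A j) → t ∈ cartesian A
  ∈-cartesian A []      h = here refl
  ∈-cartesian A (x ∷ t) h = ∈-cartesianProductWith⁺ _∷_ (h Fin.zero) (∈-cartesian (A ∘ Fin.suc) t (h ∘ Fin.suc))

  length-cartesian : ∀ {k} (A : Fin k → List ℕ) → ι (length (cartesian A)) ≡ Π (λ j → ι (length (A j)))
  length-cartesian {zero}  A = refl
  length-cartesian {suc k} A = begin-equality
    ι (length (cartesian A))                              ≡⟨ Σ-1 (cartesian A) ⟨
    Σ (cartesian A) (λ _ → 1ℚ)                            ≡⟨ Σ-cartesian _∷_ (A Fin.zero) A′ (λ _ → 1ℚ) ⟩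
    Σ (A Fin.zero) (λ _ → Σ A′ (λ _ → 1ℚ))                ≡⟨ Σ-cong (A Fin.zero) (λ _ → trans (Σ-1 A′) (sym (*-identityˡ _))) ⟩
    Σ (A Fin.zero) (λ _ → 1ℚ * ι (length A′))             ≡⟨ Σ-*ʳ (A Fin.zero) (ι (length A′)) (λ _ → 1ℚ) ⟩
    Σ (A Fin.zero) (λ _ → 1ℚ) * ι (length A′)             ≡⟨ cong₂ _*_ (Σ-1 (A Fin.zero)) (length-cartesian (A ∘ Fin.suc)) ⟩
    ι (length (A Fin.zero)) * Π (λ j → ι (length (A (Fin.suc j)))) ∎
    where
    open ≤-Reasoning
    A′ = cartesian (A ∘ Fin.suc)

  multiples-length : ∀ {A : List ℕ} {c M} → Unique A → 1 ℕ.≤ c → (∀ {a} → a ∈ A → c ∣ a × 1 ℕ.≤ a × a ℕ.≤ M) →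
    ι (length A) * ι c ≤ ι M
  multiples-length {A} {c} {M} un 1≤c h = ≤-trans (*-monoʳ-≤ (0≤ι c) (unique-⊆-length ℕ._≟_ un sub))
    (≤-trans (≤-reflexive (trans (sym (ι-* (length ms) c)) (cong (λ z → ι (z ℕ.* c)) len))) (ι-mono (m/n*n≤m M c)))
    where
    instance _ = ℕ.>-nonZero 1≤c
    ms = List.map (λ q → suc q ℕ.* c) (upTo (M ℕ./ c))
    len : length ms ≡ M ℕ./ c
    len = trans (length-map _ (upTo (M ℕ./ c))) (length-upTo (M ℕ./ c))
    sub : ∀ {a} → a ∈ A → a ∈ ms
    sub a∈ with h a∈
    ... | divides zero refl , () , _
    ... | divides (suc q) refl , _ , a≤M = ∈-map⁺ (λ q → suc q ℕ.* c) (∈-upTo⁺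
      (subst (ℕ._≤ M ℕ./ c) (m*n/n≡m (suc q) c) (/-mono-≤ a≤M (ℕ.≤-refl {c}))))

  module Counting (k₁ u v w v′ : ℕ) (u≡v+w : u ≡ v ℕ.+ w) (v≡w+v′ : v ≡ w ℕ.+ v′) (1≤v′ : 1 ℕ.≤ v′) (1≤w : 1 ℕ.≤ w)
    (u<kw : suc u ℕ.≤ suc k₁ ℕ.* w)
    (M : Fin (suc k₁) → ℕ) (d : ℕ) (1≤d : 1 ℕ.≤ d) (S : List ℕ) where

    k = suc k₁

    1≤v : 1 ℕ.≤ v
    1≤v = ℕ.≤-trans 1≤w (subst (w ℕ.≤_) (sym v≡w+v′) (ℕ.m≤m+n w v′))

    1≤u : 1 ℕ.≤ u
    1≤u = ℕ.≤-trans 1≤v (subst (v ℕ.≤_) (sym u≡v+w) (ℕ.m≤m+n v w))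

    -- The state once the primes above n have been treated. Their share of the gcds sits in `g`, and
    -- `gcds∣` says that the rest has only prime factors up to n; the power of n! with a free
    -- exponent K expresses this without factorisations. By `∤c` the c_j are prime to the primes
    -- still to come, so that c_j and p^e can be multiplied as divisors.
    record Config (n : ℕ) : Set where
      field
        A : Fin k → List ℕ
        T : List (Vec ℕ k)
        c : Fin k → ℕ
        g K : ℕ
        A-unique : ∀ j → Unique (A j)
        T-unique : Unique T
        T⊂A : ∀ {t} → t ∈ T → ∀ j → lookup t j ∈ A j
        1≤A : ∀ j {a} → a ∈ A j → 1 ℕ.≤ a
        A≤M : ∀ j {a} → a ∈ A j → a ℕ.≤ M j
        A⊂S : ∀ j {a} → a ∈ A j → a ∈ S
        c∣A : ∀ j {a} → a ∈ A j → c j ∣ a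
        1≤c : ∀ j → 1 ℕ.≤ c j
        1≤g : 1 ℕ.≤ g
        ∤c : ∀ q → Prime q → q ℕ.≤ n → ∀ j → ¬ q ∣ c j
        gcds∣ : ∀ {t} → t ∈ T → gcds t ∣ g ℕ.* (n ℕ.!) ℕ.^ K
        d≤gcds : ∀ {t} → t ∈ T → d ℕ.≤ gcds t

      scale mass : ℚ
      scale = Π (ι ∘ c) ^ v * ι d ^ (k ℕ.* v)
      mass = Π (ι ∘ M) ^ v * ι g ^ (k ℕ.* v)

      0<scale : 0ℚ < scale
      0<scale = 0<* (^-pos v (Π-pos (λ j → 0<ι (1≤c j)))) (^-pos (k ℕ.* v) (0<ι 1≤d))

      0≤mass : 0ℚ ≤ mass
      0≤mass = 0≤* (^-nonNeg v (Π-nonNeg (λ j → 0≤ι (M j)))) (^-nonNeg (k ℕ.* v) (0≤ι g))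

      1≤T : ∀ {t} → t ∈ T → ∀ j → 1 ℕ.≤ lookup t j
      1≤T t∈ j = 1≤A j (T⊂A t∈ j)

      1≤gcds : ∀ {t} → t ∈ T → 1 ℕ.≤ gcds t
      1≤gcds t∈ = ℕ.≤-trans 1≤d (d≤gcds t∈)

      sizes : Fin k → ℚ
      sizes j = ι (length (A j))

      0≤sizes : ∀ j → 0ℚ ≤ sizes j
      0≤sizes j = 0≤ι (length (A j))

    -- The quotient of the overview, with an integer `d` for D, cleared of denominators; `ℓ`
    -- collects the losses of the primes up to n.
    Claim : ℕ → ℚ → Set
    Claim n ℓ = (C : Config n) → let open Config C in ι (length T) ^ u * scale ≤ ℓ * mass * Π sizes ^ w

    claim-mono : ∀ {n ℓ ℓ′} → ℓ ≤ ℓ′ → Claim n ℓ → Claim n ℓ′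
    claim-mono ℓ≤ℓ′ claim C = ≤-trans (claim C)
      (*-monoʳ-≤ (^-nonNeg w (Π-nonNeg 0≤sizes)) (*-monoʳ-≤ 0≤mass ℓ≤ℓ′))
      where open Config C

    claim-empty : ∀ {n ℓ} (C : Config n) → 0ℚ ≤ ℓ → let open Config C in T ≡ [] → ι (length T) ^ u * scale ≤ ℓ * mass * Π sizes ^ w
    claim-empty {ℓ = ℓ} C 0≤ℓ refl = subst (_≤ ℓ * mass * Π sizes ^ w) (sym (trans (cong (_* scale) (0^ 1≤u)) (*-zeroˡ scale)))
      (0≤* (0≤* 0≤ℓ 0≤mass) (^-nonNeg w (Π-nonNeg 0≤sizes)))
      where
      open Config C
      0^ : ∀ {n} → 1 ℕ.≤ n → 0ℚ ^ n ≡ 0ℚ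
      0^ {suc n} _ = *-zeroˡ (0ℚ ^ n)

    -- Of the u = v + w factors |T| ≤ ∏ |A_j|, w stay on the right; the other v absorb the c_j
    -- through |A_j| c_j ≤ M_j. With 0! = 1 every gcd divides g, hence d ≤ g.
    claim-0 : Claim 0 1ℚ
    claim-0 C = [ claim-empty C 0≤1 , (λ (t , t∈) → main t∈) ]′ (empty-or-∈ (Config.T C))
      where
      open Config C
      lem : ∀ a b c g → a * b * (c * g) ≡ a * c * g * b
      lem = solve 4 (λ a b c g → a :* b :* (c :* g) := a :* c :* g :* b) refl
      0≤ΠC : 0ℚ ≤ Π (ι ∘ c)
      0≤ΠC = Π-nonNeg (λ j → 0≤ι (c j))
      d≤g : ∀ {t} → t ∈ T → d ℕ.≤ g
      d≤g {t} t∈ = ℕ.≤-trans (d≤gcds t∈) (∣⇒≤ {{ℕ.>-nonZero 1≤g}}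
        (subst (gcds t ∣_) (trans (cong (g ℕ.*_) (ℕ.^-zeroˡ K)) (ℕ.*-identityʳ g)) (gcds∣ t∈)))
      T≤ : ι (length T) ≤ Π sizes
      T≤ = ≤-trans (unique-⊆-length (≡-dec ℕ._≟_) T-unique (λ {t} t∈ → ∈-cartesian A t (T⊂A t∈))) (≤-reflexive (length-cartesian A))
      main : ∀ {t} → t ∈ T → ι (length T) ^ u * scale ≤ 1ℚ * mass * Π sizes ^ w
      main t∈ =
       ≤-trans (*-mono-≤ (^-nonNeg u (0≤ι (length T))) (0≤* (^-nonNeg v 0≤ΠC) (^-nonNeg (k ℕ.* v) (0≤ι g)))
          (≤-trans (^-mono-≤ u (0≤ι (length T)) T≤) (≤-reflexive (trans (cong (Π sizes ^_) u≡v+w) (^-homo-* (Π sizes) v w))))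
          (*-monoˡ-≤ (^-nonNeg v 0≤ΠC) (^-mono-≤ (k ℕ.* v) (0≤ι d) (ι-mono (d≤g t∈)))))
        (≤-trans (≤-reflexive (trans (lem (Π sizes ^ v) (Π sizes ^ w) (Π (ι ∘ c) ^ v) (ι g ^ (k ℕ.* v)))
            (cong (λ z → z * ι g ^ (k ℕ.* v) * Π sizes ^ w) (trans (sym (^-distrib-* (Π sizes) (Π (ι ∘ c)) v)) (cong (_^ v) (sym (Π-* sizes (ι ∘ c))))))))
          (≤-trans (*-monoʳ-≤ (^-nonNeg w (Π-nonNeg 0≤sizes)) (*-monoʳ-≤ (^-nonNeg (k ℕ.* v) (0≤ι g))
              (^-mono-≤ v (Π-nonNeg (λ j → 0≤* (0≤sizes j) (0≤ι (c j))))
                (Π-mono (λ j → 0≤* (0≤sizes j) (0≤ι (c j))) (λ j →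
                  multiples-length (A-unique j) (1≤c j) (λ a∈ → c∣A j a∈ , 1≤A j a∈ , A≤M j a∈))))))
            (≤-reflexive (cong (_* Π sizes ^ w) (sym (*-identityˡ mass))))))

    -- For steps in which neither the sets nor the tuples change and only the divisibility of the
    -- gcds has to be restated; such steps lose nothing.
    claim-pass : ∀ {n ℓ} → ((C : Config (suc n)) → ∃[ K′ ] (∀ {t} → t ∈ Config.T C → gcds t ∣ Config.g C ℕ.* (n ℕ.!) ℕ.^ K′)) →
      Claim n ℓ → Claim (suc n) ℓ
    claim-pass next claim C = claim record
      { A = A ; T = T ; c = c ; g = g ; K = proj₁ (next C) ; A-unique = A-unique ; T-unique = T-unique ; T⊂A = T⊂A
      ; 1≤A = 1≤A ; A≤M = A≤M ; A⊂S = A⊂S ; c∣A = c∣A ; 1≤c = 1≤c ; 1≤g = 1≤g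
      ; ∤c = λ q pq q≤n → ∤c q pq (ℕ.m≤n⇒m≤1+n q≤n) ; gcds∣ = proj₂ (next C) ; d≤gcds = d≤gcds }
      where open Config C

    claim-composite : ∀ {n ℓ} → ¬ Prime (suc n) → Claim n ℓ → Claim (suc n) ℓ
    claim-composite {n} {ℓ} ¬p = claim-pass {ℓ = ℓ} λ C → let open Config C in
      3 ℕ.* K , λ t∈ → ∣-trans (gcds∣ t∈) (*-monoʳ-∣ g (composite-!^ n K ¬p))

    split-! : ∀ g n K → g ℕ.* (suc n ℕ.!) ℕ.^ K ≡ suc n ℕ.^ K ℕ.* (g ℕ.* (n ℕ.!) ℕ.^ K)
    split-! g n K = trans (cong (g ℕ.*_) (^-distribʳ-*ⁿ (suc n) (n ℕ.!) K))
      (trans (sym (ℕ.*-assoc g (suc n ℕ.^ K) _)) (trans (cong (ℕ._* (n ℕ.!) ℕ.^ K) (ℕ.*-comm g (suc n ℕ.^ K))) (ℕ.*-assoc (suc n ℕ.^ K) g _)))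

    claim-absent : ∀ {n ℓ} → Prime (suc n) → ¬ 𝒫 S (suc n) → Claim n ℓ → Claim (suc n) ℓ
    claim-absent {n} {ℓ} pp absent = claim-pass {ℓ = ℓ} λ C → let open Config C in
      K , λ {t} t∈ → subst (gcds t ∣_) (ℕ.*-identityˡ _) (cap-exponent {K = K} {m = 0} pp (1≤gcds t∈)
        (λ p∣ → absent (pp , lose (A⊂S Fin.zero (T⊂A t∈ Fin.zero))
          (∣-trans (subst (_∣ gcds t) (ℕ.*-identityʳ (suc n)) p∣) (gcds-∣ t Fin.zero))))
        (subst (gcds t ∣_) (split-! g n K) (gcds∣ t∈)))

    module Step {n : ℕ} (pp : Prime (suc n)) {ℓ : ℚ} (0≤ℓ : 0ℚ ≤ ℓ) (claim : Claim n ℓ) (C : Config (suc n)) where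
      open Config C

      p = suc n
      2≤p = prime⇒2≤ pp

      -- In this normalisation the claim reads |T|^u ≤ Λ ∏ |A_j|^w.
      Λ : ℚ
      Λ = ℓ * mass * inv scale

      0≤Λ : 0ℚ ≤ Λ
      0≤Λ = 0≤* (0≤* 0≤ℓ 0≤mass) (<⇒≤ (0<inv 0<scale))

      -- The claim for the smaller primes, applied with c_j p^(e_j) and g p^m. The new factors p^(v
      -- Σ e_j) on the left and p^(kvm) on the right leave p^(v Σ (e_j - m)), the gain from unequal
      -- valuations.
      restrict : {PA : Fin k → ℕ → Set} {PT : Vec ℕ k → Set} (PA? : ∀ j a → Dec (PA j a)) (PT? : ∀ t → Dec (PT t))
        (e : Fin k → ℕ) (m : ℕ) → (∀ j → m ℕ.≤ e j) → (∀ j {a} → PA j a → p ℕ.^ e j ∣ a) →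
        (∀ {t} → t ∈ T → PT t → ∀ j → PA j (lookup t j)) → (∀ {t} → t ∈ T → PT t → ¬ p ℕ.^ suc m ∣ gcds t) →
        ι (length (filter PT? T)) ^ u * (ι p ^ ∑ⁿ (λ j → e j ℕ.∸ m)) ^ v ≤ Λ * Π (λ j → ι (length (filter (PA? j) (A j)))) ^ w
      restrict PA? PT? e m m≤e PA⇒∣ PT⇒PA PT⇒∤ = subst (N * R ≤_) (sym (lem₂ ℓ mass (inv scale) F))
        (≤*inv 0<scale (*-cancelˡ-≤ 0<Z (subst₂ _≤_ left right (claim C′))))
        where
        C′ : Config n
        C′ = record
          { A = λ j → filter (PA? j) (A j) ; T = filter PT? T ; c = λ j → c j ℕ.* p ℕ.^ e j ; g = g ℕ.* p ℕ.^ m ; K = K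
          ; A-unique = λ j → filter⁺ (PA? j) (A-unique j) ; T-unique = filter⁺ PT? T-unique
          ; T⊂A = λ t∈ j → let (t∈T , Pt) = ∈-filter⁻ PT? t∈ in ∈-filter⁺ (PA? j) (T⊂A t∈T j) (PT⇒PA t∈T Pt j)
          ; 1≤A = λ j a∈ → 1≤A j (proj₁ (∈-filter⁻ (PA? j) a∈))
          ; A≤M = λ j a∈ → A≤M j (proj₁ (∈-filter⁻ (PA? j) a∈))
          ; A⊂S = λ j a∈ → A⊂S j (proj₁ (∈-filter⁻ (PA? j) a∈))
          ; c∣A = λ j a∈ → let (a∈A , Pa) = ∈-filter⁻ (PA? j) a∈ in
              coprime-product-∣ (e j) pp (∤c p pp ℕ.≤-refl j) (c∣A j a∈A) (PA⇒∣ j Pa)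
          ; 1≤c = λ j → ℕ.*-mono-≤ (1≤c j) (ℕ.m^n>0 p (e j))
          ; 1≤g = ℕ.*-mono-≤ 1≤g (ℕ.m^n>0 p m)
          ; ∤c = λ q pq q≤n j q∣ → [ ∤c q pq (ℕ.m≤n⇒m≤1+n q≤n) j , ∤p^ pq q≤n (e j) ]′ (euclidsLemma (c j) (p ℕ.^ e j) pq q∣)
          ; gcds∣ = λ {t} t∈ → let (t∈T , Pt) = ∈-filter⁻ PT? t∈ in
              subst (gcds t ∣_) (regroup (p ℕ.^ m) g ((n ℕ.!) ℕ.^ K))
                (cap-exponent {K = K} {m = m} pp (1≤gcds t∈T) (PT⇒∤ t∈T Pt) (subst (gcds t ∣_) (split-! g n K) (gcds∣ t∈T)))
          ; d≤gcds = λ t∈ → d≤gcds (proj₁ (∈-filter⁻ PT? t∈))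
          }
          where
          regroup : ∀ x y z → x ℕ.* (y ℕ.* z) ≡ y ℕ.* x ℕ.* z
          regroup x y z = trans (sym (ℕ.*-assoc x y z)) (cong (ℕ._* z) (ℕ.*-comm x y))
          ∤p^ : ∀ {q} → Prime q → q ℕ.≤ n → ∀ e → ¬ q ∣ p ℕ.^ e
          ∤p^ pq q≤n zero    q∣1 = ℕ.<⇒≱ (prime⇒2≤ pq) (∣⇒≤ q∣1)
          ∤p^ pq q≤n (suc e) q∣  with euclidsLemma p (p ℕ.^ e) pq q∣
          ... | inj₂ q∣′ = ∤p^ pq q≤n e q∣′
          ... | inj₁ q∣p with prime⇒irreducible pp q∣p
          ...   | inj₁ refl = ℕ.<⇒≱ (prime⇒2≤ pq) ℕ.≤-refl
          ...   | inj₂ refl = ℕ.<⇒≱ ℕ.≤-refl q≤n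
        N = ι (length (filter PT? T)) ^ u
        q = ι p ^ m
        r = ι p ^ ∑ⁿ (λ j → e j ℕ.∸ m)
        R = r ^ v
        Z = (q ^ k) ^ v
        F = Π (λ j → ι (length (filter (PA? j) (A j)))) ^ w
        0<Z : 0ℚ < Z
        0<Z = ^-pos v (^-pos k (^-pos m (0<ι (ℕ.s≤s ℕ.z≤n))))
        lem₂ : ∀ a b c f → a * b * c * f ≡ a * b * f * c
        lem₂ = solve 4 (λ a b c f → a :* b :* c :* f := a :* b :* f :* c) refl
        C-part : Π (ι ∘ Config.c C′) ^ v ≡ Π (ι ∘ c) ^ v * (Z * R)
        C-part = trans (cong (_^ v) (trans (Π-cong (λ j → trans (ι-* (c j) (p ℕ.^ e j)) (cong (ι (c j) *_) (power j))))
            (trans (Π-* (ι ∘ c) (λ j → q * ι p ^ (e j ℕ.∸ m))) (cong (Π (ι ∘ c) *_)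
              (trans (Π-* (λ _ → q) (λ j → ι p ^ (e j ℕ.∸ m))) (cong₂ _*_ (Π-const k q) (sym (^-∑ⁿ (ι p) (λ j → e j ℕ.∸ m)))))))))
          (trans (^-distrib-* (Π (ι ∘ c)) (q ^ k * r) v) (cong (Π (ι ∘ c) ^ v *_) (^-distrib-* (q ^ k) r v)))
          where
          power : ∀ j → ι (p ℕ.^ e j) ≡ q * ι p ^ (e j ℕ.∸ m)
          power j = trans (ι-^ p (e j)) (trans (cong (ι p ^_) (sym (ℕ.m+[n∸m]≡n (m≤e j)))) (^-homo-* (ι p) m (e j ℕ.∸ m)))
        g-part : ι (g ℕ.* p ℕ.^ m) ^ (k ℕ.* v) ≡ ι g ^ (k ℕ.* v) * Z
        g-part = trans (cong (_^ (k ℕ.* v)) (trans (ι-* g (p ℕ.^ m)) (cong (ι g *_) (ι-^ p m))))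
          (trans (^-distrib-* (ι g) q (k ℕ.* v)) (cong (ι g ^ (k ℕ.* v) *_) (sym (^-assocʳ q k v))))
        left : N * Config.scale C′ ≡ Z * (N * R * scale)
        left = trans (cong (λ z → N * (z * ι d ^ (k ℕ.* v))) C-part) (lem N (Π (ι ∘ c) ^ v) Z R (ι d ^ (k ℕ.* v)))
          where
          lem : ∀ n c z r d → n * (c * (z * r) * d) ≡ z * (n * r * (c * d))
          lem = solve 5 (λ n c z r d → n :* (c :* (z :* r) :* d) := z :* (n :* r :* (c :* d))) refl
        right : ℓ * Config.mass C′ * F ≡ Z * (ℓ * mass * F)
        right = trans (cong (λ z → ℓ * (Π (ι ∘ M) ^ v * z) * F) g-part) (lem ℓ (Π (ι ∘ M) ^ v) (ι g ^ (k ℕ.* v)) Z F)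
          where
          lem : ∀ l m g z f → l * (m * (g * z)) * f ≡ z * (l * (m * g) * f)
          lem = solve 5 (λ l m g z f → l :* (m :* (g :* z)) :* f := z :* (l :* (m :* g) :* f)) refl

      L : ℕ
      L = suc (∑ⁿ M)

      I : List (Vec ℕ k)
      I = vecs k L

      vals : Vec ℕ k → Vec ℕ k
      vals = Vec.map (val p)

      lookup-vals : ∀ t j → lookup (vals t) j ≡ val p (lookup t j)
      lookup-vals t j = lookup-map j (val p) t

      val<L : ∀ j {a} → a ∈ A j → val p a ℕ.< L
      val<L j {a} a∈ = ℕ.s≤s (ℕ.≤-trans (val-≤ p a) (ℕ.≤-trans (A≤M j a∈) (∑ⁿ-term M j)))

      vals∈I : ∀ {t} → t ∈ T → vals t ∈ I
      vals∈I {t} t∈ = ∈-vecs⁺ (vals t) λ j → subst (ℕ._< L) (sym (lookup-vals t j)) (val<L j (T⊂A t∈ j))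

      _≟ᵛ_ = ≡-dec {n = k} ℕ._≟_

      cnt : Fin k → ℕ → ℚ
      cnt j l = ι (length (filter (λ a → l ℕ.≟ val p a) (A j)))

      N : Vec ℕ k → ℚ
      N i = ι (length (filter (λ t → i ≟ᵛ vals t) T))

      ∤gcds : ∀ {t m} → t ∈ T → minv (vals t) ≡ m → ¬ p ℕ.^ suc m ∣ gcds t
      ∤gcds {t} t∈ refl h = let (j , eq) = minv-attained (vals t) in
        val-∤ 2≤p (1≤T t∈ j) (∣-trans (subst (λ e → p ℕ.^ suc e ∣ gcds t) (trans (sym eq) (lookup-vals t j)) h) (gcds-∣ t j))

      exact : ∀ i → N i ^ u * (ι p ^ dev i) ^ v ≤ Λ * Π (λ j → cnt j (lookup i j)) ^ w
      exact i = restrict (λ j a → lookup i j ℕ.≟ val p a) (λ t → i ≟ᵛ vals t) (lookup i) (minv i) (minv-≤ i)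
        (λ j {a} eq → subst (λ e → p ℕ.^ e ∣ a) (sym eq) (val-∣ p a))
        (λ { {t} t∈ refl j → lookup-vals t j })
        (λ { t∈ refl → ∤gcds t∈ refl })

      -- All e_j equal m, so no power of p remains on either side: passing to multiples of p^m is
      -- free.
      level : ∀ m → ι (length (filter (λ t → minv (vals t) ℕ.≟ m) T)) ^ u ≤ Λ * Π sizes ^ w
      level m = ≤-trans (≤-reflexive (sym (trans (cong (ι (length (filter (λ t → minv (vals t) ℕ.≟ m) T)) ^ u *_)
            (trans (cong (λ s → (ι p ^ s) ^ v) (∑ⁿ-zero {k} {λ _ → m ℕ.∸ m} (λ _ → ℕ.n∸n≡0 m))) (1^n≡1 v))) (*-identityʳ _))))
        (≤-trans (restrict (λ j a → p ℕ.^ m ∣? a) (λ t → minv (vals t) ℕ.≟ m) (λ _ → m) m (λ _ → ℕ.≤-refl)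
            (λ j h → h)
            (λ { {t} t∈ refl j → ∣-trans (^-∣ p (minv-≤ (vals t) j)) (subst (λ e → p ℕ.^ e ∣ lookup t j) (sym (lookup-vals t j)) (val-∣ p (lookup t j))) })
            (λ t∈ eq → ∤gcds t∈ eq))
          (*-monoˡ-≤ 0≤Λ (^-mono-≤ w (Π-nonNeg 0≤filtered) (Π-mono 0≤filtered filtered≤))))
        where
        0≤filtered : ∀ j → 0ℚ ≤ ι (length (filter (λ a → p ℕ.^ m ∣? a) (A j)))
        0≤filtered j = 0≤ι _
        filtered≤ : ∀ j → ι (length (filter (λ a → p ℕ.^ m ∣? a) (A j))) ≤ sizes j
        filtered≤ j = subst₂ _≤_ (sym (length-filter-Σ (λ a → p ℕ.^ m ∣? a) (A j))) (Σ-1 (A j))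
          (Σ-mono (A j) (λ a _ → ⟦⟧-≤1 (p ℕ.^ m ∣? a)))

      T≤ΣN : ι (length T) ≤ Σ I N
      T≤ΣN = subst₂ _≤_ (Σ-1 T)
        (sym (trans (Σ-cong I (λ i → length-filter-Σ (λ t → i ≟ᵛ vals t) T)) (Σ-swap I T (λ i t → ⟦ i ≟ᵛ vals t ⟧))))
        (Σ-mono T λ t t∈ → subst (_≤ Σ I (λ i → ⟦ i ≟ᵛ vals t ⟧)) (⟦⟧-yes (vals t ≟ᵛ vals t) refl)
          (Σ-term {f = λ i → ⟦ i ≟ᵛ vals t ⟧} (λ i → ⟦⟧-nonNeg (i ≟ᵛ vals t)) (vals∈I t∈)))

      Σ-point : ∀ t → Σ I (λ i → ⟦ i ≟ᵛ vals t ⟧) ≤ 1ℚ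
      Σ-point t = ≤-trans (Σ-mono I (λ i _ → pointwise i))
        (≤-trans (≤-reflexive (Σ-vecs-Π k L (λ j l → ⟦ l ℕ.≟ lookup (vals t) j ⟧)))
          (Π-≤1 (λ j → Σ-nonNeg (upTo L) (λ l → ⟦⟧-nonNeg (l ℕ.≟ lookup (vals t) j))) (λ j → Σ-upTo-point L (lookup (vals t) j))))
        where
        pointwise : ∀ i → ⟦ i ≟ᵛ vals t ⟧ ≤ Π (λ j → ⟦ lookup i j ℕ.≟ lookup (vals t) j ⟧)
        pointwise i with i ≟ᵛ vals t
        ... | no _     = Π-nonNeg (λ j → ⟦⟧-nonNeg (lookup i j ℕ.≟ lookup (vals t) j))
        ... | yes refl = ≤-reflexive (sym (trans (Π-cong (λ j → ⟦⟧-yes (lookup (vals t) j ℕ.≟ lookup (vals t) j) refl))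
                (trans (Π-const k 1ℚ) (1^n≡1 k))))

      ΣN-level : ∀ m → Σ I (λ i → ⟦ minv i ℕ.≟ m ⟧ * N i) ≤ ι (length (filter (λ t → minv (vals t) ℕ.≟ m) T))
      ΣN-level m = subst₂ _≤_
        (sym (trans (Σ-cong I (λ i → trans (cong (⟦ minv i ℕ.≟ m ⟧ *_) (length-filter-Σ (λ t → i ≟ᵛ vals t) T))
            (sym (Σ-*ˡ T ⟦ minv i ℕ.≟ m ⟧ _))))
          (Σ-swap I T (λ i t → ⟦ minv i ℕ.≟ m ⟧ * ⟦ i ≟ᵛ vals t ⟧))))
        (sym (length-filter-Σ (λ t → minv (vals t) ℕ.≟ m) T))
        (Σ-mono T λ t _ → ≤-trans (Σ-mono I (λ i _ → move i t))
          (≤-trans (≤-reflexive (Σ-*ˡ I ⟦ minv (vals t) ℕ.≟ m ⟧ _)) (*≤ʳ (⟦⟧-nonNeg (minv (vals t) ℕ.≟ m)) (Σ-point t))))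
        where
        move : ∀ i t → ⟦ minv i ℕ.≟ m ⟧ * ⟦ i ≟ᵛ vals t ⟧ ≤ ⟦ minv (vals t) ℕ.≟ m ⟧ * ⟦ i ≟ᵛ vals t ⟧
        move i t with i ≟ᵛ vals t
        ... | yes refl = ≤-refl
        ... | no _     = ≤-reflexive (trans (*-zeroʳ ⟦ minv i ℕ.≟ m ⟧) (sym (*-zeroʳ ⟦ minv (vals t) ℕ.≟ m ⟧)))

      module Nonempty (1≤size : ∀ j → 1 ℕ.≤ length (A j)) where

        α : Fin k → ℕ → ℚ
        α j l = cnt j l * inv (sizes j)

        0<sizes : ∀ j → 0ℚ < sizes j
        0<sizes j = 0<ι (1≤size j)

        0≤α : ∀ j l → 0ℚ ≤ α j l
        0≤α j l = 0≤* (0≤ι _) (<⇒≤ (0<inv (0<sizes j)))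

        Σα≤1 : ∀ j → Σ (upTo L) (α j) ≤ 1ℚ
        Σα≤1 j = ≤-trans (≤-reflexive (Σ-*ʳ (upTo L) (inv (sizes j)) (cnt j)))
          (≤-trans (*-monoʳ-≤ (<⇒≤ (0<inv (0<sizes j))) Σcnt≤) (≤-reflexive (inv-inverse (0<sizes j))))
          where
          Σcnt≤ : Σ (upTo L) (cnt j) ≤ sizes j
          Σcnt≤ = subst₂ _≤_
            (sym (trans (Σ-cong (upTo L) (λ l → length-filter-Σ (λ a → l ℕ.≟ val p a) (A j)))
              (Σ-swap (upTo L) (A j) (λ l a → ⟦ l ℕ.≟ val p a ⟧))))
            (Σ-1 (A j)) (Σ-mono (A j) (λ a _ → Σ-upTo-point L (val p a)))

        Φ : ℚ
        Φ = Λ * Π sizes ^ w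

        0≤Φ : 0ℚ ≤ Φ
        0≤Φ = 0≤* 0≤Λ (^-nonNeg w (Π-nonNeg 0≤sizes))

        N≼ : ∀ i → N i ^ u ≤ Φ * (Π (λ j → α j (lookup i j)) ^ w * (1/suc n ^ v) ^ dev i)
        N≼ i = subst₂ _≤_ left right (*-monoʳ-≤ 0≤πdev (exact i))
          where
          πdev = (1/suc n ^ v) ^ dev i
          0≤πdev : 0ℚ ≤ πdev
          0≤πdev = ^-nonNeg (dev i) (^-nonNeg v (<⇒≤ (0<1/suc n)))
          cancel : (ι p ^ dev i) ^ v * πdev ≡ 1ℚ
          cancel = trans (cong (_* πdev) (^-comm (ι p) (dev i) v))
            (trans (sym (^-distrib-* (ι p ^ v) (1/suc n ^ v) (dev i)))
              (trans (cong (_^ dev i) (trans (sym (^-distrib-* (ι p) (1/suc n) v)) (trans (cong (_^ v) (1/suc-inverse n)) (1^n≡1 v))))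
                (1^n≡1 (dev i))))
          left : N i ^ u * (ι p ^ dev i) ^ v * πdev ≡ N i ^ u
          left = trans (*-assoc (N i ^ u) ((ι p ^ dev i) ^ v) πdev) (trans (cong (N i ^ u *_) cancel) (*-identityʳ (N i ^ u)))
          unnormalise : ∀ j → cnt j (lookup i j) ≡ α j (lookup i j) * sizes j
          unnormalise j = sym (trans (*-assoc (cnt j (lookup i j)) (inv (sizes j)) (sizes j))
            (trans (cong (cnt j (lookup i j) *_) (trans (*-comm (inv (sizes j)) (sizes j)) (inv-inverse (0<sizes j)))) (*-identityʳ _)))
          right : Λ * Π (λ j → cnt j (lookup i j)) ^ w * πdev ≡ Φ * (Π (λ j → α j (lookup i j)) ^ w * πdev)
          right = trans (cong (λ z → Λ * z * πdev) (trans (cong (_^ w) (trans (Π-cong unnormalise) (Π-* (λ j → α j (lookup i j)) sizes)))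
              (^-distrib-* (Π (λ j → α j (lookup i j))) (Π sizes) w)))
            (lem Λ (Π (λ j → α j (lookup i j)) ^ w) (Π sizes ^ w) πdev)
            where
            lem : ∀ l a s q → l * (a * s) * q ≡ l * s * (a * q)
            lem = solve 4 (λ l a s q → l :* (a :* s) :* q := l :* s :* (a :* q)) refl

        conclude : ∀ {λᵘ} → Σ I N ^ u ≤ Φ * λᵘ → ι (length T) ^ u * scale ≤ ℓ * λᵘ * mass * Π sizes ^ w
        conclude {λᵘ} h = ≤-trans (*-monoʳ-≤ (<⇒≤ 0<scale) (≤-trans (^-mono-≤ u (0≤ι (length T)) T≤ΣN) h))
          (≤-reflexive (trans (lem ℓ mass (inv scale) (Π sizes ^ w) λᵘ scale)
            (trans (cong (ℓ * λᵘ * mass * Π sizes ^ w *_) (inv-inverse 0<scale)) (*-identityʳ _))))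
          where
          lem : ∀ l m i s q c → l * m * i * s * q * c ≡ l * q * m * s * (c * i)
          lem = solve 6 (λ l m i s q c → l :* m :* i :* s :* q :* c := l :* q :* m :* s :* (c :* i)) refl

      -- The proportions α_j divide by |A_j|. An empty `T` satisfies the claim trivially, and any
      -- tuple in `T` makes every A_j nonempty.
      by-emptiness : ∀ {λᵘ} → 0ℚ ≤ λᵘ → ((1≤size : ∀ j → 1 ℕ.≤ length (A j)) → Σ I N ^ u ≤ Nonempty.Φ 1≤size * λᵘ) →
        ι (length T) ^ u * scale ≤ ℓ * λᵘ * mass * Π sizes ^ w
      by-emptiness 0≤λᵘ h = [ claim-empty C (0≤* 0≤ℓ 0≤λᵘ) , (λ (t , t∈) → Nonempty.conclude (1≤size t∈) (h (1≤size t∈))) ]′ (empty-or-∈ T)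
        where
        nonempty : ∀ {xs : List ℕ} {x} → x ∈ xs → 1 ℕ.≤ length xs
        nonempty (here _)  = ℕ.s≤s ℕ.z≤n
        nonempty (there _) = ℕ.s≤s ℕ.z≤n
        1≤size : ∀ {t} → t ∈ T → ∀ j → 1 ℕ.≤ length (A j)
        1≤size t∈ j = nonempty (T⊂A t∈ j)

    claim-small : ∀ {n ℓ} → Prime (suc n) → 0ℚ ≤ ℓ → Claim n ℓ → Claim (suc n) (ℓ * (ι 4 ^ k) ^ u)
    claim-small {n} pp 0≤ℓ claim C = Step.by-emptiness pp 0≤ℓ claim C (^-nonNeg u (^-nonNeg k (0≤ι 4))) λ 1≤size →
      let open Step pp 0≤ℓ claim C
          open Nonempty 1≤size
          open LocalWeights k₁ u v w v′ u≡v+w v≡w+v′ 1≤v′ 1≤w u<kw L (1/suc n) (<⇒≤ (0<1/suc n)) (1/suc≤1 n) α 0≤α Σα≤1 Φ 0≤Φ using (small-bound)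
      in small-bound N (λ i → 0≤ι _) (λ i _ → N≼ i) π^v≤
      where
      1/p≤½ : 1/suc n ≤ ½
      1/p≤½ = *-cancelˡ-≤ (0<ι {suc n} (ℕ.s≤s ℕ.z≤n)) (subst (_≤ ι (suc n) * ½) (sym (1/suc-inverse n))
        (*-monoʳ-≤ 0≤½ (ι-mono (prime⇒2≤ pp))))
      -- 1/p ≤ 1/2 ≤ (3/4)^2 and u = v + w ≤ 2v; this is the origin of the ratio 3/4.
      π^v≤ : 1/suc n ^ v ≤ ¾ ^ u
      π^v≤ = ≤-trans (^-mono-≤ v (<⇒≤ (0<1/suc n)) (≤-trans 1/p≤½ (toWitness {a? = ½ ≤? ¾ ^ 2} _)))
        (≤-trans (≤-reflexive (^-assocʳ ¾ 2 v)) (^-antiʳ-≤ 0≤¾ (toWitness {a? = ¾ ≤? 1ℚ} _)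
          (ℕ.≤-trans (ℕ.≤-reflexive u≡v+w) (ℕ.+-monoʳ-≤ v (ℕ.≤-trans (subst (w ℕ.≤_) (sym v≡w+v′) (ℕ.m≤m+n w v′)) (ℕ.m≤m+n v 0))))))

    open Constants k₁ u 1≤u using (θ½; κ; ψ; loss; 1≤loss; Ψ; 0≤Ψ; Ψ≤2; module LargePrime)

    claim-large : ∀ {n ℓ} → 1/suc n ≤ θ½ → Prime (suc n) → 0ℚ ≤ ℓ → Claim n ℓ → Claim (suc n) (ℓ * loss n ^ u)
    claim-large {n} π≤θ½ pp 0≤ℓ claim C = Step.by-emptiness pp 0≤ℓ claim C (^-nonNeg u (≤-trans 0≤1 (1≤loss n))) λ 1≤size →
      let open Step pp 0≤ℓ claim C
          open Nonempty 1≤size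
          open LargePrime v w v′ u≡v+w v≡w+v′ 1≤v′ 1≤w u<kw L n α 0≤α Σα≤1 Φ 0≤Φ using (large-bound)
      in large-bound π≤θ½ N (λ i → 0≤ι _) (λ i _ → N≼ i) λ m _ →
           ≤-trans (^-mono-≤ u (Σ-nonNeg I (λ i → 0≤* (⟦⟧-nonNeg (minv i ℕ.≟ m)) (0≤ι _))) (ΣN-level m)) (level m)

    Q : ℚ
    Q = (ι 4 ^ k) ^ u

    1≤Q : 1ℚ ≤ Q
    1≤Q = 1≤^ u (1≤^ k (ι-mono {1} {4} (ℕ.s≤s ℕ.z≤n)))

    0≤Q^ : ∀ n → 0ℚ ≤ Q ^ n
    0≤Q^ n = ^-nonNeg n (≤-trans 0≤1 1≤Q)

    #𝒫 : ℕ → ℕ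
    #𝒫 n = #𝒫small n S

    #𝒫-suc : ∀ n → #𝒫 (suc n) ≡ #𝒫 n ℕ.+ length (filter (𝒫? S) (suc n ∷ []))
    #𝒫-suc n = trans (cong (length ∘ filter (𝒫? S)) (sym (upTo-∷ʳ (suc n))))
      (trans (cong length (filter-++ (𝒫? S) (upTo (suc n)) (suc n ∷ []))) (length-++ (filter (𝒫? S) (upTo (suc n)))))

    #𝒫-≤ : ∀ n → #𝒫 n ℕ.≤ #𝒫 (suc n)
    #𝒫-≤ n = subst (#𝒫 n ℕ.≤_) (sym (#𝒫-suc n)) (ℕ.m≤m+n (#𝒫 n) _)

    #𝒫-yes : ∀ n → 𝒫 S (suc n) → #𝒫 (suc n) ≡ suc (#𝒫 n)
    #𝒫-yes n h = trans (#𝒫-suc n) (trans (cong (λ xs → #𝒫 n ℕ.+ length xs) (filter-accept (𝒫? S) h)) (ℕ.+-comm (#𝒫 n) 1))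

    -- `Claim n` ranges over all configurations, so removing primes from the largest downwards
    -- becomes an ordinary induction on n.
    claims-small : ∀ n → Claim n (Q ^ #𝒫 n)
    claims-small zero    = claim-mono (1≤^ (#𝒫 0) 1≤Q) claim-0
    claims-small (suc n) = by-cases (prime? (suc n)) (𝒫? S (suc n))
      where
      ih = claims-small n
      Q^≤ = ^-monoʳ-≤ 1≤Q (#𝒫-≤ n)
      by-cases : Dec (Prime (suc n)) → Dec (𝒫 S (suc n)) → Claim (suc n) (Q ^ #𝒫 (suc n))
      by-cases (no ¬p)  _            = claim-mono Q^≤ (claim-composite {n} {Q ^ #𝒫 n} ¬p ih)
      by-cases (yes pp) (no absent)  = claim-mono Q^≤ (claim-absent {n} {Q ^ #𝒫 n} pp absent ih)
      by-cases (yes pp) (yes occurs) = subst (Claim (suc n)) (trans (*-comm (Q ^ #𝒫 n) Q) (cong (Q ^_) (sym (#𝒫-yes n occurs))))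
        (claim-small pp (0≤Q^ (#𝒫 n)) ih)

    module _ (p₀ : ℕ) (1/n≤θ½ : ∀ n → p₀ ℕ.≤ n → 1/suc n ≤ θ½) where

      -- Beyond p₀ every integer, prime or not, is charged its `loss`; the product of all of them is
      -- bounded, so only the primes up to p₀ are counted.
      claims-large : ∀ j → Claim (p₀ ℕ.+ j) (Q ^ #𝒫 p₀ * Ψ p₀ j ^ u)
      claims-large zero    = subst₂ Claim (sym (ℕ.+-identityʳ p₀))
        (sym (trans (cong (Q ^ #𝒫 p₀ *_) (1^n≡1 u)) (*-identityʳ (Q ^ #𝒫 p₀)))) (claims-small p₀)
      claims-large (suc j) = subst (λ n → Claim n (Q ^ #𝒫 p₀ * Ψ p₀ (suc j) ^ u)) (sym (ℕ.+-suc p₀ j)) (by-cases (prime? (suc n)))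
        where
        n = p₀ ℕ.+ j
        ℓ = Q ^ #𝒫 p₀ * Ψ p₀ j ^ u
        0≤ℓ : 0ℚ ≤ ℓ
        0≤ℓ = 0≤* (0≤Q^ (#𝒫 p₀)) (^-nonNeg u (0≤Ψ p₀ j))
        eq : ℓ * loss n ^ u ≡ Q ^ #𝒫 p₀ * Ψ p₀ (suc j) ^ u
        eq = trans (*-assoc (Q ^ #𝒫 p₀) (Ψ p₀ j ^ u) (loss n ^ u)) (cong (Q ^ #𝒫 p₀ *_) (sym (^-distrib-* (Ψ p₀ j) (loss n) u)))
        by-cases : Dec (Prime (suc n)) → Claim (suc n) (Q ^ #𝒫 p₀ * Ψ p₀ (suc j) ^ u)
        by-cases (yes pp) = subst (Claim (suc n)) eq (claim-large (1/n≤θ½ n (ℕ.m≤m+n p₀ j)) pp 0≤ℓ (claims-large j))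
        by-cases (no ¬p)  = claim-mono (subst (ℓ ≤_) eq (subst (_≤ ℓ * loss n ^ u) (*-identityʳ ℓ)
            (*-monoˡ-≤ 0≤ℓ (1≤^ u (1≤loss n)))))
          (claim-composite {n} {ℓ} ¬p (claims-large j))

      module _ (κψ≤1 : κ * ψ p₀ ≤ 1ℚ)
        (A : Fin k → List ℕ) (T : List (Vec ℕ k)) (A-unique : ∀ j → Unique (A j)) (T-unique : Unique T)
        (T⊂A : ∀ {t} → t ∈ T → ∀ j → lookup t j ∈ A j) (1≤A : ∀ j {a} → a ∈ A j → 1 ℕ.≤ a)
        (A≤M : ∀ j {a} → a ∈ A j → a ℕ.≤ M j) (A⊂S : ∀ j {a} → a ∈ A j → a ∈ S)
        (d≤gcds : ∀ {t} → t ∈ T → d ℕ.≤ gcds t) where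

        count-bound : ι (length T) ^ u * ι d ^ (k ℕ.* v) ≤ Q ^ #𝒫 p₀ * ι 2 ^ u * Π (ι ∘ M) ^ v * Π (λ j → ι (length (A j))) ^ w
        count-bound = subst₂ _≤_ left right (claim-mono (*-monoˡ-≤ (0≤Q^ (#𝒫 p₀)) (^-mono-≤ u (0≤Ψ p₀ m) (Ψ≤2 p₀ κψ≤1 m)))
            (claims-large m) initial)
          where
          m = M Fin.zero
          -- Every gcd is at most m and so divides n!, which starts the descent with c_j = g = 1;
          -- the summand p₀ places n in the range of `claims-large`.
          n = p₀ ℕ.+ m
          initial : Config n
          initial = record
            { A = A ; T = T ; c = λ _ → 1 ; g = 1 ; K = 1 ; A-unique = A-unique ; T-unique = T-unique ; T⊂A = T⊂A
            ; 1≤A = 1≤A ; A≤M = A≤M ; A⊂S = A⊂S ; c∣A = λ _ _ → 1∣ _ ; 1≤c = λ _ → ℕ.≤-refl ; 1≤g = ℕ.≤-refl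
            ; ∤c = λ q pq _ _ q∣1 → ℕ.<⇒≱ (prime⇒2≤ pq) (∣⇒≤ q∣1)
            ; gcds∣ = λ {t} t∈ → subst (gcds t ∣_) (sym (trans (ℕ.*-identityˡ _) (ℕ.*-identityʳ (n ℕ.!))))
                (∣! (ℕ.≤-trans 1≤d (d≤gcds t∈)) (ℕ.≤-trans (gcds≤ t∈) (ℕ.m≤n+m m p₀)))
            ; d≤gcds = d≤gcds
            }
            where
            gcds≤ : ∀ {t} → t ∈ T → gcds t ℕ.≤ m
            gcds≤ {t} t∈ = ℕ.≤-trans (∣⇒≤ {{ℕ.>-nonZero (1≤A Fin.zero (T⊂A t∈ Fin.zero))}} (gcds-∣ t Fin.zero)) (A≤M Fin.zero (T⊂A t∈ Fin.zero))
          left : ι (length T) ^ u * (Π {k} (λ _ → ι 1) ^ v * ι d ^ (k ℕ.* v)) ≡ ι (length T) ^ u * ι d ^ (k ℕ.* v)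
          left = cong (ι (length T) ^ u *_) (trans (cong (_* ι d ^ (k ℕ.* v))
            (trans (cong (_^ v) (trans (Π-const k 1ℚ) (1^n≡1 k))) (1^n≡1 v))) (*-identityˡ _))
          right : Q ^ #𝒫 p₀ * ι 2 ^ u * (Π (ι ∘ M) ^ v * ι 1 ^ (k ℕ.* v)) * Π (λ j → ι (length (A j))) ^ w
                ≡ Q ^ #𝒫 p₀ * ι 2 ^ u * Π (ι ∘ M) ^ v * Π (λ j → ι (length (A j))) ^ w
          right = cong (λ z → Q ^ #𝒫 p₀ * ι 2 ^ u * z * Π (λ j → ι (length (A j))) ^ w)
            (trans (cong (Π (ι ∘ M) ^ v *_) (1^n≡1 (k ℕ.* v))) (*-identityʳ (Π (ι ∘ M) ^ v)))

  -- Real numbers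

  Eventually : (ℕ → Set) → Set
  Eventually P = ∃[ N ] (∀ n → N ℕ.≤ n → P n)

  infixl 4 _⊛_
  _⊛_ : ∀ {P Q : ℕ → Set} → Eventually (λ n → P n → Q n) → Eventually P → Eventually Q
  (M , f) ⊛ (N , p) = M ℕ.⊔ N , λ n h → f n (⊔-left M N h) (p n (⊔-right M N h))

  always : ∀ {P : ℕ → Set} → (∀ n → P n) → Eventually P
  always f = 0 , λ n _ → f n

  -- Stronger than 0ᴿ ≤ᴿ x, which allows small negative terms: here the terms themselves are
  -- eventually nonnegative, as the monotonicity lemmas for rationals require.
  NonNegᴿ : ℝ → Set
  NonNegᴿ x = Eventually (λ n → 0ℚ ≤ seq x n)

  ≤ᴿ-eventually : ∀ {x y} → Eventually (λ n → seq x n ≤ seq y n) → x ≤ᴿ y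
  ≤ᴿ-eventually {x} {y} h e 0<e = always (λ n x≤y → ≤-trans x≤y (p≤p+q (<⇒≤ 0<e))) ⊛ h

  ≤ᴿ-pointwise : ∀ {x y} → (∀ n → seq x n ≤ seq y n) → x ≤ᴿ y
  ≤ᴿ-pointwise {x} {y} h = ≤ᴿ-eventually {x} {y} (always h)

  ≤ᴿ-trans : ∀ {x y z} → x ≤ᴿ y → y ≤ᴿ z → x ≤ᴿ z
  ≤ᴿ-trans {x} {y} {z} x≤y y≤z e 0<e = always
      (λ n h₁ h₂ → ≤-trans h₁ (≤-trans (+-monoˡ-≤ (½ * e) h₂)
        (≤-reflexive (trans (+-assoc (seq z n) (½ * e) (½ * e)) (cong (λ s → seq z n + s) (½+½ e))))))
    ⊛ x≤y (½ * e) (½*-pos 0<e) ⊛ y≤z (½ * e) (½*-pos 0<e)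

  pos⇒NonNegᴿ : ∀ {x} → 0ᴿ <ᴿ x → NonNegᴿ x
  pos⇒NonNegᴿ {x} 0<x = let (c , 0<c , N , h) = eventually-positive {x} 0<x in N , λ n N≤n → ≤-trans (<⇒≤ 0<c) (h n N≤n)

  *ᴿ-NonNeg : ∀ {x y} → NonNegᴿ x → NonNegᴿ y → NonNegᴿ (x *ᴿ y)
  *ᴿ-NonNeg 0≤x 0≤y = always (λ n → 0≤*) ⊛ 0≤x ⊛ 0≤y

  ^ᴿ-NonNeg : ∀ {x} n → NonNegᴿ x → NonNegᴿ (x ^ᴿ n)
  ^ᴿ-NonNeg zero        0≤x = always (λ _ → 0≤1)
  ^ᴿ-NonNeg {x} (suc n) 0≤x = *ᴿ-NonNeg {x} {x ^ᴿ n} 0≤x (^ᴿ-NonNeg {x} n 0≤x)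

  constᴿ-NonNeg : ∀ {q} → 0ℚ ≤ q → NonNegᴿ (constᴿ q)
  constᴿ-NonNeg 0≤q = always (λ _ → 0≤q)

  eventually-≤ : ∀ x → ∃[ B ] 0ℚ < B × Eventually (λ n → seq x n ≤ B)
  eventually-≤ x = let (B , 0<B , h) = eventually-bounded x in B , 0<B , (always (λ n → ≤-trans (p≤∣p∣ (seq x n))) ⊛ h)

  *ᴿ-monoʳ-≤ : ∀ {x y z} → NonNegᴿ z → x ≤ᴿ y → x *ᴿ z ≤ᴿ y *ᴿ z
  *ᴿ-monoʳ-≤ {x} {y} {z} 0≤z x≤y e 0<e =
    let (B , 0<B , z≤B) = eventually-≤ z
        e′ = e * inv B
        0<e′ = 0<* 0<e (0<inv 0<B)
        e′B≡e : e′ * B ≡ e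
        e′B≡e = trans (*-assoc e (inv B) B) (trans (cong (λ s → e * s) (trans (*-comm (inv B) B) (inv-inverse 0<B))) (*-identityʳ e))
    in always (λ n 0≤zₙ zₙ≤B h → ≤-trans (*-monoʳ-≤ 0≤zₙ h)
         (≤-trans (≤-reflexive (*-distribʳ-+ (seq z n) (seq y n) e′))
           (+-monoʳ-≤ (seq y n * seq z n) (subst (e′ * seq z n ≤_) e′B≡e (*-monoˡ-≤ (<⇒≤ 0<e′) zₙ≤B)))))
       ⊛ 0≤z ⊛ z≤B ⊛ x≤y e′ 0<e′

  *ᴿ-mono-≤ : ∀ {x y z w} → NonNegᴿ z → NonNegᴿ y → x ≤ᴿ y → z ≤ᴿ w → x *ᴿ z ≤ᴿ y *ᴿ w
  *ᴿ-mono-≤ {x} {y} {z} {w} 0≤z 0≤y x≤y z≤w = ≤ᴿ-trans {x *ᴿ z} {y *ᴿ z} {y *ᴿ w} (*ᴿ-monoʳ-≤ {x} {y} {z} 0≤z x≤y)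
    (≤ᴿ-trans {y *ᴿ z} {z *ᴿ y} {y *ᴿ w} (≤ᴿ-pointwise {y *ᴿ z} {z *ᴿ y} (λ n → ≤-reflexive (*-comm (seq y n) (seq z n))))
      (≤ᴿ-trans {z *ᴿ y} {w *ᴿ y} {y *ᴿ w} (*ᴿ-monoʳ-≤ {z} {w} {y} 0≤y z≤w)
        (≤ᴿ-pointwise {w *ᴿ y} {y *ᴿ w} (λ n → ≤-reflexive (*-comm (seq w n) (seq y n))))))

  ^ᴿ-mono-≤ : ∀ {x y} n → NonNegᴿ x → NonNegᴿ y → x ≤ᴿ y → x ^ᴿ n ≤ᴿ y ^ᴿ n
  ^ᴿ-mono-≤ zero            0≤x 0≤y x≤y = ≤ᴿ-pointwise {1ᴿ} {1ᴿ} (λ _ → ≤-refl)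
  ^ᴿ-mono-≤ {x} {y} (suc n) 0≤x 0≤y x≤y = *ᴿ-mono-≤ {x} {y} {x ^ᴿ n} {y ^ᴿ n} (^ᴿ-NonNeg {x} n 0≤x) 0≤y x≤y
    (^ᴿ-mono-≤ {x} {y} n 0≤x 0≤y x≤y)

  ∏ᴿ-NonNeg : ∀ {k} {f : Fin k → ℝ} → (∀ j → NonNegᴿ (f j)) → NonNegᴿ (∏ᴿ f)
  ∏ᴿ-NonNeg {zero}      h = always (λ _ → 0≤1)
  ∏ᴿ-NonNeg {suc k} {f} h = *ᴿ-NonNeg {f Fin.zero} {∏ᴿ (f ∘ Fin.suc)} (h Fin.zero) (∏ᴿ-NonNeg {f = f ∘ Fin.suc} (h ∘ Fin.suc))

  ∏ᴿ-mono-≤ : ∀ {k} {f g : Fin k → ℝ} → (∀ j → NonNegᴿ (f j)) → (∀ j → NonNegᴿ (g j)) → (∀ j → f j ≤ᴿ g j) → ∏ᴿ f ≤ᴿ ∏ᴿ g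
  ∏ᴿ-mono-≤ {zero}          0≤f 0≤g f≤g = ≤ᴿ-pointwise {1ᴿ} {1ᴿ} (λ _ → ≤-refl)
  ∏ᴿ-mono-≤ {suc k} {f} {g} 0≤f 0≤g f≤g = *ᴿ-mono-≤ {f Fin.zero} {g Fin.zero} {∏ᴿ (f ∘ Fin.suc)} {∏ᴿ (g ∘ Fin.suc)}
    (∏ᴿ-NonNeg {f = f ∘ Fin.suc} (0≤f ∘ Fin.suc)) (0≤g Fin.zero) (f≤g Fin.zero)
    (∏ᴿ-mono-≤ {f = f ∘ Fin.suc} {g = g ∘ Fin.suc} (0≤f ∘ Fin.suc) (0≤g ∘ Fin.suc) (f≤g ∘ Fin.suc))

  seq-^ᴿ : ∀ x n m → seq (x ^ᴿ n) m ≡ seq x m ^ n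
  seq-^ᴿ x zero    m = refl
  seq-^ᴿ x (suc n) m = cong (seq x m *_) (seq-^ᴿ x n m)

  seq-∏ᴿ : ∀ {k} (f : Fin k → ℝ) m → seq (∏ᴿ f) m ≡ Π (λ j → seq (f j) m)
  seq-∏ᴿ {zero}  f m = refl
  seq-∏ᴿ {suc k} f m = cong (seq (f Fin.zero) m *_) (seq-∏ᴿ (f ∘ Fin.suc) m)

  ^-superadditive : ∀ {x y} n → 1 ℕ.≤ n → 0ℚ ≤ x → 0ℚ ≤ y → x ^ n + y ^ n ≤ (x + y) ^ n
  ^-superadditive {x} {y} (suc zero) _ 0≤x 0≤y = ≤-reflexive (sym (*-distribʳ-+ 1ℚ x y))
  ^-superadditive {x} {y} (suc (suc n)) _ 0≤x 0≤y = ≤-trans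
    (≤-by-gap (x * y ^ suc n + y * x ^ suc n) (0≤+ (0≤* 0≤x (^-nonNeg (suc n) 0≤y)) (0≤* 0≤y (^-nonNeg (suc n) 0≤x)))
      (lem x y (x ^ suc n) (y ^ suc n)))
    (*-monoˡ-≤ (0≤+ 0≤x 0≤y) (^-superadditive (suc n) (ℕ.s≤s ℕ.z≤n) 0≤x 0≤y))
    where
    lem : ∀ x y X Y → (x + y) * (X + Y) ≡ x * X + y * Y + (x * Y + y * X)
    lem = solve 4 (λ x y X Y → (x :+ y) :* (X :+ Y) := x :* X :+ y :* Y :+ (x :* Y :+ y :* X)) refl

  -- The hypothesis is used with tolerance e^n, as y^n + e^n ≤ (y + e)^n.
  ^ᴿ-cancel-≤ : ∀ {x y} n → 1 ℕ.≤ n → NonNegᴿ y → x ^ᴿ n ≤ᴿ y ^ᴿ n → x ≤ᴿ y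
  ^ᴿ-cancel-≤ {x} {y} n 1≤n 0≤y h e 0<e = always
      (λ m 0≤yₘ le → ^-cancel-≤ n 1≤n (0≤+ 0≤yₘ (<⇒≤ 0<e))
        (≤-trans (subst₂ (λ a b → a ≤ b + e ^ n) (seq-^ᴿ x n m) (seq-^ᴿ y n m) le)
          (^-superadditive n 1≤n 0≤yₘ (<⇒≤ 0<e))))
    ⊛ 0≤y ⊛ h (e ^ n) (^-pos n 0<e)

  *ᴿ-cancelˡ-≤ : ∀ {x y c} → 0ℚ < c → constᴿ c *ᴿ x ≤ᴿ constᴿ c *ᴿ y → x ≤ᴿ y
  *ᴿ-cancelˡ-≤ {x} {y} {c} 0<c h e 0<e = always
      (λ n le → *-cancelˡ-≤ 0<c (subst (c * seq x n ≤_) (sym (*-distribˡ-+ c (seq y n) e)) le))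
    ⊛ h (c * e) (0<* 0<c 0<e)

  ι-cancel-≤ : ∀ {m n} → ι m ≤ ι n → m ℕ.≤ n
  ι-cancel-≤ {m} {n} (*≤* h) = ℤ.drop‿+≤+ (subst₂ ℤ._≤_ (ℤ.*-identityʳ (ℤ.+ m)) (ℤ.*-identityʳ (ℤ.+ n)) h)

  *-denominator : ∀ q → q * ι (↧ₙ q) ≡ ι ((↥ q) ⁺) - ι ((↥ q) ⁻)
  *-denominator q@(mkℚ p d _) = toℚᵘ-injective (ℚᵘ.≃-trans (toℚᵘ-homo-* q (ι (suc d)))
    (ℚᵘ.≃-sym (ℚᵘ.≃-trans (toℚᵘ-homo-+ (ι (p ⁺)) (- ι (p ⁻)))
      (ℚᵘ.≃-trans (ℚᵘ.+-congʳ (toℚᵘ (ι (p ⁺))) (toℚᵘ-homo‿- (ι (p ⁻))))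
        (ℚᵘ.*≡* (trans (cong (ℤ._* (ℤ.+ suc d ℤ.* ℤ.+ 1)) (lem (ℤ.+ (p ⁺)) (ℤ.+ (p ⁻))))
          (trans (lem′ (ℤ.+ (p ⁺) ℤ.- ℤ.+ (p ⁻)) (ℤ.+ suc d)) (cong (λ z → z ℤ.* ℤ.+ suc d ℤ.* (ℤ.+ 1 ℤ.* ℤ.+ 1)) (sym (⁺-⁻ p))))))))))
    where
    lem : ∀ a b → a ℤ.* ℤ.+ 1 ℤ.+ ℤ.- b ℤ.* ℤ.+ 1 ≡ a ℤ.- b
    lem = ℤSolver.solve-∀
    lem′ : ∀ a b → a ℤ.* (b ℤ.* ℤ.+ 1) ≡ a ℤ.* b ℤ.* (ℤ.+ 1 ℤ.* ℤ.+ 1)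
    lem′ = ℤSolver.solve-∀

  exponent-≤ : ∀ α u v → α * ι v + ι u ≤ 0ℚ → (↥ α) ⁺ ℕ.* v ℕ.+ u ℕ.* ↧ₙ α ℕ.≤ (↥ α) ⁻ ℕ.* v
  exponent-≤ α u v h = ι-cancel-≤ (0≤q-p⇒p≤q (subst (0ℚ ≤_) eq
      (neg-antimono-≤ (subst ((α * ι v + ι u) * ι q ≤_) (*-zeroˡ (ι q)) (*-monoʳ-≤ (0≤ι q) h)))))
    where
    q = ↧ₙ α
    a = (↥ α) ⁺
    c = (↥ α) ⁻
    ι-+ : ∀ m n → ι (m ℕ.+ n) ≡ ι m + ι n
    ι-+ zero    n = sym (+-identityˡ (ι n))
    ι-+ (suc m) n = trans (ι-suc (m ℕ.+ n)) (trans (cong (1ℚ +_) (ι-+ m n))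
      (trans (sym (+-assoc 1ℚ (ι m) (ι n))) (cong (_+ ι n) (sym (ι-suc m)))))
    lem : ∀ α v u q {a c} → α * q ≡ a - c → - ((α * v + u) * q) ≡ c * v - (a * v + u * q)
    lem α v u q {a} {c} eq = trans (solve 4 (λ α v u q → :- ((α :* v :+ u) :* q) := :- (α :* q :* v) :- u :* q) refl α v u q)
      (trans (cong (λ z → - (z * v) - u * q) eq)
        (solve 5 (λ a c v u q → :- ((a :- c) :* v) :- u :* q := c :* v :- (a :* v :+ u :* q)) refl a c v u q))
    eq : - ((α * ι v + ι u) * ι q) ≡ ι (c ℕ.* v) - ι (a ℕ.* v ℕ.+ u ℕ.* q)
    eq = trans (lem α (ι v) (ι u) (ι q) {ι a} {ι c} (*-denominator α))
      (cong₂ _-_ (sym (ι-* c v)) (sym (trans (ι-+ (a ℕ.* v) (u ℕ.* q)) (cong₂ _+_ (ι-* a v) (ι-* u q)))))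

  -- For z ≥ x^α with α = (a - c)/q and αv + u ≤ 0, z^v x^u is at least x^(αv+u), which is at least
  -- 1 if x ≤ 1. The terms of a real number δ ≤ 1 may slightly exceed 1; the power of `s` makes up
  -- for this.
  power-lower : ∀ {x z s} a c q u v M → 0ℚ < x → x ≤ s → 1ℚ ≤ s → 0ℚ ≤ z → 1 ℕ.≤ q →
    a ℕ.* v ℕ.+ u ℕ.* q ℕ.≤ c ℕ.* v → c ℕ.≤ M ℕ.* q → x ^ a ≤ z ^ q * x ^ c →
    1ℚ ≤ z ^ v * x ^ u * s ^ (M ℕ.* v)
  power-lower {x} {z} {s} a c q u v M 0<x x≤s 1≤s 0≤z 1≤q av+uq≤cv c≤Mq h =
    ^-cancel-≤ q 1≤q (0≤* (0≤* (^-nonNeg v 0≤z) (^-nonNeg u 0≤x)) (^-nonNeg (M ℕ.* v) 0≤s))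
      (subst (_≤ (z ^ v * x ^ u * s ^ (M ℕ.* v)) ^ q) (sym (1^n≡1 q))
        (*-cancelˡ-≤ (^-pos (a ℕ.* v) 0<x) (≤-trans (≤-reflexive (*-identityʳ (x ^ (a ℕ.* v)))) main)))
    where
    0≤x = <⇒≤ 0<x
    0≤s = ≤-trans 0≤1 1≤s
    r = c ℕ.* v ℕ.∸ (a ℕ.* v ℕ.+ u ℕ.* q)
    r≤ : r ℕ.≤ M ℕ.* v ℕ.* q
    r≤ = ℕ.≤-trans (ℕ.m∸n≤m _ (a ℕ.* v ℕ.+ u ℕ.* q)) (ℕ.≤-trans (ℕ.*-monoˡ-≤ v c≤Mq) (ℕ.≤-reflexive
      (trans (ℕ.*-assoc M q v) (trans (cong (M ℕ.*_) (ℕ.*-comm q v)) (sym (ℕ.*-assoc M v q))))))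
    main : x ^ (a ℕ.* v) ≤ x ^ (a ℕ.* v) * (z ^ v * x ^ u * s ^ (M ℕ.* v)) ^ q
    main = begin
      x ^ (a ℕ.* v)                                       ≡⟨ ^-assocʳ x a v ⟨
      (x ^ a) ^ v                                         ≤⟨ ^-mono-≤ v (^-nonNeg a 0≤x) h ⟩
      (z ^ q * x ^ c) ^ v                                 ≡⟨ ^-distrib-* (z ^ q) (x ^ c) v ⟩
      (z ^ q) ^ v * (x ^ c) ^ v                           ≡⟨ cong₂ _*_ (^-comm z q v) (trans (^-assocʳ x c v) (cong (x ^_) (sym (ℕ.m+[n∸m]≡n av+uq≤cv)))) ⟩
      (z ^ v) ^ q * x ^ (a ℕ.* v ℕ.+ u ℕ.* q ℕ.+ r)       ≡⟨ cong ((z ^ v) ^ q *_) (trans (^-homo-* x (a ℕ.* v ℕ.+ u ℕ.* q) r)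
                                                              (cong (_* x ^ r) (trans (^-homo-* x (a ℕ.* v) (u ℕ.* q)) (cong (x ^ (a ℕ.* v) *_) (sym (^-assocʳ x u q)))))) ⟩
      (z ^ v) ^ q * (x ^ (a ℕ.* v) * (x ^ u) ^ q * x ^ r) ≡⟨ lem ((z ^ v) ^ q) (x ^ (a ℕ.* v)) ((x ^ u) ^ q) (x ^ r) ⟩
      x ^ (a ℕ.* v) * ((z ^ v) ^ q * (x ^ u) ^ q * x ^ r) ≤⟨ *-monoˡ-≤ (^-nonNeg (a ℕ.* v) 0≤x) (*-monoˡ-≤ (0≤* (^-nonNeg q (^-nonNeg v 0≤z)) (^-nonNeg q (^-nonNeg u 0≤x)))
                                                               (≤-trans (^-mono-≤ r 0≤x x≤s) (≤-trans (^-monoʳ-≤ 1≤s r≤) (≤-reflexive (sym (^-assocʳ s (M ℕ.* v) q)))))) ⟩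
      x ^ (a ℕ.* v) * ((z ^ v) ^ q * (x ^ u) ^ q * (s ^ (M ℕ.* v)) ^ q)
                                                          ≡⟨ cong (x ^ (a ℕ.* v) *_) (trans (cong (_* (s ^ (M ℕ.* v)) ^ q) (sym (^-distrib-* (z ^ v) (x ^ u) q)))
                                                               (sym (^-distrib-* (z ^ v * x ^ u) (s ^ (M ℕ.* v)) q))) ⟩
      x ^ (a ℕ.* v) * (z ^ v * x ^ u * s ^ (M ℕ.* v)) ^ q ∎
      where
      open ≤-Reasoning
      lem : ∀ a b c d → a * (b * c * d) ≡ b * (a * c * d)
      lem = solve 4 (λ a b c d → a :* (b :* c :* d) := b :* (a :* c :* d)) refl

  -- A representative of 0. Adding it to a real power, whose terms are rounded down, gives terms
  -- above the exact rational powers.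
  1/sucᴿ : ℝ
  1/sucᴿ = mkℝ 1/suc λ e 0<e → let (N , h) = 1/suc-≤ 0<e in N , λ m n N≤m N≤n →
    ∣∣-lub (≤-trans (minus m n) (h m N≤m)) (≤-trans (≤-reflexive (lem (1/suc m) (1/suc n))) (≤-trans (minus n m) (h n N≤n)))
    where
    minus : ∀ m n → 1/suc m - 1/suc n ≤ 1/suc m
    minus m n = subst (1/suc m - 1/suc n ≤_) (+-identityʳ (1/suc m)) (+-monoʳ-≤ (1/suc m) (neg-antimono-≤ (<⇒≤ (0<1/suc n))))
    lem : ∀ a b → - (a - b) ≡ b - a
    lem = solve 2 (λ a b → :- (a :- b) := b :- a) refl

  -- Formally δ^(αv+u) ≥ 1. Besides nonnegativity, this is all that the bound uses about real
  -- powers.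
  1≤δ^α^v*δ^u : ∀ δ (0<δ : 0ᴿ <ᴿ δ) α u v → δ ≤ᴿ 1ᴿ → Eventually (λ n → seq α n * ι v + ι u ≤ 0ℚ) →
    1ᴿ ≤ᴿ (δ ^ᴿ[ 0<δ ] α) ^ᴿ v *ᴿ δ ^ᴿ u
  1≤δ^α^v*δ^u δ 0<δ α u v δ≤1 α≤ = ≤ᴿ-trans {1ᴿ} {Y} {G ^ᴿ v *ᴿ δ ^ᴿ u} 1≤Y
      (*ᴿ-monoʳ-≤ {(G +ᴿ 1/sucᴿ) ^ᴿ v} {G ^ᴿ v} {δ ^ᴿ u} (^ᴿ-NonNeg {δ} u (pos⇒NonNegᴿ {δ} 0<δ))
        (^ᴿ-mono-≤ {G +ᴿ 1/sucᴿ} {G} v 0≤G⁺ 0≤G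
          (λ e 0<e → let (N , h) = 1/suc-≤ 0<e in N , λ n N≤n → +-monoʳ-≤ (seq G n) (h n N≤n))))
    where
    G = δ ^ᴿ[ 0<δ ] α
    Y = (G +ᴿ 1/sucᴿ) ^ᴿ v *ᴿ δ ^ᴿ u
    0≤G : NonNegᴿ G
    0≤G = always (λ n → approxPower-nonNeg n (seq δ n) (seq α n))
    0≤G⁺ : NonNegᴿ (G +ᴿ 1/sucᴿ)
    0≤G⁺ = always (λ n → 0≤+ (approxPower-nonNeg n (seq δ n) (seq α n)) (<⇒≤ (0<1/suc n)))
    1≤Y : 1ᴿ ≤ᴿ Y
    1≤Y e 0<e =
      let (b , B , 0<b , 1≤B , 1≤Bb , δ-bounds) = common-bound δ 0<δ
          (A , _ , α-bound) = eventually-bounded α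
          (M , A≤M) = archimedean A
          (R , 0<R , Y≤R) = eventually-≤ Y
          -- The correction for terms of δ up to 1 + τ is (1 + τ)^(Mv) ≤ 1 + t; as Y ≤ R eventually,
          -- it costs at most Rt ≤ e.
          (t , 0<t , t≤1 , 8Rt≤e) = choose-t e R 0<e (<⇒≤ 0<R)
          (τ , 0<τ , s^≤) = choose-v t (M ℕ.* v) 0<t t≤1
          0≤B = ≤-trans 0≤1 1≤B
          (N , B^M≤N) = archimedean (B ^ M)
          Rt≤e : R * t ≤ e
          Rt≤e = ≤-trans (subst (_≤ ι 8 * R * t) (cong (_* t) (*-identityˡ R))
                   (*-monoʳ-≤ (<⇒≤ 0<t) (*-monoʳ-≤ (<⇒≤ 0<R) (ι-mono {1} {8} (ℕ.s≤s ℕ.z≤n))))) 8Rt≤e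
      in always (λ n δb αb Yₙ≤R δₙ≤ αₙ≤ N≤n →
           let x = seq δ n
               a = seq α n
               0<x = <-≤-trans 0<b (proj₁ δb)
               z = approxPower n x a + 1/suc n
               0≤z = 0≤+ (approxPower-nonNeg n x a) (<⇒≤ (0<1/suc n))
               0≤Yₙ = 0≤* (^-nonNeg v 0≤z) (^-nonNeg u (<⇒≤ 0<x))
               Yₙ≡ : seq Y n ≡ z ^ v * x ^ u
               Yₙ≡ = cong₂ _*_ (seq-^ᴿ (G +ᴿ 1/sucᴿ) v n) (seq-^ᴿ δ u n)
               ∣a∣≤M = ≤-trans αb A≤M
               lower = power-lower ((↥ a) ⁺) ((↥ a) ⁻) (↧ₙ a) u v M 0<x δₙ≤ (p≤p+q (<⇒≤ 0<τ)) 0≤z (ℕ.s≤s ℕ.z≤n)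
                 (exponent-≤ a u v αₙ≤) (ℕ.≤-trans (ℕ.m≤n+m _ ((↥ a) ⁺)) (exponent-size a M ∣a∣≤M))
                 (<⇒≤ (approxPower-upper n x a M 1≤B 0<x (proj₂ δb) (≤-trans 1≤Bb (*-monoˡ-≤ 0≤B (proj₁ δb))) ∣a∣≤M (≤-trans B^M≤N (ι-mono N≤n))))
               step : 1ℚ ≤ seq Y n * (1ℚ + t)
               step = subst (λ y → 1ℚ ≤ y * (1ℚ + t)) (sym Yₙ≡) (≤-trans lower (*-monoˡ-≤ 0≤Yₙ s^≤))
           in ≤-trans step (≤-trans (≤-reflexive (distrib (seq Y n) t))
                (+-monoʳ-≤ (seq Y n) (≤-trans (*-monoʳ-≤ (<⇒≤ 0<t) Yₙ≤R) Rt≤e))))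
         ⊛ δ-bounds ⊛ α-bound ⊛ Y≤R ⊛ δ≤1 τ 0<τ ⊛ α≤ ⊛ (N , λ _ h → h)
      where
      distrib : ∀ y t → y * (1ℚ + t) ≡ y + y * t
      distrib = solve 2 (λ y t → y :* (con 1ℚ :+ t) := y :+ y :* t) refl

  ι-∏ : ∀ {k} (f : Fin k → ℕ) → ι (∏ f) ≡ Π (ι ∘ f)
  ι-∏ {zero}  f = refl
  ι-∏ {suc k} f = trans (ι-* (f Fin.zero) (∏ (f ∘ Fin.suc))) (cong (ι (f Fin.zero) *_) (ι-∏ (f ∘ Fin.suc)))

  ∏≡0-or-positive : ∀ {k} (f : Fin k → ℕ) → ∏ f ≡ 0 ⊎ (∀ j → 1 ℕ.≤ f j)
  ∏≡0-or-positive {zero}  f = inj₂ λ ()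
  ∏≡0-or-positive {suc k} f with f Fin.zero in eq | ∏≡0-or-positive (f ∘ Fin.suc)
  ... | zero  | _      = inj₁ refl
  ... | suc m | inj₁ h = inj₁ (trans (cong (suc m ℕ.*_) h) (ℕ.*-zeroʳ m))
  ... | suc m | inj₂ h = inj₂ λ { Fin.zero → subst (1 ℕ.≤_) (sym eq) (ℕ.s≤s ℕ.z≤n) ; (Fin.suc j) → h j }

  module _ {A : Set} (f : A → ℕ) where

    minimiser : ∀ x (xs : List A) → ∃[ m ] m ∈ x ∷ xs × (∀ {y} → y ∈ x ∷ xs → f m ℕ.≤ f y)
    minimiser x []        = x , here refl , λ { (here refl) → ℕ.≤-refl }
    minimiser x (x′ ∷ xs) with minimiser x′ xs
    ... | m , m∈ , least with ℕ.≤-total (f x) (f m)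
    ...   | inj₁ h = x , here refl , λ { (here refl) → ℕ.≤-refl ; (there y∈) → ℕ.≤-trans h (least y∈) }
    ...   | inj₂ h = m , there m∈ , λ { (here refl) → h ; (there y∈) → least y∈ }

    maximiser : ∀ x (xs : List A) → ∃[ m ] m ∈ x ∷ xs × (∀ {y} → y ∈ x ∷ xs → f y ℕ.≤ f m)
    maximiser x []        = x , here refl , λ { (here refl) → ℕ.≤-refl }
    maximiser x (x′ ∷ xs) with maximiser x′ xs
    ... | m , m∈ , greatest with ℕ.≤-total (f m) (f x)
    ...   | inj₁ h = x , here refl , λ { (here refl) → ℕ.≤-refl ; (there y∈) → ℕ.≤-trans (greatest y∈) h }
    ...   | inj₂ h = m , there m∈ , λ { (here refl) → h ; (there y∈) → greatest y∈ }

  maximum : ∀ {xs : List ℕ} → 1 ℕ.≤ length xs → ∃[ m ] m ∈ xs × (∀ {y} → y ∈ xs → y ℕ.≤ m)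
  maximum {x ∷ xs} _ = maximiser id x xs

  constᴿ-cancel-≤ : ∀ {p q} → constᴿ p ≤ᴿ constᴿ q → p ≤ q
  constᴿ-cancel-≤ {p} {q} h = ≮⇒≥ λ q<p →
    let e = ½ * (p - q)
        0<p-q = subst (_< p - q) (+-inverseʳ q) (+-monoˡ-< (- q) q<p)
        (N , hN) = h e (½*-pos 0<p-q)
        half : ½ * (p - q) + ½ * (p - q) ≤ ½ * (p - q)
        half = subst₂ _≤_ (sym (½+½ (p - q))) (lem q e) (+-monoˡ-≤ (- q) (hN N ℕ.≤-refl))
    in <-irrefl refl (<-≤-trans (subst (_< e + e) (+-identityʳ e) (+-monoʳ-< e (½*-pos 0<p-q))) half)
    where
    lem : ∀ q e → q + e - q ≡ e
    lem = solve 2 (λ q e → q :+ e :- q := e) refl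

  module _ {k : ℕ} (C : Configuration k) where

    open Configuration C

    X-NonNeg : ∀ j → NonNegᴿ (X j)
    X-NonNeg j = pos⇒NonNegᴿ {X j} (1ᴿ≤⇒0ᴿ< {X j} (1≤X j))

    D^k-NonNeg : NonNegᴿ (D ^ᴿ k)
    D^k-NonNeg = pos⇒NonNegᴿ {D ^ᴿ k} D^k>0

    1/D^k-NonNeg : NonNegᴿ (invᴿ (D ^ᴿ k) D^k>0)
    1/D^k-NonNeg = let (d , 0<d , M , h) = eventually-positive {D ^ᴿ k} D^k>0 in M , λ n M≤n → <⇒≤ (0<inv (<-≤-trans 0<d (h n M≤n)))

    ∏X/D^k-NonNeg : NonNegᴿ (∏ᴿ X /ᴿ D ^ᴿ k [ D^k>0 ])
    ∏X/D^k-NonNeg = *ᴿ-NonNeg {∏ᴿ X} {invᴿ (D ^ᴿ k) D^k>0} (∏ᴿ-NonNeg {f = X} X-NonNeg) 1/D^k-NonNeg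

  ^ᴿ[]-NonNeg : ∀ x (0<x : 0ᴿ <ᴿ x) α → NonNegᴿ (x ^ᴿ[ 0<x ] α)
  ^ᴿ[]-NonNeg x 0<x α = always (λ n → approxPower-nonNeg n (seq x n) (seq α n))

  -- From the counting bound to real X, D and δ

  module Bound (k₁ w v′ : ℕ) (1≤v′ : 1 ℕ.≤ v′) (1≤w : 1 ℕ.≤ w) (u<kw : suc (w ℕ.+ v′ ℕ.+ w) ℕ.≤ suc k₁ ℕ.* w) where

    k v u : ℕ
    k = suc k₁
    v = w ℕ.+ v′
    u = v ℕ.+ w

    1≤v : 1 ℕ.≤ v
    1≤v = ℕ.≤-trans 1≤w (ℕ.m≤m+n w v′)

    1≤u : 1 ℕ.≤ u
    1≤u = ℕ.≤-trans 1≤v (ℕ.m≤m+n v w)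

    u≤2v : u ℕ.≤ 2 ℕ.* v
    u≤2v = ℕ.+-monoʳ-≤ v (ℕ.≤-trans (ℕ.m≤m+n w v′) (ℕ.m≤m+n v 0))

    open Constants k₁ u 1≤u using (θ½; κ; ψ)

    Cₖ : ℕ → ℕ
    Cₖ s = (2 ℕ.^ (4 ℕ.* k)) ℕ.^ (1 ℕ.+ s)

    -- Origin of 2^(4k): as u ≤ 2v, a small prime costs (4^k)^u ≤ 2^(4kv). The remaining 2^u from
    -- the large primes and 2^(kv) from the intervals [X_j, 2X_j] amount to at most 2^((2+k)v) ≤
    -- 2^(4kv), the 1 in the exponent 1 + s.
    ≤Cₖ^v : ∀ s → ((ι 4 ^ k) ^ u) ^ s * ι 2 ^ u * (ι 2 ^ k) ^ v ≤ ι (Cₖ s) ^ v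
    ≤Cₖ^v s = begin
      ((ι 4 ^ k) ^ u) ^ s * ι 2 ^ u * (ι 2 ^ k) ^ v ≡⟨ *-assoc (((ι 4 ^ k) ^ u) ^ s) (ι 2 ^ u) ((ι 2 ^ k) ^ v) ⟩
      ((ι 4 ^ k) ^ u) ^ s * (ι 2 ^ u * (ι 2 ^ k) ^ v) ≤⟨ *-mono-≤ (^-nonNeg s (^-nonNeg u (^-nonNeg k (0≤ι 4)))) (^-nonNeg v (0≤c)) small base ⟩
      (c ^ v) ^ s * c ^ v ≡⟨ *-comm ((c ^ v) ^ s) (c ^ v) ⟩
      (c ^ v) ^ suc s ≡⟨ ^-comm c v (suc s) ⟩
      (c ^ suc s) ^ v ≡⟨ cong (_^ v) (trans (cong (_^ suc s) (sym (ι-^ 2 (4 ℕ.* k)))) (sym (ι-^ (2 ℕ.^ (4 ℕ.* k)) (suc s)))) ⟩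
      ι (Cₖ s) ^ v ∎
      where
      open ≤-Reasoning
      c = ι 2 ^ (4 ℕ.* k)
      1≤2 : 1ℚ ≤ ι 2
      1≤2 = ι-mono {1} {2} (ℕ.s≤s ℕ.z≤n)
      0≤c : 0ℚ ≤ c
      0≤c = ^-nonNeg (4 ℕ.* k) (0≤ι 2)
      4^k≡ : ι 4 ^ k ≡ ι 2 ^ (2 ℕ.* k)
      4^k≡ = ^-assocʳ (ι 2) 2 k
      exponents : ∀ a b c → a ℕ.* b ℕ.* (2 ℕ.* c) ≡ 2 ℕ.* a ℕ.* b ℕ.* c
      exponents a b c = trans (sym (ℕ.*-assoc (a ℕ.* b) 2 c)) (cong (ℕ._* c) (trans (ℕ.*-comm (a ℕ.* b) 2) (sym (ℕ.*-assoc 2 a b))))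
      small : ((ι 4 ^ k) ^ u) ^ s ≤ (c ^ v) ^ s
      small = ^-mono-≤ s (^-nonNeg u (^-nonNeg k (0≤ι 4))) (≤-trans
        (≤-reflexive (trans (cong (_^ u) 4^k≡) (^-assocʳ (ι 2) (2 ℕ.* k) u)))
        (≤-trans (^-monoʳ-≤ 1≤2 (ℕ.≤-trans (ℕ.*-monoʳ-≤ (2 ℕ.* k) u≤2v) (ℕ.≤-reflexive (exponents 2 k v))))
          (≤-reflexive (sym (^-assocʳ (ι 2) (4 ℕ.* k) v)))))
      base : ι 2 ^ u * (ι 2 ^ k) ^ v ≤ c ^ v
      base = ≤-trans (≤-reflexive (trans (cong (ι 2 ^ u *_) (^-assocʳ (ι 2) k v)) (sym (^-homo-* (ι 2) u (k ℕ.* v)))))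
        (≤-trans (^-monoʳ-≤ 1≤2 (ℕ.≤-trans (ℕ.+-monoˡ-≤ (k ℕ.* v) u≤2v) (ℕ.≤-trans (ℕ.≤-reflexive (sym (ℕ.*-distribʳ-+ v 2 k)))
            (ℕ.*-monoˡ-≤ v 2+k≤4k))))
          (≤-reflexive (sym (^-assocʳ (ι 2) (4 ℕ.* k) v))))
        where
        2+k≤4k : 2 ℕ.+ k ℕ.≤ 4 ℕ.* k
        2+k≤4k = ℕ.≤-trans (ℕ.≤-reflexive (ℕ.+-comm 2 k)) (ℕ.+-monoʳ-≤ k
          (ℕ.+-mono-≤ {1} (ℕ.s≤s ℕ.z≤n) (ℕ.≤-trans {j = k} (ℕ.s≤s ℕ.z≤n) (ℕ.m≤m+n k (k ℕ.+ 0)))))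

    bound : (p₀ : ℕ) → (∀ n → p₀ ℕ.≤ n → 1/suc n ≤ θ½) → κ * ψ p₀ ≤ 1ℚ →
      (C : Configuration k) (let open Configuration C) (α : ℝ) → Eventually (λ n → seq α n * ι v + ι u ≤ 0ℚ) →
      fromℕ (∏ (λ j → card (A j))) ≤ᴿ
        fromℕ (Cₖ (#𝒫small p₀ (⋃ A))) *ᴿ δ ^ᴿ[ 0<δ ] α *ᴿ (∏ᴿ X /ᴿ D ^ᴿ k [ D^k>0 ])
    bound p₀ 1/n≤θ½ κψ≤1 C α α≤ = [ degenerate , main ]′ (∏≡0-or-positive (λ j → card (A j)))
      where
      open Configuration C
      c = ι (Cₖ (#𝒫small p₀ (⋃ A)))
      G = δ ^ᴿ[ 0<δ ] α
      X∏ = ∏ᴿ X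
      Dᵏ = D ^ᴿ k
      D⁻ᵏ = invᴿ Dᵏ D^k>0
      T = proj₁ large
      N = length T
      P = Π (λ j → ι (card (A j)))

      0≤X : ∀ j → NonNegᴿ (X j)
      0≤X = X-NonNeg C
      0≤X∏ : NonNegᴿ X∏
      0≤X∏ = ∏ᴿ-NonNeg {f = X} 0≤X
      0≤D : NonNegᴿ D
      0≤D = pos⇒NonNegᴿ {D} (1ᴿ≤⇒0ᴿ< {D} 1≤D)
      0≤Dᵏ : NonNegᴿ Dᵏ
      0≤Dᵏ = D^k-NonNeg C
      0≤D⁻ᵏ : NonNegᴿ D⁻ᵏ
      0≤D⁻ᵏ = 1/D^k-NonNeg C
      0≤δ : NonNegᴿ δ
      0≤δ = pos⇒NonNegᴿ {δ} 0<δ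
      0≤G : NonNegᴿ G
      0≤G = ^ᴿ[]-NonNeg δ 0<δ α
      0≤c : 0ℚ ≤ c
      0≤c = 0≤ι (Cₖ (#𝒫small p₀ (⋃ A)))

      degenerate : ∏ (λ j → card (A j)) ≡ 0 → fromℕ (∏ (λ j → card (A j))) ≤ᴿ constᴿ c *ᴿ G *ᴿ (X∏ *ᴿ D⁻ᵏ)
      degenerate eq = ≤ᴿ-eventually {fromℕ (∏ (λ j → card (A j)))} {constᴿ c *ᴿ G *ᴿ (X∏ *ᴿ D⁻ᵏ)}
        (always (λ n 0≤R → subst (λ m → ι m ≤ seq (constᴿ c *ᴿ G *ᴿ (X∏ *ᴿ D⁻ᵏ)) n) (sym eq) 0≤R)
         ⊛ *ᴿ-NonNeg {constᴿ c *ᴿ G} {X∏ *ᴿ D⁻ᵏ} (*ᴿ-NonNeg {constᴿ c} {G} (constᴿ-NonNeg 0≤c) 0≤G) (∏X/D^k-NonNeg C))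

      module _ (1≤card : ∀ j → 1 ℕ.≤ card (A j)) where

        -- The largest element of A_j is an integer stand-in for 2X_j, since a Cauchy real has no
        -- computable integer part. For the same reason the smallest gcd stands in for D.
        M : Fin k → ℕ
        M j = proj₁ (maximum {elements (A j)} (1≤card j))

        M∈ : ∀ j → M j ∈ elements (A j)
        M∈ j = proj₁ (proj₂ (maximum {elements (A j)} (1≤card j)))

        ≤M : ∀ j {a} → a ∈ elements (A j) → a ℕ.≤ M j
        ≤M j = proj₂ (proj₂ (maximum {elements (A j)} (1≤card j)))

        in-T : ∀ {t} → t ∈ T → (∀ j → lookup t j ∈ elements (A j)) × D ≤ᴿ fromℕ (gcds t)
        in-T = All.lookup (proj₁ (proj₂ (proj₂ large)))

        1≤-from-ℝ : ∀ {n} → 1ᴿ ≤ᴿ fromℕ n → 1 ℕ.≤ n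
        1≤-from-ℝ h = ι-cancel-≤ (constᴿ-cancel-≤ h)

        gcd-bound : ∃[ d ] D ≤ᴿ fromℕ d × (∀ {t} → t ∈ T → d ℕ.≤ gcds t)
        gcd-bound = by-emptiness T (λ t∈ → proj₂ (in-T t∈))
          where
          by-emptiness : ∀ T → (∀ {t} → t ∈ T → D ≤ᴿ fromℕ (gcds t)) → ∃[ d ] D ≤ᴿ fromℕ d × (∀ {t} → t ∈ T → d ℕ.≤ gcds t)
          -- Without tuples any integer above D serves.
          by-emptiness []       h = let (B , _ , D≤B) = eventually-≤ D ; (d , B≤d) = archimedean B in
            d , ≤ᴿ-eventually {D} {fromℕ d} (always (λ n Dₙ≤B → ≤-trans Dₙ≤B B≤d) ⊛ D≤B) , λ ()
          by-emptiness (t ∷ ts) h = let (m , m∈ , least) = minimiser gcds t ts in gcds m , h m∈ , least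

        d = proj₁ gcd-bound
        D≤d = proj₁ (proj₂ gcd-bound)

        open Counting k₁ u v w v′ refl refl 1≤v′ 1≤w u<kw M d (1≤-from-ℝ (≤ᴿ-trans {1ᴿ} {D} {fromℕ d} 1≤D D≤d)) (⋃ A) using (Q; count-bound)

        q : ℚ
        q = Q ^ #𝒫small p₀ (⋃ A) * ι 2 ^ u

        0≤q : 0ℚ ≤ q
        0≤q = 0≤* (^-nonNeg (#𝒫small p₀ (⋃ A)) (^-nonNeg u (^-nonNeg k (0≤ι 4)))) (^-nonNeg u (0≤ι 2))

        counted : ι N ^ u * ι d ^ (k ℕ.* v) ≤ q * Π (ι ∘ M) ^ v * P ^ w
        counted = count-bound p₀ 1/n≤θ½ κψ≤1 (elements ∘ A) T (λ j → unique (A j)) (proj₁ (proj₂ large))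
          (λ t∈ → proj₁ (in-T t∈))
          (λ j {a} a∈ → 1≤-from-ℝ (≤ᴿ-trans {1ᴿ} {X j} {fromℕ a} (1≤X j) (proj₁ (A⊂ j a∈))))
          ≤M (λ j a∈ → ∈-concat⁺′ a∈ (∈-tabulate⁺ {f = elements ∘ A} j)) (proj₂ (proj₂ gcd-bound))

        0<P : 0ℚ < P
        0<P = Π-pos (λ j → 0<ι (1≤card j))

        -- The goal multiplied by D^k is a ≤ b. It is proved as P^w a^v ≤ P^w b^v, because P^w a^v =
        -- P^u D^(kv) is what the counting bound controls.
        a b : ℝ
        a = constᴿ P *ᴿ Dᵏ
        b = constᴿ c *ᴿ (G *ᴿ X∏)

        0≤a : NonNegᴿ a
        0≤a = *ᴿ-NonNeg {constᴿ P} {Dᵏ} (constᴿ-NonNeg (<⇒≤ 0<P)) 0≤Dᵏ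
        0≤b : NonNegᴿ b
        0≤b = *ᴿ-NonNeg {constᴿ c} {G *ᴿ X∏} (constᴿ-NonNeg 0≤c) (*ᴿ-NonNeg {G} {X∏} 0≤G 0≤X∏)

        Pʷ = constᴿ (P ^ w)
        0≤Pʷ : NonNegᴿ Pʷ
        0≤Pʷ = constᴿ-NonNeg (^-nonNeg w (<⇒≤ 0<P))
        Gᵛδᵘ = G ^ᴿ v *ᴿ δ ^ᴿ u
        0≤Gᵛ : NonNegᴿ (G ^ᴿ v)
        0≤Gᵛ = ^ᴿ-NonNeg {G} v 0≤G
        0≤Pʷaᵛ : NonNegᴿ (Pʷ *ᴿ a ^ᴿ v)
        0≤Pʷaᵛ = *ᴿ-NonNeg {Pʷ} {a ^ᴿ v} 0≤Pʷ (^ᴿ-NonNeg {a} v 0≤a)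

        edges : ℝ
        edges = (δ *ᴿ constᴿ P) ^ᴿ u *ᴿ Dᵏ ^ᴿ v
        count : ℝ
        count = fromℕ N ^ᴿ u *ᴿ (fromℕ d ^ᴿ k) ^ᴿ v
        2X : Fin k → ℝ
        2X j = fromℕ 2 *ᴿ X j
        0≤2X : ∀ j → NonNegᴿ (2X j)
        0≤2X j = *ᴿ-NonNeg {fromℕ 2} {X j} (constᴿ-NonNeg (0≤ι 2)) (0≤X j)
        M∏ : ℝ
        M∏ = ∏ᴿ (λ j → fromℕ (M j))
        qPʷ = constᴿ (q * P ^ w)
        0≤qPʷ : NonNegᴿ qPʷ
        0≤qPʷ = constᴿ-NonNeg (0≤* 0≤q (^-nonNeg w (<⇒≤ 0<P)))

        δP≤N : δ *ᴿ constᴿ P ≤ᴿ fromℕ N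
        δP≤N = subst (λ p → δ *ᴿ constᴿ p ≤ᴿ fromℕ N) (ι-∏ (λ j → card (A j))) (proj₂ (proj₂ (proj₂ large)))

        -- Inserting 1 ≤ G^v δ^u supplies the δ^u that turns P^u into (δP)^u, which is at most
        -- |T|^u.
        step₁ : Pʷ *ᴿ a ^ᴿ v ≤ᴿ Pʷ *ᴿ a ^ᴿ v *ᴿ Gᵛδᵘ
        step₁ = ≤ᴿ-trans {Pʷ *ᴿ a ^ᴿ v} {1ᴿ *ᴿ (Pʷ *ᴿ a ^ᴿ v)} {Pʷ *ᴿ a ^ᴿ v *ᴿ Gᵛδᵘ}
          (≤ᴿ-pointwise {Pʷ *ᴿ a ^ᴿ v} {1ᴿ *ᴿ (Pʷ *ᴿ a ^ᴿ v)} (λ n → ≤-reflexive (sym (*-identityˡ _))))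
          (≤ᴿ-trans {1ᴿ *ᴿ (Pʷ *ᴿ a ^ᴿ v)} {Gᵛδᵘ *ᴿ (Pʷ *ᴿ a ^ᴿ v)} {Pʷ *ᴿ a ^ᴿ v *ᴿ Gᵛδᵘ}
            (*ᴿ-monoʳ-≤ {1ᴿ} {Gᵛδᵘ} {Pʷ *ᴿ a ^ᴿ v} 0≤Pʷaᵛ (1≤δ^α^v*δ^u δ 0<δ α u v δ≤1 α≤))
            (≤ᴿ-pointwise {Gᵛδᵘ *ᴿ (Pʷ *ᴿ a ^ᴿ v)} {Pʷ *ᴿ a ^ᴿ v *ᴿ Gᵛδᵘ} (λ n → ≤-reflexive (*-comm (seq Gᵛδᵘ n) (seq (Pʷ *ᴿ a ^ᴿ v) n)))))

        step₂ : Pʷ *ᴿ a ^ᴿ v *ᴿ Gᵛδᵘ ≤ᴿ edges *ᴿ G ^ᴿ v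
        step₂ = ≤ᴿ-pointwise {Pʷ *ᴿ a ^ᴿ v *ᴿ Gᵛδᵘ} {edges *ᴿ G ^ᴿ v} λ n → ≤-reflexive (rearrange n)
          where
          rearrange : ∀ n → seq (Pʷ *ᴿ a ^ᴿ v *ᴿ Gᵛδᵘ) n ≡ seq (edges *ᴿ G ^ᴿ v) n
          rearrange n = begin-equality
            P ^ w * seq (a ^ᴿ v) n * (g * seq (δ ^ᴿ u) n) ≡⟨ cong₂ (λ x y → P ^ w * x * (g * y)) (trans (seq-^ᴿ a v n) (^-distrib-* P (seq Dᵏ n) v)) (seq-^ᴿ δ u n) ⟩
            P ^ w * (P ^ v * seq Dᵏ n ^ v) * (g * seq δ n ^ u) ≡⟨ lem (P ^ w) (P ^ v) (seq Dᵏ n ^ v) g (seq δ n ^ u) ⟩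
            seq δ n ^ u * (P ^ v * P ^ w) * seq Dᵏ n ^ v * g ≡⟨ cong (λ z → seq δ n ^ u * z * seq Dᵏ n ^ v * g) (sym (^-homo-* P v w)) ⟩
            seq δ n ^ u * P ^ u * seq Dᵏ n ^ v * g ≡⟨ cong (λ z → z * seq Dᵏ n ^ v * g) (sym (^-distrib-* (seq δ n) P u)) ⟩
            (seq δ n * P) ^ u * seq Dᵏ n ^ v * g ≡⟨ cong₂ (λ x y → x * y * g) (sym (seq-^ᴿ (δ *ᴿ constᴿ P) u n)) (sym (seq-^ᴿ Dᵏ v n)) ⟩
            seq (edges *ᴿ G ^ᴿ v) n ∎
            where
            open ≤-Reasoning
            g = seq (G ^ᴿ v) n
            lem : ∀ a b c d e → a * (b * c) * (d * e) ≡ e * (b * a) * c * d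
            lem = solve 5 (λ a b c d e → a :* (b :* c) :* (d :* e) := e :* (b :* a) :* c :* d) refl

        step₃ : edges *ᴿ G ^ᴿ v ≤ᴿ count *ᴿ G ^ᴿ v
        step₃ = *ᴿ-monoʳ-≤ {edges} {count} {G ^ᴿ v} 0≤Gᵛ
          (*ᴿ-mono-≤ {(δ *ᴿ constᴿ P) ^ᴿ u} {fromℕ N ^ᴿ u} {Dᵏ ^ᴿ v} {(fromℕ d ^ᴿ k) ^ᴿ v}
            (^ᴿ-NonNeg {Dᵏ} v 0≤Dᵏ) (^ᴿ-NonNeg {fromℕ N} u (constᴿ-NonNeg (0≤ι N)))
            (^ᴿ-mono-≤ {δ *ᴿ constᴿ P} {fromℕ N} u (*ᴿ-NonNeg {δ} {constᴿ P} 0≤δ (constᴿ-NonNeg (<⇒≤ 0<P))) (constᴿ-NonNeg (0≤ι N)) δP≤N)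
            (^ᴿ-mono-≤ {Dᵏ} {fromℕ d ^ᴿ k} v 0≤Dᵏ (^ᴿ-NonNeg {fromℕ d} k (constᴿ-NonNeg (0≤ι d)))
              (^ᴿ-mono-≤ {D} {fromℕ d} k 0≤D (constᴿ-NonNeg (0≤ι d)) D≤d)))

        step₄ : count ≤ᴿ M∏ ^ᴿ v *ᴿ qPʷ
        step₄ = ≤ᴿ-pointwise {count} {M∏ ^ᴿ v *ᴿ qPʷ} λ n → subst₂ _≤_ (left n) (right n) counted
          where
          left : ∀ n → ι N ^ u * ι d ^ (k ℕ.* v) ≡ seq count n
          left n = sym (cong₂ _*_ (seq-^ᴿ (fromℕ N) u n) (trans (seq-^ᴿ (fromℕ d ^ᴿ k) v n)
            (trans (cong (_^ v) (seq-^ᴿ (fromℕ d) k n)) (^-assocʳ (ι d) k v))))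
          right : ∀ n → q * Π (ι ∘ M) ^ v * P ^ w ≡ seq (M∏ ^ᴿ v *ᴿ qPʷ) n
          right n = trans (lem q (Π (ι ∘ M) ^ v) (P ^ w)) (cong (_* (q * P ^ w)) (sym (trans (seq-^ᴿ M∏ v n)
            (cong (_^ v) (seq-∏ᴿ (λ j → fromℕ (M j)) n)))))
            where
            lem : ∀ a b c → a * b * c ≡ b * (a * c)
            lem = solve 3 (λ a b c → a :* b :* c := b :* (a :* c)) refl

        step₅ : M∏ ^ᴿ v *ᴿ qPʷ ≤ᴿ ∏ᴿ 2X ^ᴿ v *ᴿ qPʷ
        step₅ = *ᴿ-monoʳ-≤ {M∏ ^ᴿ v} {∏ᴿ 2X ^ᴿ v} {qPʷ} 0≤qPʷ
          (^ᴿ-mono-≤ {M∏} {∏ᴿ 2X} v (∏ᴿ-NonNeg {f = λ j → fromℕ (M j)} 0≤M) (∏ᴿ-NonNeg {f = 2X} 0≤2X)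
            (∏ᴿ-mono-≤ {f = λ j → fromℕ (M j)} {g = 2X} 0≤M 0≤2X (λ j → proj₂ (A⊂ j (M∈ j)))))
          where
          0≤M : ∀ j → NonNegᴿ (fromℕ (M j))
          0≤M j = constᴿ-NonNeg (0≤ι (M j))

        step₆ : ∏ᴿ 2X ^ᴿ v *ᴿ qPʷ *ᴿ G ^ᴿ v ≤ᴿ Pʷ *ᴿ b ^ᴿ v
        step₆ = ≤ᴿ-eventually {∏ᴿ 2X ^ᴿ v *ᴿ qPʷ *ᴿ G ^ᴿ v} {Pʷ *ᴿ b ^ᴿ v} (always below ⊛ 0≤X∏)
          where
          open ≤-Reasoning
          below : ∀ n → 0ℚ ≤ seq X∏ n → seq (∏ᴿ 2X ^ᴿ v *ᴿ qPʷ *ᴿ G ^ᴿ v) n ≤ seq (Pʷ *ᴿ b ^ᴿ v) n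
          below n 0≤x = begin
            seq (∏ᴿ 2X ^ᴿ v) n * (q * P ^ w) * seq (G ^ᴿ v) n ≡⟨ cong₂ (λ s t → s * (q * P ^ w) * t) 2X-part (seq-^ᴿ G v n) ⟩
            (ι 2 ^ k) ^ v * x ^ v * (q * P ^ w) * g ^ v ≡⟨ lem ((ι 2 ^ k) ^ v) (x ^ v) q (P ^ w) (g ^ v) ⟩
            P ^ w * (q * (ι 2 ^ k) ^ v * (g ^ v * x ^ v)) ≤⟨ *-monoˡ-≤ (^-nonNeg w (<⇒≤ 0<P)) (*-monoʳ-≤
                (0≤* (^-nonNeg v 0≤g) (^-nonNeg v 0≤x)) (≤Cₖ^v (#𝒫small p₀ (⋃ A)))) ⟩
            P ^ w * (c ^ v * (g ^ v * x ^ v)) ≡⟨ cong (P ^ w *_) (sym (trans (seq-^ᴿ b v n) (trans (^-distrib-* c (g * x) v)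
                (cong (c ^ v *_) (^-distrib-* g x v))))) ⟩
            P ^ w * seq (b ^ᴿ v) n ∎
            where
            x = seq X∏ n
            g = seq G n
            0≤g : 0ℚ ≤ g
            0≤g = approxPower-nonNeg n (seq δ n) (seq α n)
            2X-part : seq (∏ᴿ 2X ^ᴿ v) n ≡ (ι 2 ^ k) ^ v * x ^ v
            2X-part = trans (seq-^ᴿ (∏ᴿ 2X) v n) (trans (cong (_^ v) (trans (seq-∏ᴿ 2X n)
                (trans (Π-* (λ _ → ι 2) (λ j → seq (X j) n)) (cong₂ _*_ (Π-const k (ι 2)) (sym (seq-∏ᴿ X n))))))
              (^-distrib-* (ι 2 ^ k) x v))
            lem : ∀ a b c d e → a * b * (c * d) * e ≡ d * (c * a * (e * b))
            lem = solve 5 (λ a b c d e → a :* b :* (c :* d) :* e := d :* (c :* a :* (e :* b))) refl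

        a≤b : a ≤ᴿ b
        a≤b = ^ᴿ-cancel-≤ {a} {b} v 1≤v 0≤b (*ᴿ-cancelˡ-≤ {a ^ᴿ v} {b ^ᴿ v} (^-pos w 0<P)
          (≤ᴿ-trans {Pʷ *ᴿ a ^ᴿ v} {Pʷ *ᴿ a ^ᴿ v *ᴿ Gᵛδᵘ} {Pʷ *ᴿ b ^ᴿ v} step₁
            (≤ᴿ-trans {Pʷ *ᴿ a ^ᴿ v *ᴿ Gᵛδᵘ} {edges *ᴿ G ^ᴿ v} {Pʷ *ᴿ b ^ᴿ v} step₂
              (≤ᴿ-trans {edges *ᴿ G ^ᴿ v} {count *ᴿ G ^ᴿ v} {Pʷ *ᴿ b ^ᴿ v} step₃
                (≤ᴿ-trans {count *ᴿ G ^ᴿ v} {∏ᴿ 2X ^ᴿ v *ᴿ qPʷ *ᴿ G ^ᴿ v} {Pʷ *ᴿ b ^ᴿ v}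
                  (*ᴿ-monoʳ-≤ {count} {∏ᴿ 2X ^ᴿ v *ᴿ qPʷ} {G ^ᴿ v} 0≤Gᵛ
                    (≤ᴿ-trans {count} {M∏ ^ᴿ v *ᴿ qPʷ} {∏ᴿ 2X ^ᴿ v *ᴿ qPʷ} step₄ step₅))
                  step₆)))))

        main : fromℕ (∏ (λ j → card (A j))) ≤ᴿ constᴿ c *ᴿ G *ᴿ (X∏ *ᴿ D⁻ᵏ)
        main = ≤ᴿ-trans {fromℕ (∏ (λ j → card (A j)))} {a *ᴿ D⁻ᵏ} {constᴿ c *ᴿ G *ᴿ (X∏ *ᴿ D⁻ᵏ)}
          (≤ᴿ-eventually {fromℕ (∏ (λ j → card (A j)))} {a *ᴿ D⁻ᵏ} clear)
          (≤ᴿ-trans {a *ᴿ D⁻ᵏ} {b *ᴿ D⁻ᵏ} {constᴿ c *ᴿ G *ᴿ (X∏ *ᴿ D⁻ᵏ)} (*ᴿ-monoʳ-≤ {a} {b} {D⁻ᵏ} 0≤D⁻ᵏ a≤b)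
            (≤ᴿ-pointwise {b *ᴿ D⁻ᵏ} {constᴿ c *ᴿ G *ᴿ (X∏ *ᴿ D⁻ᵏ)} (λ n → ≤-reflexive (lem c (seq G n) (seq X∏ n) (seq D⁻ᵏ n)))))
          where
          lem : ∀ c g x i → c * (g * x) * i ≡ c * g * (x * i)
          lem = solve 4 (λ c g x i → c :* (g :* x) :* i := c :* g :* (x :* i)) refl
          clear : Eventually (λ n → ι (∏ (λ j → card (A j))) ≤ P * seq Dᵏ n * inv (seq Dᵏ n))
          clear = let (e , 0<e , m , h) = eventually-positive {Dᵏ} D^k>0 in m , λ n m≤n → ≤-reflexive
            (trans (ι-∏ (λ j → card (A j))) (sym (trans (*-assoc P (seq Dᵏ n) (inv (seq Dᵏ n)))
              (trans (cong (P *_) (inv-inverse (<-≤-trans 0<e (h n m≤n)))) (*-identityʳ P)))))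

  -- The exponent (k + 1/E)/(k - 1) is u/v with u = kE + 1 and v = (k - 1)E; here k = k₂ + 3, E = e + 2,
  -- and E is so large that both exponents of the theorem are at least u/v.
  module Exponents (k₂ : ℕ) (ε : ℝ) (0<ε : 0ᴿ <ᴿ ε) where

    k K : ℕ
    k = suc (suc (suc k₂))
    K = suc (suc k₂)

    r : ℚ
    r = ℤ.+ 1 / K

    r≡ : r ≡ 1/suc (suc k₂)
    r≡ = ↥p/↧p≡p (1/suc (suc k₂))

    0<r : 0ℚ < r
    0<r = subst (0ℚ <_) (sym r≡) (0<1/suc (suc k₂))

    ιK*r : ι K * r ≡ 1ℚ
    ιK*r = trans (cong (ι K *_) r≡) (1/suc-inverse (suc k₂))

    private
      ε₀ = proj₁ (eventually-positive {ε} 0<ε)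
      0<ε₀ = proj₁ (proj₂ (eventually-positive {ε} 0<ε))
      ε₀≤ε : Eventually (λ n → ε₀ ≤ seq ε n)
      ε₀≤ε = proj₂ (proj₂ (eventually-positive {ε} 0<ε))
      0<ε₀r = 0<* 0<ε₀ 0<r

    -- w = u - v and v′ = v - w = (k - 2)E - 1. The shift by 2 in E makes v′ ≥ 1 already for k = 3.
    e E w v′ : ℕ
    e = proj₁ (archimedean (inv (ε₀ * r)))
    E = suc (suc e)
    w = suc E
    v′ = suc e ℕ.+ k₂ ℕ.* E

    v≡ : w ℕ.+ v′ ≡ K ℕ.* E
    v≡ = sym (ℕ.+-suc E v′)

    u≡ : w ℕ.+ v′ ℕ.+ w ≡ suc (k ℕ.* E)
    u≡ = trans (ℕ.+-suc (w ℕ.+ v′) E) (cong suc (trans (ℕ.+-comm (w ℕ.+ v′) E) (cong (E ℕ.+_) v≡)))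

    u<kw : suc (w ℕ.+ v′ ℕ.+ w) ℕ.≤ k ℕ.* w
    -- kw = kE + k exceeds u = kE + 1 by k - 1.
    u<kw = ℕ.≤-trans (ℕ.≤-reflexive (cong suc u≡)) (ℕ.≤-trans (ℕ.+-monoˡ-≤ (k ℕ.* E) (ℕ.s≤s (ℕ.s≤s (ℕ.z≤n {suc k₂}))))
      (ℕ.≤-reflexive (sym (ℕ.*-suc k E))))

    open Bound K w v′ (ℕ.s≤s ℕ.z≤n) (ℕ.s≤s ℕ.z≤n) u<kw public hiding (k)
    open Constants K u 1≤u using (threshold)

    Small : ℝ → Set
    Small α = Eventually (λ n → seq α n * ι v + ι u ≤ 0ℚ)

    1≤εrE : ∀ {x} → ε₀ ≤ x → 1ℚ ≤ x * r * ι E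
    1≤εrE {x} ε₀≤x = ≤-trans (≤-reflexive (sym (inv-inverse 0<ε₀r)))
      (*-mono-≤ (<⇒≤ 0<ε₀r) (0≤ι E) (*-monoʳ-≤ (<⇒≤ 0<r) ε₀≤x)
        (≤-trans (proj₂ (archimedean (inv (ε₀ * r)))) (ι-mono (ℕ.m≤n+m e 2))))

    -- The equation says αv + u = 1 - x. Here x is εE/(k-1) for the first exponent of the theorem
    -- and ε(k-1)E for the second.
    small-by : ∀ α x → 1ℚ ≤ x → α * (ι K * ι E) + (1ℚ + ι k * ι E) ≡ 1ℚ - x → α * ι v + ι u ≤ 0ℚ
    small-by α x 1≤x eq = subst (_≤ 0ℚ) (sym (trans
        (cong₂ (λ a b → α * a + b) (trans (cong ι v≡) (ι-* K E)) (trans (cong ι u≡) (trans (ι-suc (k ℕ.* E)) (cong (1ℚ +_) (ι-* k E)))))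
        eq))
      (≤-trans (+-monoʳ-≤ 1ℚ (neg-antimono-≤ 1≤x)) (≤-reflexive (+-inverseʳ 1ℚ)))

    exponent-small : Small (-ᴿ ((fromℕ k +ᴿ ε ÷ᴿ K) ÷ᴿ K))
    exponent-small = always (λ n ε₀≤x → small-by (- ((ι k + seq ε n * r) * r)) (seq ε n * r * ι E) (1≤εrE ε₀≤x) (identity (seq ε n) (ι k) r (ι K) (ι E) ιK*r)) ⊛ ε₀≤ε
      where
      identity : ∀ x k r K E → K * r ≡ 1ℚ → - ((k + x * r) * r) * (K * E) + (1ℚ + k * E) ≡ 1ℚ - x * r * E
      identity x k r K E eq = trans
        (solve 5 (λ x k r K E → :- ((k :+ x :* r) :* r) :* (K :* E) :+ (con 1ℚ :+ k :* E)
          := :- ((k :+ x :* r) :* (K :* r) :* E) :+ (con 1ℚ :+ k :* E)) refl x k r K E)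
        (trans (cong (λ z → - ((k + x * r) * z * E) + (1ℚ + k * E)) eq)
          (solve 4 (λ x k r E → :- ((k :+ x :* r) :* con 1ℚ :* E) :+ (con 1ℚ :+ k :* E) := con 1ℚ :- x :* r :* E) refl x k r E))

    exponent′-small : Small (-ᴿ (fromℕ k ÷ᴿ K) +ᴿ -ᴿ ε)
    exponent′-small = always (λ n ε₀≤x → small-by (- (ι k * r) + - seq ε n) (seq ε n * ι K * ι E)
        (≤-trans (1≤εrE ε₀≤x) (*-monoʳ-≤ (0≤ι E) (*-monoˡ-≤ (≤-trans (<⇒≤ 0<ε₀) ε₀≤x) r≤K)))
        (identity (seq ε n) (ι k) r (ι K) (ι E) ιK*r)) ⊛ ε₀≤ε
      where
      r≤K : r ≤ ι K
      r≤K = ≤-trans (≤-reflexive r≡) (≤-trans (1/suc≤1 (suc k₂)) (ι-mono {1} {K} (ℕ.s≤s ℕ.z≤n)))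
      identity : ∀ x k r K E → K * r ≡ 1ℚ → (- (k * r) + - x) * (K * E) + (1ℚ + k * E) ≡ 1ℚ - x * K * E
      identity x k r K E eq = trans
        (solve 5 (λ x k r K E → (:- (k :* r) :+ :- x) :* (K :* E) :+ (con 1ℚ :+ k :* E)
          := :- (k :* (K :* r) :* E) :- x :* K :* E :+ (con 1ℚ :+ k :* E)) refl x k r K E)
        (trans (cong (λ z → - (k * z * E) - x * K * E + (1ℚ + k * E)) eq)
          (solve 4 (λ x k K E → :- (k :* con 1ℚ :* E) :- x :* K :* E :+ (con 1ℚ :+ k :* E) := con 1ℚ :- x :* K :* E) refl x k K E))

    P : ℕ
    P = proj₁ threshold

    large-p₀-bound : ∀ p₀ → P ℕ.≤ p₀ → (C : Configuration k) (let open Configuration C) (α : ℝ) → Small α →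
      fromℕ (∏ (λ j → card (A j))) ≤ᴿ fromℕ (Cₖ (#𝒫small p₀ (⋃ A))) *ᴿ δ ^ᴿ[ 0<δ ] α *ᴿ (∏ᴿ X /ᴿ D ^ᴿ k [ D^k>0 ])
    large-p₀-bound p₀ P≤p₀ = bound p₀ (λ n p₀≤n → proj₁ (proj₂ threshold n (ℕ.≤-trans P≤p₀ p₀≤n))) (proj₂ (proj₂ threshold p₀ P≤p₀))

    -- At p₀ = P the small primes lie among the P + 1 integers from 0 to P, which makes the constant
    -- independent of the sets.
    uniform-bound : (C : Configuration k) (let open Configuration C) (α : ℝ) → Small α →
      fromℕ (∏ (λ j → card (A j))) ≤ᴿ fromℕ (Cₖ (suc P)) *ᴿ δ ^ᴿ[ 0<δ ] α *ᴿ (∏ᴿ X /ᴿ D ^ᴿ k [ D^k>0 ])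
    uniform-bound C α α≤ = ≤ᴿ-trans {fromℕ (∏ (λ j → card (A j)))} {c *ᴿ G *ᴿ R} {c′ *ᴿ G *ᴿ R} (large-p₀-bound P ℕ.≤-refl C α α≤)
      (*ᴿ-monoʳ-≤ {c *ᴿ G} {c′ *ᴿ G} {R} (∏X/D^k-NonNeg C) (*ᴿ-monoʳ-≤ {c} {c′} {G} (^ᴿ[]-NonNeg δ 0<δ α)
        (≤ᴿ-pointwise {c} {c′} (λ _ → ι-mono (ℕ.^-monoʳ-≤ (2 ℕ.^ (4 ℕ.* k)) {{ℕ.m^n≢0 2 (4 ℕ.* k)}} (ℕ.s≤s #≤))))))
      where
      open Configuration C
      c = fromℕ (Cₖ (#𝒫small P (⋃ A)))
      c′ = fromℕ (Cₖ (suc P))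
      G = δ ^ᴿ[ 0<δ ] α
      R = ∏ᴿ X /ᴿ D ^ᴿ k [ D^k>0 ]
      #≤ : #𝒫small P (⋃ A) ℕ.≤ suc P
      #≤ = ℕ.≤-trans (length-filter (𝒫? (⋃ A)) (upTo (suc P))) (ℕ.≤-reflexive (length-upTo (suc P)))

open Proof using (module Exponents)
open import Data.Nat.Base using (ℕ; suc; _+_; _*_; _∸_; _^_; _≤_)
open import Data.Product.Base using (∃-syntax; _×_; _,_)

theorem1p1 : (k : ℕ) (k≥3 : 3 ≤ k) (ε : ℝ) → 0ᴿ <ᴿ ε → ε <ᴿ 1ᴿ →
    let instance _ = k-1≢0 k≥3 in
    (∃[ P ] ((p₀ : ℕ) → P ≤ p₀ → (S : Configuration k) →
    let open Configuration S in
    fromℕ (∏ (λ i → card (A i))) ≤ᴿ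
    fromℕ ((2 ^ (4 * k)) ^ (1 + #𝒫small p₀ (⋃ A)))
    *ᴿ δ ^ᴿ[ 0<δ ] (-ᴿ ((fromℕ k +ᴿ ε ÷ᴿ (k ∸ 1)) ÷ᴿ (k ∸ 1)))
    *ᴿ (∏ᴿ X /ᴿ D ^ᴿ k [ D^k>0 ])))
    × (∃[ C ] ((S : Configuration k) →
    let open Configuration S in
    fromℕ (∏ (λ i → card (A i))) ≤ᴿ
    C *ᴿ δ ^ᴿ[ 0<δ ] (-ᴿ (fromℕ k ÷ᴿ (k ∸ 1)) +ᴿ -ᴿ ε)
    *ᴿ (∏ᴿ X /ᴿ D ^ᴿ k [ D^k>0 ])))
theorem1p1 1 (_≤_.s≤s ()) ε 0<ε _
theorem1p1 2 (_≤_.s≤s (_≤_.s≤s ())) ε 0<ε _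
theorem1p1 (suc (suc (suc k₂))) k≥3 ε 0<ε _ =
  (P , λ p₀ P≤p₀ S → large-p₀-bound p₀ P≤p₀ S (-ᴿ ((fromℕ k +ᴿ ε ÷ᴿ K) ÷ᴿ K)) exponent-small) ,
  (fromℕ (Cₖ (suc P)) , λ S → uniform-bound S (-ᴿ (fromℕ k ÷ᴿ K) +ᴿ -ᴿ ε) exponent′-small)
  where open Exponents k₂ ε 0<ε
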